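{- Let $\Sigma$ be a closed, connected, orientable surface, let $\mathcal P$ be a polygonal subdivision of $\Sigma$, let $\mathbb D$ be a division ring and let $n\ge 1$. Then the incidence theorem in $\mathbb P^n(\mathbb D)$ associated with $\mathcal P$ holds if and only if at least one of the following conditions is satisfied: (1) $\mathcal P$ has a face with more than $n+1$ vertices; (2) $\mathbb D$ is a field (i.e. commutative); (3) $\Sigma$ is a sphere.
   Context: A polygonal subdivision of a closed, connected, orientable surface $\Sigma$ is a cellular decomposition of $\Sigma$ in which the closure of every $2$-cell (face) is an embedded polygon with at least two vertices. $\mathbb P^n(\mathbb D)$ denotes the left projective space of dimension $n$ over $\mathbb D$, i.e. the set of rank-one left submodules of $\mathbb D^{n+1}$. Points are linearly independent if some (equivalently any) choice of representing vectors in $\mathbb D^{n+1}$ is left-linearly independent; three points are collinear if their representing vectors span a submodule of rank at most $2$. A realization of $\mathcal P$ in $\mathbb P^n(\mathbb D)$ is an assignment of a point of $\mathbb P^n(\mathbb D)$ to each vertex and to each edge of $\mathcal P$ such that: (i) if an edge $e$ joins vertices $v$ and $w$, then the points assigned to $e$, $v$, $w$ are collinear and pairwise distinct; (ii) the points assigned to the vertices of each face are linearly independent. Given a realization, the Menelaus condition holds for a face if the points assigned to the edges of that face are linearly dependent. The incidence theorem in $\mathbb P^n(\mathbb D)$ associated with $\mathcal P$ is the statement: for every realization of $\mathcal P$ in $\mathbb P^n(\mathbb D)$, if the Menelaus condition holds for all faces except one, then it also holds for the remaining face. -}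

module Defs where

open import Level using (Level; _⊔_) renaming (suc to lsuc)
open import Data.Nat using (ℕ; zero; suc; _<_; _≤_)
open import Data.Nat as ℕ using ()
open import Data.Fin using (Fin; toℕ) renaming (zero to fz; suc to fs; _≤?_ to _≤ᶠ?_; _≤_ to _≤ᶠ_)
open import Data.Fin.Properties using (all?)
open import Data.Fin.Permutation using (Permutation′; _⟨$⟩ʳ_)
open import Data.Product using (Σ; ∃; _×_; _,_)
open import Data.Sum using (_⊎_)
open import Data.Bool using (Bool; if_then_else_)
open import Relation.Nullary using (¬_; Dec; yes; no)
open import Relation.Nullary.Decidable using (⌊_⌋)
open import Relation.Binary.PropositionalEquality using (_≡_; _≢_)
open import Algebra.Bundles using (Ring)

record DivisionRing (c ℓ : Level) : Set (lsuc (c ⊔ ℓ)) where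
  field
    ring : Ring c ℓ
  open Ring ring public
  field
    0≉1     : 0# ≉ 1#
    inverse : ∀ x → x ≉ 0# → Σ Carrier (λ y → (x * y ≈ 1#) × (y * x ≈ 1#))

iter : ∀ {a} {A : Set a} → (A → A) → ℕ → A → A
iter f zero    x = x
iter f (suc k) x = f (iter f k x)

-- Combinatorial (oriented) maps.
-- A cellular decomposition of a closed, connected, orientable surface is
-- encoded by its darts (= oriented edges / half-edges) Fin m, with
--   σ : rotation of darts around their origin vertex (vertices = σ-orbits),
--   α : fixed-point-free involution reversing a dart (edges = α-orbits),
--   φ = σ ∘ α : face permutation (faces = φ-orbits).
-- Dart d goes from vertex [d] to vertex [α d]; the boundary of the face
-- through d is d , φ d , φ² d , … with vertices [φⁱ d] and edges [φⁱ d].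

data Reach {m : ℕ} (σ α : Fin m → Fin m) (d : Fin m) : Fin m → Set where
  here  : Reach σ α d d
  stepσ : ∀ {e} → Reach σ α d e → Reach σ α d (σ e)
  stepα : ∀ {e} → Reach σ α d e → Reach σ α d (α e)

record OrientedMap : Set where
  field
    m         : ℕ
    σ α       : Permutation′ m
    nonempty  : 0 < m
    α-invol   : ∀ d → α ⟨$⟩ʳ (α ⟨$⟩ʳ d) ≡ d
    α-fpf     : ∀ d → α ⟨$⟩ʳ d ≢ d
    connected : ∀ d d′ → Reach (σ ⟨$⟩ʳ_) (α ⟨$⟩ʳ_) d d′

  Dart : Set
  Dart = Fin m

  σf αf φ : Dart → Dart
  σf d = σ ⟨$⟩ʳ d
  αf d = α ⟨$⟩ʳ d
  φ  d = σ ⟨$⟩ʳ (α ⟨$⟩ʳ d)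

  SameVertex : Dart → Dart → Set
  SameVertex d d′ = ∃ λ k → iter σf k d ≡ d′

  SameEdge : Dart → Dart → Set
  SameEdge d d′ = (d′ ≡ d) ⊎ (d′ ≡ αf d)

  SameFace : Dart → Dart → Set
  SameFace d d′ = ∃ λ k → iter φ k d ≡ d′

  FaceSize : Dart → ℕ → Set
  FaceSize d k = (0 < k) × (iter φ k d ≡ d)
                 × (∀ j → 0 < j → j < k → iter φ j d ≢ d)

  bd : Dart → ℕ → Dart
  bd d i = iter φ i d

  private
    countB : ∀ {k} → (Fin k → Bool) → ℕ
    countB {zero}  p = 0
    countB {suc k} p = (if p fz then 1 else 0) ℕ.+ countB (λ i → p (fs i))

  isOrbitMin? : (f : Dart → Dart) → (d : Dart) → Dec (∀ (k : Fin m) → d ≤ᶠ iter f (toℕ k) d)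
  isOrbitMin? f d = all? (λ k → d ≤ᶠ? iter f (toℕ k) d)

  #orbits : (Dart → Dart) → ℕ
  #orbits f = countB (λ d → ⌊ isOrbitMin? f d ⌋)

  #V #E #F : ℕ
  #V = #orbits σf
  #E = #orbits αf
  #F = #orbits φ

-- Polygonal subdivision: the closure of every face is an embedded polygon
-- with at least two vertices, i.e. the boundary walk of every face has
-- length ≥ 2 and visits pairwise distinct vertices and pairwise distinct edges.
record PolygonalSubdivision : Set where
  field
    map : OrientedMap
  open OrientedMap map public
  field
    face-≥2        : ∀ d k → FaceSize d k → 2 ≤ k
    face-vertices  : ∀ d k → FaceSize d k → (i j : Fin k) → toℕ i ≢ toℕ j →
                     ¬ SameVertex (bd d (toℕ i)) (bd d (toℕ j))
    face-edges     : ∀ d k → FaceSize d k → (i j : Fin k) → toℕ i ≢ toℕ j →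
                     ¬ SameEdge (bd d (toℕ i)) (bd d (toℕ j))

  IsSphere : Set
  IsSphere = #V ℕ.+ #F ≡ #E ℕ.+ 2

-- Left linear algebra over a division ring, projective space ℙⁿ(D)
-- (points represented by nonzero vectors of Dⁿ⁺¹ up to left scaling)

module LinAlg {c ℓ} (D : DivisionRing c ℓ) (n : ℕ) where
  open DivisionRing D

  Vector : Set c
  Vector = Fin (suc n) → Carrier

  sumFin : ∀ {k} → (Fin k → Carrier) → Carrier
  sumFin {zero}  f = 0#
  sumFin {suc k} f = f fz + sumFin (λ i → f (fs i))

  CombZero : ∀ {k} → (Fin k → Carrier) → (Fin k → Vector) → Set ℓ
  CombZero c v = ∀ j → sumFin (λ i → c i * v i j) ≈ 0#

  LinIndep : ∀ {k} → (Fin k → Vector) → Set (c ⊔ ℓ)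
  LinIndep v = ∀ cs → CombZero cs v → ∀ i → cs i ≈ 0#

  LinDep : ∀ {k} → (Fin k → Vector) → Set (c ⊔ ℓ)
  LinDep v = Σ (_ → Carrier) λ cs → CombZero cs v × ∃ λ i → cs i ≉ 0#

  NonZero : Vector → Set ℓ
  NonZero u = ∃ λ j → u j ≉ 0#

  SamePoint : Vector → Vector → Set (c ⊔ ℓ)
  SamePoint u v = Σ Carrier λ a → ∀ j → v j ≈ a * u j

  three : Vector → Vector → Vector → Fin 3 → Vector
  three u v w fz           = u
  three u v w (fs fz)      = v
  three u v w (fs (fs fz)) = w

  Collinear : Vector → Vector → Vector → Set (c ⊔ ℓ)
  Collinear u v w = LinDep (three u v w)

module _ (P : PolygonalSubdivision) {c ℓ} (D : DivisionRing c ℓ) (n : ℕ) where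
  open PolygonalSubdivision P
  open LinAlg D n

  -- vx d : point of the origin vertex of dart d; ey d : point of its edge
  record Realization : Set (c ⊔ ℓ) where
    field
      vx ey      : Dart → Vector
      vx-nonzero : ∀ d → NonZero (vx d)
      ey-nonzero : ∀ d → NonZero (ey d)
      vx-wd      : ∀ d → SamePoint (vx d) (vx (σf d))
      ey-wd      : ∀ d → SamePoint (ey d) (ey (αf d))
      collinear  : ∀ d → Collinear (ey d) (vx d) (vx (αf d))
      distinct₁  : ∀ d → ¬ SamePoint (ey d) (vx d)
      distinct₂  : ∀ d → ¬ SamePoint (ey d) (vx (αf d))
      distinct₃  : ∀ d → ¬ SamePoint (vx d) (vx (αf d))
      face-indep : ∀ d k → FaceSize d k → LinIndep (λ (i : Fin k) → vx (bd d (toℕ i)))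

    Menelaus : Dart → Set (c ⊔ ℓ)
    Menelaus d = ∀ k → FaceSize d k → LinDep (λ (i : Fin k) → ey (bd d (toℕ i)))

  IncidenceTheorem : Set (c ⊔ ℓ)
  IncidenceTheorem = ∀ (R : Realization) (d : Dart) →
    (∀ d′ → ¬ SameFace d d′ → Realization.Menelaus R d′) → Realization.Menelaus R d

  HasBigFace : Set
  HasBigFace = ∃ λ d → ∃ λ k → FaceSize d k × (suc n < k)

IsCommutative : ∀ {c ℓ} → DivisionRing c ℓ → Set (c ⊔ ℓ)
IsCommutative D = ∀ a b → a * b ≈ b * a
  where open DivisionRing D

{-# OPTIONS --safe #-}

-- In the coordinates given by the vertices, a realization is a connection with
-- values in the units of D on the darts, and Menelaus' condition for a face says
-- that the holonomy around it is trivial.  Gluing the faces one after another to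
-- the exceptional face turns its boundary into a closed word W in which every
-- remaining edge is traversed once in each direction; the holonomy of W is that
-- of the exceptional face, and it vanishes if D is commutative.  Cancelling
-- adjacent inverse letters preserves V - E + F, and the surface is a sphere iff W
-- cancels completely.  Otherwise the reduced word contains ... x ... y ... x⁻¹ ...
-- y⁻¹ ..., so that any commutator occurs as holonomy of the exceptional face.
-- Realizing this connection requires vertices in general position, hence D
-- infinite: this is Wedderburn's theorem.

module Submission where

open import Defs
open import Level using (Level; _⊔_; 0ℓ; Setω)
open import Data.Nat as ℕ using (ℕ; zero; suc; _<_; _≤_; z≤n; s≤s)
import Data.Nat.Properties as ℕₚ
open import Data.Nat.Solver using (module +-*-Solver)
open import Data.Fin as Fin using (Fin; toℕ; fromℕ<) renaming (zero to fz; suc to fs)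
import Data.Fin.Properties as Finₚ
open import Data.Bool using (Bool; true; false; if_then_else_; T)
open import Data.Bool.Properties using (T?)
open import Data.Empty using (⊥; ⊥-elim)
open import Data.Unit using (⊤; tt)
open import Data.Maybe using (Maybe; just; nothing)
open import Data.Product using (Σ; ∃; ∃₂; _×_; _,_; proj₁; proj₂)
open import Data.Sum using (_⊎_; inj₁; inj₂)
open import Data.List using (List; []; _∷_; _++_; _∷ʳ_; [_]; length; map; concatMap; filter; applyUpTo; allFin; tabulate; lookup)
import Data.List.Properties as Listₚ
open import Data.List.Membership.Propositional using (_∈_; _∉_; find)
open import Data.List.Membership.Propositional.Properties using (∈-++⁺ˡ; ∈-++⁺ʳ; ∈-++⁻; ∈-insert; ∈-∃++; ∈-map⁺; ∈-map⁻; ∈-filter⁺; ∈-filter⁻; ∈-applyUpTo⁺; ∈-applyUpTo⁻; ∈-allFin; ∈-lookup)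
open import Data.List.Relation.Unary.Any as Any using (here; there)
open import Data.List.Relation.Unary.All as All using (All; []; _∷_)
import Data.List.Relation.Unary.All.Properties as Allₚ
open import Data.List.Relation.Unary.AllPairs using (AllPairs; []; _∷_)
open import Data.List.Relation.Unary.Unique.Propositional using (Unique)
import Data.List.Relation.Unary.Unique.Propositional.Properties as Uniqueₚ
open import Data.List.Relation.Binary.Permutation.Propositional using (_↭_; ↭-refl; ↭-sym; ↭-trans; ↭-prep; ↭⇒↭ₛ)
import Data.List.Relation.Binary.Permutation.Setoid.Properties as PermSetoidₚ
import Data.List.Relation.Binary.Permutation.Propositional as Perm
import Data.List.Relation.Binary.Permutation.Propositional.Properties as Permₚ
open import Data.Fin.Permutation as FinPerm using (_⟨$⟩ˡ_)
import Data.List.Membership.DecPropositional as DecMembership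
open import Relation.Binary using (tri<; tri≈; tri>)
open import Relation.Nullary using (¬_; Dec; yes; no)
open import Relation.Nullary.Decidable using (⌊_⌋; toWitness; fromWitness; ¬?)
open import Relation.Binary.PropositionalEquality as ≡ using (_≡_; _≢_; refl; sym; trans; cong; cong₂; subst; setoid)
open import Function using (_∘_; id)
open import Function.Bundles using (_⇔_; mk⇔; Equivalence)
open import Data.Nat.Divisibility using (_∣_; divides; ∣m+n∣m⇒∣n; ∣⇒≤)
open import Data.List.Relation.Unary.Any.Properties using (lookup-index)
open import Algebra.Bundles using (Ring; Group; RawRing)
import Algebra.Structures
open import Algebra.Morphism.Structures using (IsRingMonomorphism)
import Algebra.Morphism.RingMonomorphism as RingMonomorphism
open import Axiom.ExcludedMiddle using (ExcludedMiddle)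
import Algebra.Construct.Flip.Op as Op
open import Data.Vec.Functional using (insertAt)
import Data.Vec.Functional.Properties as VecFₚ

-- Lists and orbits

-- The link between spheres and complete cancellation is a count. With `c` cancellations and `2h`
-- letters left, counting edges turns the sphere condition into `#V ≡ c + h + 1`. A nonempty reduced
-- word meets every vertex on it at two positions, which gives `#V ≤ c + h`. A complete cancellation
-- can be undone to a labelling of the vertices with `c + 1` values, which gives `#V ≥ c + 1`. This
-- labelling must be carried over the glued edges exactly as a connection must, so both come from
-- one extension lemma, applied to pairs of end labels and to units of the ring. Edge points are
-- normalized as `U d - a d * U (αf d)`. The minus sign makes the product in Menelaus' condition
-- equal to 1 for polygons of every length, and makes `a` invert when the edge is reversed.
-- Wedderburn's theorem is reached without cyclotomic polynomials. In a minimal counterexample the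
-- centralizer `K` of a noncentral element is commutative, and Artin's independence argument gives
-- `[D : K] = [K : Z]`. This fixes the size of `K`, hence that of every noncentral conjugacy class,
-- and divisibility finishes.

module _ {a} {A : Set a} where

  split-∈ : ∀ {x : A} {ys} → x ∈ ys → ∃₂ λ us vs → ys ≡ us ++ x ∷ vs
  split-∈ = ∈-∃++

  length-insert : ∀ (us : List A) {x vs} → length (us ++ x ∷ vs) ≡ suc (length (us ++ vs))
  length-insert us {x} {vs} = Permₚ.↭-length (Permₚ.shift x us vs)

  Unique-resp-↭ : ∀ {xs ys : List A} → xs ↭ ys → Unique xs → Unique ys
  Unique-resp-↭ p = PermSetoidₚ.Unique-resp-↭ (setoid A) (↭⇒↭ₛ p)

  ∉-of-Unique : ∀ {x : A} us {vs} → Unique (us ++ x ∷ vs) → x ∉ us ++ vs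
  ∉-of-Unique us {vs} u = Uniqueₚ.Unique[x∷xs]⇒x∉xs (Unique-resp-↭ (Permₚ.shift _ us vs) u)

  Unique-remove : ∀ {x : A} us {vs} → Unique (us ++ x ∷ vs) → Unique (us ++ vs)
  Unique-remove us {vs} u with Unique-resp-↭ (Permₚ.shift _ us vs) u
  ... | _ ∷ u′ = u′

  Unique-++ˡ : ∀ {xs ys : List A} → Unique (xs ++ ys) → Unique xs
  Unique-++ˡ {[]} _ = []
  Unique-++ˡ {x ∷ xs} (x≢ ∷ u) = Allₚ.++⁻ˡ xs x≢ ∷ Unique-++ˡ u

  Unique-++-disjoint : ∀ {xs ys : List A} {x} → Unique (xs ++ ys) → x ∈ xs → x ∉ ys
  Unique-++-disjoint {_ ∷ xs} (x≢ ∷ u) (here refl) x∈ys = All.lookup x≢ (∈-++⁺ʳ xs x∈ys) refl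
  Unique-++-disjoint (_ ∷ u) (there x∈xs) x∈ys = Unique-++-disjoint u x∈xs x∈ys

  ∈-remove : ∀ {x y : A} us {vs} → x ≢ y → x ∈ us ++ y ∷ vs → x ∈ us ++ vs
  ∈-remove us x≢y x∈ with ∈-++⁻ us x∈
  ... | inj₁ p = ∈-++⁺ˡ p
  ... | inj₂ (here x≡y) = ⊥-elim (x≢y x≡y)
  ... | inj₂ (there p) = ∈-++⁺ʳ us p

  ∈-unremove : ∀ {x y : A} us {vs} → x ∈ us ++ vs → x ∈ us ++ y ∷ vs
  ∈-unremove us x∈ with ∈-++⁻ us x∈
  ... | inj₁ p = ∈-++⁺ˡ p
  ... | inj₂ p = ∈-++⁺ʳ us (there p)

  Unique-⊆⇒length-≤ : ∀ {xs ys : List A} → Unique xs → (∀ {x} → x ∈ xs → x ∈ ys) →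
                      length xs ≤ length ys
  Unique-⊆⇒length-≤ [] _ = z≤n
  Unique-⊆⇒length-≤ {x ∷ xs} (x≢ ∷ u) sub with split-∈ (sub (here refl))
  ... | us , vs , refl = ℕₚ.≤-trans (s≤s (Unique-⊆⇒length-≤ u sub′)) (ℕₚ.≤-reflexive (sym (length-insert us)))
    where
    sub′ : ∀ {y} → y ∈ xs → y ∈ us ++ vs
    sub′ y∈ = ∈-remove us (λ y≡x → All.lookup x≢ y∈ (sym y≡x)) (sub (there y∈))

  Unique-map : ∀ {b} {B : Set b} (f : A → B) {xs} → Unique xs →
               (∀ {x y} → x ∈ xs → y ∈ xs → f x ≡ f y → x ≡ y) → Unique (map f xs)
  Unique-map f [] inj = []
  Unique-map f {x ∷ xs} (x≢ ∷ u) inj =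
    All.tabulate (λ {z} z∈ fx≡z → let y , y∈ , z≡ = ∈-map⁻ f z∈ in
                   All.lookup x≢ y∈ (inj (here refl) (there y∈) (trans fx≡z z≡)))
    ∷ Unique-map f u (λ p q → inj (there p) (there q))

infixl 8 _[_↦_]

abstract
  _[_↦_] : ∀ {m a} {A : Set a} → (Fin m → A) → Fin m → A → Fin m → A
  (f [ k ↦ v ]) x with x Finₚ.≟ k
  ... | yes _ = v
  ... | no _  = f x

  ↦-≡ : ∀ {m a} {A : Set a} {f : Fin m → A} {k v} → (f [ k ↦ v ]) k ≡ v
  ↦-≡ {k = k} with k Finₚ.≟ k
  ... | yes _  = refl
  ... | no k≢k = ⊥-elim (k≢k refl)

  ↦-≢ : ∀ {m a} {A : Set a} {f : Fin m → A} {k v x} → x ≢ k → (f [ k ↦ v ]) x ≡ f x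
  ↦-≢ {k = k} {x = x} x≢k with x Finₚ.≟ k
  ... | yes x≡k = ⊥-elim (x≢k x≡k)
  ... | no _    = refl

least : ∀ {p} {P : ℕ → Set p} → (∀ n → Dec (P n)) → ∀ n → P n →
        ∃ λ k → P k × k ≤ n × (∀ j → j < k → ¬ P j)
least P? zero p = 0 , p , z≤n , λ _ ()
least P? (suc n) p with P? 0
... | yes p₀ = 0 , p₀ , z≤n , λ _ ()
... | no ¬p₀ with least (P? ∘ suc) n p
...   | k , pk , k≤n , min = suc k , pk , s≤s k≤n , below
  where
  below : ∀ j → j < suc k → ¬ _
  below zero _ = ¬p₀
  below (suc j) (s≤s j<k) = min j j<k

module Orbits {m : ℕ} (f : Fin m → Fin m) (f-inj : ∀ {x y} → f x ≡ f y → x ≡ y) where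

  SameOrbit : Fin m → Fin m → Set
  SameOrbit d e = ∃ λ k → iter f k d ≡ e

  IsPeriod : Fin m → ℕ → Set
  IsPeriod d k = (0 < k) × (iter f k d ≡ d) × (∀ j → 0 < j → j < k → iter f j d ≢ d)

  iter-+ : ∀ i j d → iter f (i ℕ.+ j) d ≡ iter f i (iter f j d)
  iter-+ zero j d = refl
  iter-+ (suc i) j d = cong f (iter-+ i j d)

  iter-f : ∀ i d → iter f i (f d) ≡ iter f (suc i) d
  iter-f zero d = refl
  iter-f (suc i) d = cong f (iter-f i d)

  iter-inj : ∀ i {d e} → iter f i d ≡ iter f i e → d ≡ e
  iter-inj zero eq = eq
  iter-inj (suc i) eq = iter-inj i (f-inj eq)

  iter-cancel : ∀ {i j d} → i ≤ j → iter f i d ≡ iter f j d → iter f (j ℕ.∸ i) d ≡ d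
  iter-cancel {i} {j} {d} i≤j eq = iter-inj i (trans (sym (iter-+ i (j ℕ.∸ i) d))
    (trans (cong (λ n → iter f n d) (ℕₚ.m+[n∸m]≡n i≤j)) (sym eq)))

  abstract
    -- Pigeonhole on `m + 1` iterates; injectivity cancels the common initial part, so the orbit
    -- returns to `d` itself. The exponent is stored minus one, which makes `orbit d` a cons by
    -- computation. The bound by `m` ensures that `isOrbitMin?`, which inspects `m` iterates, sees
    -- the whole orbit.
    period′ : ∀ d → ∃ λ k → (iter f (suc k) d ≡ d) × k < m × (∀ j → j < k → iter f (suc j) d ≢ d)
    period′ d with Finₚ.pigeonhole (ℕₚ.n<1+n m) (λ i → iter f (toℕ i) d)
    ... | i , j , i<j , eq with toℕ j ℕ.∸ toℕ i in j∸i | iter-cancel {d = d} (ℕₚ.<⇒≤ i<j) eq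
    ...   | zero | _ = ⊥-elim (ℕₚ.m>n⇒m∸n≢0 i<j j∸i)
    ...   | suc n | ret with least (λ n → iter f (suc n) d Finₚ.≟ d) n ret
    ...     | k , p , k≤n , min = k , p , ℕₚ.≤-trans (s≤s k≤n) suc-n≤m , min
      where
      suc-n≤m : suc n ≤ m
      suc-n≤m = ℕₚ.≤-trans (ℕₚ.≤-reflexive (sym j∸i))
        (ℕₚ.≤-trans (ℕₚ.m∸n≤m (toℕ j) (toℕ i)) (ℕₚ.≤-pred (Finₚ.toℕ<n j)))

  period-1 : Fin m → ℕ
  period-1 d = proj₁ (period′ d)

  period : Fin m → ℕ
  period d = suc (period-1 d)

  iter-period : ∀ d → iter f (period d) d ≡ d
  iter-period d = proj₁ (proj₂ (period′ d))

  period≤m : ∀ d → period d ≤ m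
  period≤m d = proj₁ (proj₂ (proj₂ (period′ d)))

  isPeriod : ∀ d → IsPeriod d (period d)
  isPeriod d = s≤s z≤n , iter-period d , λ where (suc j) _ (s≤s j<k) → proj₂ (proj₂ (proj₂ (period′ d))) j j<k

  IsPeriod-unique : ∀ {d k l} → IsPeriod d k → IsPeriod d l → k ≡ l
  IsPeriod-unique {k = k} {l} (0<k , pk , mk) (0<l , pl , ml) with ℕₚ.<-cmp k l
  ... | tri< k<l _ _ = ⊥-elim (ml k 0<k k<l pk)
  ... | tri≈ _ k≡l _ = k≡l
  ... | tri> _ _ l<k = ⊥-elim (mk l 0<l l<k pl)

  reduce : ∀ d n → ∃ λ j → j < period d × iter f n d ≡ iter f j d
  reduce d zero = 0 , s≤s z≤n , refl
  reduce d (suc n) with reduce d n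
  ... | j , j< , eq with ℕₚ.m≤n⇒m<n∨m≡n j<
  ...   | inj₁ sj< = suc j , sj< , cong f eq
  ...   | inj₂ sj≡ = 0 , s≤s z≤n , trans (cong f eq) (trans (cong (λ n → iter f n d) sj≡) (iter-period d))

  SameOrbit-refl : ∀ {d} → SameOrbit d d
  SameOrbit-refl = 0 , refl

  SameOrbit-step : ∀ {d} → SameOrbit d (f d)
  SameOrbit-step = 1 , refl

  SameOrbit-trans : ∀ {d e g} → SameOrbit d e → SameOrbit e g → SameOrbit d g
  SameOrbit-trans {d} (k , refl) (l , refl) = l ℕ.+ k , iter-+ l k d

  SameOrbit-sym : ∀ {d e} → SameOrbit d e → SameOrbit e d
  SameOrbit-sym {d} (k , refl) with reduce d k
  ... | j , j< , eq = period d ℕ.∸ j , trans (cong (iter f (period d ℕ.∸ j)) eq)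
    (trans (sym (iter-+ (period d ℕ.∸ j) j d))
      (trans (cong (λ n → iter f n d) (ℕₚ.m∸n+n≡m (ℕₚ.<⇒≤ j<))) (iter-period d)))

  orbitTail : Fin m → List (Fin m)
  orbitTail d = applyUpTo (λ i → iter f (suc i) d) (period-1 d)

  orbit : Fin m → List (Fin m)
  orbit d = d ∷ orbitTail d

  ∈-orbit⁺ : ∀ {d e} → SameOrbit d e → e ∈ orbit d
  ∈-orbit⁺ {d} (k , refl) with reduce d k
  ... | j , j< , eq = subst (_∈ orbit d) (sym eq) (∈-applyUpTo⁺ (λ i → iter f i d) j<)

  ∈-orbit⁻ : ∀ {d e} → e ∈ orbit d → SameOrbit d e
  ∈-orbit⁻ {d} e∈ with ∈-applyUpTo⁻ (λ i → iter f i d) {n = period d} e∈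
  ... | i , _ , refl = i , refl

  iter-distinct : ∀ d {i j} → i < j → j < period d → iter f i d ≢ iter f j d
  iter-distinct d {i} {j} i<j j<p eq =
    proj₂ (proj₂ (isPeriod d)) (j ℕ.∸ i) (ℕₚ.m<n⇒0<n∸m i<j)
      (ℕₚ.≤-<-trans (ℕₚ.m∸n≤m j i) j<p) (iter-cancel (ℕₚ.<⇒≤ i<j) eq)

  Unique-orbit : ∀ d → Unique (orbit d)
  Unique-orbit d = Uniqueₚ.applyUpTo⁺₁ (λ i → iter f i d) (period d) (iter-distinct d)

  period-f : ∀ d → period (f d) ≡ period d
  period-f d = IsPeriod-unique {f d} (isPeriod (f d))
    (s≤s z≤n , trans (iter-f (period d) d) (cong f (iter-period d)) ,
     λ j 0<j j<p eq → proj₂ (proj₂ (isPeriod d)) j 0<j j<p (f-inj (trans (sym (iter-f j d)) eq)))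

  orbit-f : ∀ d → orbit (f d) ≡ orbitTail d ∷ʳ d
  orbit-f d = begin
    orbit (f d)                                            ≡⟨⟩
    applyUpTo (λ i → iter f i (f d)) (period (f d))        ≡⟨ cong (applyUpTo (λ i → iter f i (f d))) (period-f d) ⟩
    applyUpTo (λ i → iter f i (f d)) (period d)            ≡⟨ applyUpTo-cong (λ i → iter-f i d) (period d) ⟩
    applyUpTo (λ i → iter f (suc i) d) (period d)          ≡⟨ sym (Listₚ.applyUpTo-∷ʳ (λ i → iter f (suc i) d) (period-1 d)) ⟩
    orbitTail d ∷ʳ iter f (period d) d                     ≡⟨ cong (orbitTail d ∷ʳ_) (iter-period d) ⟩
    orbitTail d ∷ʳ d                                       ∎
    where
    open ≡.≡-Reasoning
    applyUpTo-cong : ∀ {g h : ℕ → Fin m} → (∀ i → g i ≡ h i) → ∀ n → applyUpTo g n ≡ applyUpTo h n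
    applyUpTo-cong eq zero = refl
    applyUpTo-cong eq (suc n) = cong₂ _∷_ (eq 0) (applyUpTo-cong (eq ∘ suc) n)

  abstract
    least-∈ : ∀ (x : Fin m) xs → ∃ λ y → y ∈ x ∷ xs × (∀ {z} → z ∈ x ∷ xs → y Fin.≤ z)
    least-∈ x [] = x , here refl , λ where (here refl) → ℕₚ.≤-refl
    least-∈ x (x′ ∷ xs) with least-∈ x′ xs
    ... | y , y∈ , min with toℕ x ℕ.≤? toℕ y
    ...   | yes x≤y = x , here refl , λ where
              (here refl) → ℕₚ.≤-refl
              (there z∈) → ℕₚ.≤-trans x≤y (min z∈)
    ...   | no x≰y = y , there y∈ , λ where
              (here refl) → ℕₚ.<⇒≤ (ℕₚ.≰⇒> x≰y)
              (there z∈) → min z∈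

  rep : Fin m → Fin m
  rep d = proj₁ (least-∈ d (orbitTail d))

  rep-∈ : ∀ d → SameOrbit d (rep d)
  rep-∈ d = ∈-orbit⁻ (proj₁ (proj₂ (least-∈ d (orbitTail d))))

  rep-least : ∀ d {e} → SameOrbit d e → rep d Fin.≤ e
  rep-least d so = proj₂ (proj₂ (least-∈ d (orbitTail d))) (∈-orbit⁺ so)

  rep-cong : ∀ {d e} → SameOrbit d e → rep d ≡ rep e
  rep-cong {d} {e} so = Finₚ.≤-antisym
    (rep-least d (SameOrbit-trans so (rep-∈ e)))
    (rep-least e (SameOrbit-trans (SameOrbit-sym so) (rep-∈ d)))

  rep-reflects : ∀ {d e} → rep d ≡ rep e → SameOrbit d e
  rep-reflects {d} {e} eq = SameOrbit-trans (rep-∈ d) (subst (λ r → SameOrbit r e) (sym eq) (SameOrbit-sym (rep-∈ e)))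

  rep-f : ∀ d → rep (f d) ≡ rep d
  rep-f d = sym (rep-cong SameOrbit-step)

  IsOrbitMin : Fin m → Set
  IsOrbitMin d = ∀ (k : Fin m) → d Fin.≤ iter f (toℕ k) d

  rep-isMin : ∀ d → IsOrbitMin (rep d)
  rep-isMin d k = rep-least d (SameOrbit-trans (rep-∈ d) (toℕ k , refl))

  isMin⇒rep : ∀ {d} → IsOrbitMin d → rep d ≡ d
  isMin⇒rep {d} min = Finₚ.≤-antisym (rep-least d SameOrbit-refl) d≤rep
    where
    d≤rep : d Fin.≤ rep d
    d≤rep with rep-∈ d
    ... | k , eq with reduce d k
    ...   | j , j< , eq′ = subst (d Fin.≤_) (trans (cong (λ n → iter f n d) (Finₚ.toℕ-fromℕ< j<m)) (trans (sym eq′) eq)) (min (fromℕ< j<m))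
      where
      j<m = ℕₚ.<-≤-trans j< (period≤m d)

countᵇ : ∀ {k} → (Fin k → Bool) → ℕ
countᵇ {zero}  p = 0
countᵇ {suc k} p = (if p fz then 1 else 0) ℕ.+ countᵇ (λ i → p (fs i))

countᵇ-unique : (c : ∀ k → (Fin k → Bool) → ℕ) → (∀ p → c 0 p ≡ 0) →
                (∀ k p → c (suc k) p ≡ (if p fz then 1 else 0) ℕ.+ c k (λ i → p (fs i))) →
                ∀ k p → c k p ≡ countᵇ p
countᵇ-unique c c0 cs zero p = c0 p
countᵇ-unique c c0 cs (suc k) p = trans (cs k p) (cong ((if p fz then 1 else 0) ℕ.+_) (countᵇ-unique c c0 cs k _))

-- The counting function behind #orbits is private to Defs; it can only be
-- reached by letting unification solve for it.
mutual
  privateCount : OrientedMap → ∀ k → (Fin k → Bool) → ℕ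
  privateCount M = _

  #orbits≡countᵇ : ∀ M f → OrientedMap.#orbits M f ≡ countᵇ (λ d → ⌊ OrientedMap.isOrbitMin? M f d ⌋)
  #orbits≡countᵇ M f with OrientedMap.m M | (λ d → ⌊ OrientedMap.isOrbitMin? M f d ⌋)
  ... | k | p = countᵇ-unique (privateCount M) (λ _ → refl) (λ _ _ → refl) k p

countᵇ≡length-filter : ∀ {a} {A : Set a} (p : A → Bool) {k} (g : Fin k → A) →
                       countᵇ (p ∘ g) ≡ length (filter (T? ∘ p) (tabulate g))
countᵇ≡length-filter p {zero} g = refl
countᵇ≡length-filter p {suc k} g with p (g fz)
... | true = cong suc (countᵇ≡length-filter p (g ∘ fs))
... | false = countᵇ≡length-filter p (g ∘ fs)

module OrbitCount (M : OrientedMap) (f : OrientedMap.Dart M → OrientedMap.Dart M)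
                  (f-inj : ∀ {x y} → f x ≡ f y → x ≡ y) where
  open OrientedMap M
  open Orbits f f-inj

  private
    minima : List Dart
    minima = filter (λ d → T? ⌊ isOrbitMin? f d ⌋) (allFin m)

    #orbits≡length-minima : #orbits f ≡ length minima
    #orbits≡length-minima = trans (#orbits≡countᵇ M f) (countᵇ≡length-filter (λ d → ⌊ isOrbitMin? f d ⌋) id)

    rep-∈-minima : ∀ d → rep d ∈ minima
    rep-∈-minima d = ∈-filter⁺ (λ d → T? ⌊ isOrbitMin? f d ⌋) (∈-allFin (rep d)) (fromWitness (rep-isMin d))

    ∈-minima⇒rep : ∀ {d} → d ∈ minima → rep d ≡ d
    ∈-minima⇒rep {d} d∈ = isMin⇒rep (toWitness {a? = isOrbitMin? f d} (proj₂ (∈-filter⁻ (λ d → T? ⌊ isOrbitMin? f d ⌋) {xs = allFin m} d∈)))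

  -- Orbits are counted by their least elements, and `rep` maps a covering list onto these. The
  -- upper and the lower bound are separate lemmas because `#V` is bounded from the two sides by
  -- different lists.
  cover⇒#orbits≤ : ∀ (rs : List Dart) → (∀ d → ∃ λ r → r ∈ rs × SameOrbit r d) → #orbits f ≤ length rs
  cover⇒#orbits≤ rs cov = subst₂ _≤_ (sym #orbits≡length-minima) (Listₚ.length-map rep rs)
    (Unique-⊆⇒length-≤ (Uniqueₚ.filter⁺ (λ d → T? ⌊ isOrbitMin? f d ⌋) (Uniqueₚ.allFin⁺ m)) sub)
    where
    open ≡ using (subst₂)
    sub : ∀ {d} → d ∈ minima → d ∈ map rep rs
    sub {d} d∈ with cov d
    ... | r , r∈ , so = subst (_∈ map rep rs) (trans (rep-cong so) (∈-minima⇒rep d∈)) (∈-map⁺ rep r∈)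

  separated⇒≤#orbits : ∀ (rs : List Dart) → AllPairs (λ r s → ¬ SameOrbit r s) rs → length rs ≤ #orbits f
  separated⇒≤#orbits rs sep = subst₂ _≤_ (Listₚ.length-map rep rs) (sym #orbits≡length-minima)
    (Unique-⊆⇒length-≤ (unique sep) λ x∈ → let r , _ , eq = ∈-map⁻ rep x∈ in subst (_∈ minima) (sym eq) (rep-∈-minima r))
    where
    open ≡ using (subst₂)
    unique : ∀ {rs} → AllPairs (λ r s → ¬ SameOrbit r s) rs → Unique (map rep rs)
    unique [] = []
    unique (¬so ∷ sep) = Allₚ.map⁺ (All.map (λ ¬so eq → ¬so (rep-reflects eq)) ¬so) ∷ unique sep

-- Cutting a surface into a disc

module Surfaces (M : OrientedMap) where
  open OrientedMap M
  open DecMembership (Finₚ._≟_ {m}) using (_∈?_)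

  σ-inj : ∀ {x y} → σf x ≡ σf y → x ≡ y
  σ-inj {x} {y} eq = trans (sym (FinPerm.inverseˡ σ)) (trans (cong (σ ⟨$⟩ˡ_) eq) (FinPerm.inverseˡ σ))

  α-inj : ∀ {x y} → αf x ≡ αf y → x ≡ y
  α-inj {x} {y} eq = trans (sym (α-invol x)) (trans (cong αf eq) (α-invol y))

  φ-inj : ∀ {x y} → φ x ≡ φ y → x ≡ y
  φ-inj = α-inj ∘ σ-inj

  α-swap : ∀ {x y} → αf x ≡ y → x ≡ αf y
  α-swap {x} refl = sym (α-invol x)

  module Φ = Orbits φ φ-inj
  module Σ′ = Orbits σf σ-inj
  module A = Orbits αf α-inj

  face tailFace : Dart → List Dart
  face = Φ.orbit
  tailFace = Φ.orbitTail

  Closed : List Dart → Set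
  Closed W = ∀ {d} → d ∈ W → αf d ∈ W

  absorbed : List Dart → List Dart
  absorbed = concatMap face

  ∈-absorbed⁺ : ∀ {r rs e} → r ∈ rs → SameFace r e → e ∈ absorbed rs
  ∈-absorbed⁺ {rs = rs} (here refl) so = ∈-++⁺ˡ (Φ.∈-orbit⁺ so)
  ∈-absorbed⁺ {rs = r ∷ rs} (there r∈) so = ∈-++⁺ʳ (face r) (∈-absorbed⁺ r∈ so)

  ∈-absorbed⁻ : ∀ {rs e} → e ∈ absorbed rs → ∃ λ r → r ∈ rs × SameFace r e
  ∈-absorbed⁻ {r ∷ rs} e∈ with ∈-++⁻ (face r) e∈
  ... | inj₁ p = r , here refl , Φ.∈-orbit⁻ p
  ... | inj₂ p with ∈-absorbed⁻ {rs} p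
  ...   | r′ , r′∈ , so = r′ , there r′∈ , so

  absorbed-face : ∀ {rs e e′} → SameFace e e′ → e ∈ absorbed rs → e′ ∈ absorbed rs
  absorbed-face {rs} so e∈ with ∈-absorbed⁻ {rs} e∈
  ... | r , r∈ , so′ = ∈-absorbed⁺ r∈ (Φ.SameOrbit-trans so′ so)

  -- Cutting the surface open: W is the boundary word of a disc glued from the
  -- faces of the darts in rs, and X lists the darts interior to the disc.
  data Surgery (d₀ : Dart) : List Dart → List Dart → List Dart → Set where
    start : Surgery d₀ (face d₀) [] [ d₀ ]
    glue  : ∀ {X rs} u d w → Surgery d₀ (u ++ d ∷ w) X rs → αf d ∉ absorbed rs →
            Surgery d₀ (u ++ tailFace (αf d) ++ w) (d ∷ αf d ∷ X) (αf d ∷ rs)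

  module _ {d₀ : Dart} where

    -- The invariant behind all bookkeeping: boundary and interior darts together are the darts of
    -- the absorbed faces. Distinctness of letters and disjointness of `W` and `X` are inherited
    -- from the faces.
    word-↭ : ∀ {W X rs} → Surgery d₀ W X rs → W ++ X ↭ absorbed rs
    word-↭ start = ↭-refl
    word-↭ {X = d ∷ _ ∷ X} {_ ∷ rs} (glue u d w s _) = begin
      (u ++ t ++ w) ++ d ∷ αf d ∷ X        ↭⟨ Permₚ.shift d (u ++ t ++ w) _ ⟩
      d ∷ (u ++ t ++ w) ++ αf d ∷ X        ↭⟨ ↭-prep d (Permₚ.shift (αf d) (u ++ t ++ w) X) ⟩
      d ∷ αf d ∷ (u ++ t ++ w) ++ X        ↭⟨ _↭_.swap d (αf d) (Permₚ.++⁺ʳ X (Permₚ.shifts u t)) ⟩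
      αf d ∷ d ∷ (t ++ u ++ w) ++ X        ≡⟨ cong (λ l → αf d ∷ d ∷ l) (Listₚ.++-assoc t (u ++ w) X) ⟩
      αf d ∷ d ∷ t ++ (u ++ w) ++ X        ↭⟨ ↭-prep (αf d) (Permₚ.shift d t _) ⟨
      αf d ∷ t ++ d ∷ (u ++ w) ++ X        ↭⟨ Permₚ.++⁺ˡ (αf d ∷ t) (Permₚ.++⁺ʳ X (Permₚ.shift d u w)) ⟨
      (αf d ∷ t) ++ (u ++ d ∷ w) ++ X      ↭⟨ Permₚ.++⁺ˡ (αf d ∷ t) (word-↭ s) ⟩
      absorbed (αf d ∷ rs)                 ∎
      where
      open Perm.PermutationReasoning
      t = tailFace (αf d)

    root-∈ : ∀ {W X rs} → Surgery d₀ W X rs → d₀ ∈ rs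
    root-∈ start = here refl
    root-∈ (glue u d w s _) = there (root-∈ s)

    root-absorbed : ∀ {W X rs} → Surgery d₀ W X rs → d₀ ∈ absorbed rs
    root-absorbed s = ∈-absorbed⁺ (root-∈ s) Φ.SameOrbit-refl

    separated : ∀ {W X rs} → Surgery d₀ W X rs → AllPairs (λ r s → ¬ SameFace r s) rs
    separated start = [] ∷ []
    separated (glue u d w s new) =
      All.tabulate (λ r∈ so → new (∈-absorbed⁺ r∈ (Φ.SameOrbit-sym so))) ∷ separated s

    Unique-absorbed : ∀ {W X rs} → Surgery d₀ W X rs → Unique (absorbed rs)
    Unique-absorbed start = subst Unique (sym (Listₚ.++-identityʳ (face d₀))) (Φ.Unique-orbit d₀)
    Unique-absorbed {rs = _ ∷ rs} (glue u d w s new) =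
      Uniqueₚ.++⁺ (Φ.Unique-orbit (αf d)) (Unique-absorbed s)
        λ (p , q) → new (absorbed-face {rs} (Φ.SameOrbit-sym (Φ.∈-orbit⁻ p)) q)

    Unique-WX : ∀ {W X rs} → Surgery d₀ W X rs → Unique (W ++ X)
    Unique-WX s = Unique-resp-↭ (↭-sym (word-↭ s)) (Unique-absorbed s)

    Unique-W : ∀ {W X rs} → Surgery d₀ W X rs → Unique W
    Unique-W s = Unique-++ˡ (Unique-WX s)

    W-absorbed : ∀ {W X rs} → Surgery d₀ W X rs → ∀ {d} → d ∈ W → d ∈ absorbed rs
    W-absorbed s d∈ = Permₚ.∈-resp-↭ (word-↭ s) (∈-++⁺ˡ d∈)

    X-absorbed : ∀ {W X rs} → Surgery d₀ W X rs → ∀ {d} → d ∈ X → d ∈ absorbed rs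
    X-absorbed {W} s d∈ = Permₚ.∈-resp-↭ (word-↭ s) (∈-++⁺ʳ W d∈)

    X-closed : ∀ {W X rs} → Surgery d₀ W X rs → Closed X
    X-closed (glue u d w s _) (here refl) = there (here refl)
    X-closed (glue u d w s _) (there (here refl)) = here (α-invol d)
    X-closed (glue u d w s _) (there (there d∈)) = there (there (X-closed s d∈))

    -- The glued edges form a tree on the absorbed faces: one edge for each face except the root,
    -- and two darts per edge.
    length-X : ∀ {W X rs} → Surgery d₀ W X rs → length X ℕ.+ 2 ≡ length rs ℕ.+ length rs
    length-X start = refl
    length-X {rs = _ ∷ rs} (glue u d w s _) =
      cong suc (trans (cong suc (length-X s)) (sym (ℕₚ.+-suc (length rs) (length rs))))

    length-rs : ∀ {W X rs} → Surgery d₀ W X rs → length rs ≤ m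
    length-rs {rs = rs} s = ℕₚ.≤-trans (Unique-⊆⇒length-≤ (unique (separated s)) (λ _ → ∈-allFin _))
                                       (ℕₚ.≤-reflexive (Listₚ.length-tabulate id))
      where
      unique : ∀ {rs} → AllPairs (λ r s → ¬ SameFace r s) rs → Unique rs
      unique [] = []
      unique (p ∷ ps) = All.map (λ { ¬so refl → ¬so Φ.SameOrbit-refl }) p ∷ unique ps

    record Complete : Set where
      constructor complete
      field
        {W X rs} : List Dart
        surgery  : Surgery d₀ W X rs
        W-closed : Closed W

    -- Each gluing adds a new face to `rs`, and the darts in `rs` are pairwise distinct, so at most
    -- `m` faces can be listed; `n` bounds what is left.
    continue : ∀ {W X rs} n → m ≤ length rs ℕ.+ n → Surgery d₀ W X rs → Complete
    continue {W} {X} {rs} n fuel s with Any.any? (λ d → ¬? (αf d ∈? absorbed rs)) W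
    continue {W} {X} {rs} n fuel s | no ¬any = complete s closed
      where
      closed : Closed W
      closed {d} d∈ with αf d ∈? absorbed rs
      ... | no new = ⊥-elim (¬any (Any.map (λ { refl → new }) d∈))
      ... | yes old with ∈-++⁻ W (Permₚ.∈-resp-↭ (↭-sym (word-↭ s)) old)
      ...   | inj₁ αd∈W = αd∈W
      -- Interior darts come in pairs, so `d` would be interior as well as on the boundary.
      ...   | inj₂ αd∈X = ⊥-elim (Unique-++-disjoint (Unique-WX s) d∈ (subst (_∈ X) (α-invol d) (X-closed s αd∈X)))
    continue n fuel s | yes any with find any
    ... | d , d∈ , new with split-∈ d∈
    continue {rs = rs} zero fuel s | yes any | d , d∈ , new | u , w , refl =
      ⊥-elim (ℕₚ.<-irrefl refl (ℕₚ.≤-trans (length-rs (glue u d w s new)) (subst (m ≤_) (ℕₚ.+-identityʳ _) fuel)))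
    continue {rs = rs} (suc n) fuel s | yes any | d , d∈ , new | u , w , refl =
      continue n (subst (m ≤_) (ℕₚ.+-suc (length rs) n) fuel) (glue u d w s new)

  completion : ∀ d₀ → Complete {d₀}
  completion d₀ = continue m (ℕₚ.m≤n+m m 1) start

  module _ {d₀ : Dart} (C : Complete {d₀}) where
    open Complete C

    -- The absorbed darts are a union of faces, hence closed under `φ`, and closed under `αf`
    -- because both `W` and `X` are. As `σf` is `φ` after `αf`, connectedness reaches every dart.
    all-absorbed : ∀ e → e ∈ absorbed rs
    all-absorbed e = go (connected d₀ e)
      where
      α-step : ∀ {e} → e ∈ absorbed rs → αf e ∈ absorbed rs
      α-step e∈ with ∈-++⁻ W (Permₚ.∈-resp-↭ (↭-sym (word-↭ surgery)) e∈)
      ... | inj₁ p = W-absorbed surgery (W-closed p)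
      ... | inj₂ p = X-absorbed surgery (X-closed surgery p)
      go : ∀ {e} → Reach σf αf d₀ e → e ∈ absorbed rs
      go Reach.here = root-absorbed surgery
      go (Reach.stepσ {e} r) = subst (λ x → σf x ∈ absorbed rs) (α-invol e)
        (absorbed-face {rs} Φ.SameOrbit-step (α-step (go r)))
      go (Reach.stepα r) = α-step (go r)

    faces-covered : ∀ e → ∃ λ r → r ∈ rs × SameFace r e
    faces-covered e = ∈-absorbed⁻ {rs} (all-absorbed e)

    dart-count : m ≡ length W ℕ.+ length X
    dart-count = trans (ℕₚ.≤-antisym m≤ ≤m) (trans (sym (Permₚ.↭-length (word-↭ surgery))) (Listₚ.length-++ W))
      where
      m≤ : m ≤ length (absorbed rs)
      m≤ = ℕₚ.≤-trans (ℕₚ.≤-reflexive (sym (Listₚ.length-tabulate {n = m} id)))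
                      (Unique-⊆⇒length-≤ (Uniqueₚ.allFin⁺ m) (λ {x} _ → all-absorbed x))
      ≤m : length (absorbed rs) ≤ m
      ≤m = ℕₚ.≤-trans (Unique-⊆⇒length-≤ (Unique-absorbed surgery) (λ _ → ∈-allFin _))
                      (ℕₚ.≤-reflexive (Listₚ.length-tabulate id))

    #F≡ : #F ≡ length rs
    #F≡ = ℕₚ.≤-antisym (OrbitCount.cover⇒#orbits≤ M φ φ-inj rs faces-covered)
                       (OrbitCount.separated⇒≤#orbits M φ φ-inj rs (separated surgery))

  -- Inverse pairs, cancellation and crossings in boundary words

  data Paired : List Dart → Set where
    []   : Paired []
    pair : ∀ d u w → Paired (u ++ w) → Paired (d ∷ u ++ αf d ∷ w)

  Closed-remove : ∀ {u d w} → Unique (d ∷ u ++ αf d ∷ w) → Closed (d ∷ u ++ αf d ∷ w) → Closed (u ++ w)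
  Closed-remove {u} {d} {w} uq cl {x} x∈ with cl (there (∈-unremove u x∈))
  ... | here αx≡d = ⊥-elim (∉-of-Unique (d ∷ u) uq (there (subst (_∈ u ++ w) (α-swap αx≡d) x∈)))
  ... | there p = ∈-remove u (λ αx≡αd → ∉-of-Unique [] uq (∈-unremove u (subst (_∈ u ++ w) (α-inj αx≡αd) x∈))) p

  paired : ∀ n {W} → length W ≤ n → Unique W → Closed W → Paired W
  paired n {[]} _ _ _ = []
  paired (suc n) {d ∷ W} (s≤s len) uq cl with cl (here refl)
  ... | here αd≡d = ⊥-elim (α-fpf d αd≡d)
  ... | there αd∈ with split-∈ αd∈
  ...   | u , w , refl = pair d u w (paired n
            (ℕₚ.≤-trans (ℕₚ.n≤1+n _) (ℕₚ.≤-trans (ℕₚ.≤-reflexive (sym (length-insert u))) len))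
            (Unique-remove u (Unique-remove [] uq)) (Closed-remove uq cl))

  pair-reps : ∀ {W} → Unique W → Paired W → ∃ λ H → length W ≡ length H ℕ.+ length H ×
              (∀ {x} → x ∈ H → x ∈ W) × AllPairs (λ x y → ¬ A.SameOrbit x y) H ×
              (∀ {x} → x ∈ W → ∃ λ h → h ∈ H × A.SameOrbit h x)
  pair-reps uq [] = [] , refl , (λ ()) , [] , (λ ())
  pair-reps uq (pair d u w p) with pair-reps (Unique-remove u (Unique-remove [] uq)) p
  ... | H , len , H⊆ , sep , cov = d ∷ H , len′ , sub , All.tabulate new ∷ sep , cov′
    where
    len′ : suc (length (u ++ αf d ∷ w)) ≡ suc (length H) ℕ.+ suc (length H)
    len′ = cong suc (trans (length-insert u) (trans (cong suc len) (sym (ℕₚ.+-suc _ _))))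
    sub : ∀ {x} → x ∈ d ∷ H → x ∈ d ∷ u ++ αf d ∷ w
    sub (here refl) = here refl
    sub (there x∈) = there (∈-unremove u (H⊆ x∈))
    α-orbit : ∀ k → iter αf k d ≡ d ⊎ iter αf k d ≡ αf d
    α-orbit zero = inj₁ refl
    α-orbit (suc k) with α-orbit k
    ... | inj₁ eq = inj₂ (cong αf eq)
    ... | inj₂ eq = inj₁ (trans (cong αf eq) (α-invol d))
    new : ∀ {x} → x ∈ H → ¬ A.SameOrbit d x
    new x∈ (k , refl) with α-orbit k
    ... | inj₁ eq = ∉-of-Unique [] uq (∈-unremove u (subst (_∈ u ++ w) eq (H⊆ x∈)))
    ... | inj₂ eq = ∉-of-Unique (d ∷ u) uq (there (subst (_∈ u ++ w) eq (H⊆ x∈)))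
    cov′ : ∀ {x} → x ∈ d ∷ u ++ αf d ∷ w → ∃ λ h → h ∈ d ∷ H × A.SameOrbit h x
    cov′ {x} (here refl) = d , here refl , A.SameOrbit-refl
    cov′ {x} (there x∈) with x Finₚ.≟ αf d
    ... | yes refl = d , here refl , A.SameOrbit-step
    ... | no x≢ with cov (∈-remove u x≢ x∈)
    ...   | h , h∈ , so = h , there h∈ , so

  #E+#E≡m : #E ℕ.+ #E ≡ m
  #E+#E≡m with pair-reps (Uniqueₚ.allFin⁺ m) (paired _ ℕₚ.≤-refl (Uniqueₚ.allFin⁺ m) (λ _ → ∈-allFin _))
  ... | H , len , _ , sep , cov = trans (cong₂ ℕ._+_ #E≡ #E≡) (trans (sym len) (Listₚ.length-tabulate id))
    where
    #E≡ : #E ≡ length H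
    #E≡ = ℕₚ.≤-antisym (OrbitCount.cover⇒#orbits≤ M αf α-inj H (λ d → cov (∈-allFin d)))
                       (OrbitCount.separated⇒≤#orbits M αf α-inj H sep)

  NoCancel : List Dart → Set
  NoCancel W = ∀ u d w → W ≢ u ++ d ∷ αf d ∷ w

  -- Unlike `Paired`, only adjacent partners are removed, which preserves holonomy in any group. The
  -- index counts the cancellations, since each of them stands for one vertex in the Euler count.
  data Reduces : List Dart → ℕ → List Dart → Set where
    done   : ∀ {W} → NoCancel W → Reduces W 0 W
    cancel : ∀ {c R} u d w → Reduces (u ++ w) c R → Reduces (u ++ d ∷ αf d ∷ w) (suc c) R

  findCancel : ∀ W → (∃ λ u → ∃₂ λ d w → W ≡ u ++ d ∷ αf d ∷ w) ⊎ NoCancel W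
  findCancel [] = inj₂ λ { [] d w () ; (_ ∷ _) d w () }
  findCancel (x ∷ []) = inj₂ λ { [] d w () ; (_ ∷ []) d w () ; (_ ∷ _ ∷ _) d w () }
  findCancel (x ∷ y ∷ W) with y Finₚ.≟ αf x | findCancel (y ∷ W)
  ... | yes refl | _ = inj₁ ([] , x , W , refl)
  ... | no _ | inj₁ (u , d , w , eq) = inj₁ (x ∷ u , d , w , cong (x ∷_) eq)
  ... | no y≢ | inj₂ nc = inj₂ λ where
          [] d w refl → y≢ refl
          (_ ∷ u) d w eq → nc u d w (Listₚ.∷-injectiveʳ eq)

  length-cancel : ∀ u {d w} → length (u ++ d ∷ αf d ∷ w) ≡ 2 ℕ.+ length (u ++ w)
  length-cancel u = trans (length-insert u) (cong suc (length-insert u))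

  reduction : ∀ n W → length W ≤ n → ∃₂ λ c R → Reduces W c R
  reduction n W len with findCancel W
  reduction n W len | inj₂ nc = 0 , W , done nc
  reduction zero W len | inj₁ (u , d , w , refl) with subst (_≤ 0) (length-cancel u) len
  ... | ()
  reduction (suc n) W len | inj₁ (u , d , w , refl)
    with reduction n (u ++ w) (ℕₚ.≤-trans (ℕₚ.n≤1+n _) (ℕₚ.≤-pred (subst (_≤ suc n) (length-cancel u) len)))
  ... | c , R , r = suc c , R , cancel u d w r

  cancel-↭ : ∀ u {d w} → u ++ d ∷ αf d ∷ w ↭ d ∷ u ++ αf d ∷ w
  cancel-↭ u {d} {w} = Permₚ.shift d u (αf d ∷ w)

  cancel-Unique : ∀ u {d w} → Unique (u ++ d ∷ αf d ∷ w) → Unique (u ++ w)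
  cancel-Unique u uq = Unique-remove u (Unique-remove u uq)

  cancel-Closed : ∀ u {d w} → Unique (u ++ d ∷ αf d ∷ w) → Closed (u ++ d ∷ αf d ∷ w) → Closed (u ++ w)
  cancel-Closed u {d} {w} uq cl = Closed-remove {u} {d} {w} (Unique-resp-↭ p uq) (λ x∈ →
    Permₚ.∈-resp-↭ p (cl (Permₚ.∈-resp-↭ (↭-sym p) x∈)))
    where p = cancel-↭ u

  Reduces-NoCancel : ∀ {W c R} → Reduces W c R → NoCancel R
  Reduces-NoCancel (done nc) = nc
  Reduces-NoCancel (cancel u d w r) = Reduces-NoCancel r

  Reduces-Unique : ∀ {W c R} → Reduces W c R → Unique W → Unique R
  Reduces-Unique (done _) uq = uq
  Reduces-Unique (cancel u d w r) uq = Reduces-Unique r (cancel-Unique u uq)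

  Reduces-Closed : ∀ {W c R} → Reduces W c R → Unique W → Closed W → Closed R
  Reduces-Closed (done _) uq cl = cl
  Reduces-Closed (cancel u d w r) uq cl = Reduces-Closed r (cancel-Unique u uq) (cancel-Closed u uq cl)

  Reduces-length : ∀ {W c R} → Reduces W c R → length W ≡ (c ℕ.+ c) ℕ.+ length R
  Reduces-length (done _) = refl
  Reduces-length {c = suc c} {R} (cancel u d w r) = trans (length-cancel u)
    (cong suc (trans (cong suc (Reduces-length r)) (cong (ℕ._+ length R) (sym (ℕₚ.+-suc c c)))))

  data Interlaced (W : List Dart) : Set where
    crossing : ∀ x e p q r s t → W ≡ p ++ x ∷ q ++ e ∷ r ++ αf x ∷ s ++ αf e ∷ t → Interlaced W

  -- The first letter whose partner has already been read closes up such a pattern.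
  interlaced : ∀ {W} → W ≢ [] → Unique W → Closed W → NoCancel W → Interlaced W
  interlaced {W} W≢[] uq cl nc = scan [] W refl (λ ())
    where
    scan : ∀ pre rest → W ≡ pre ++ rest → (∀ {x} → x ∈ pre → αf x ∉ pre) → Interlaced W
    scan [] [] refl _ = ⊥-elim (W≢[] refl)
    scan (x ∷ pre) [] eq noPair = ⊥-elim (noPair (here refl)
      (subst (αf x ∈_) W≡pre (cl (subst (x ∈_) (sym W≡pre) (here refl)))))
      where W≡pre = trans eq (Listₚ.++-identityʳ (x ∷ pre))
    scan pre (y ∷ rest) eq noPair with αf y ∈? pre
    ... | no αy∉ = scan (pre ∷ʳ y) rest (trans eq (sym (Listₚ.++-assoc pre [ y ] rest))) noPair′
      where
      noPair′ : ∀ {x} → x ∈ pre ∷ʳ y → αf x ∉ pre ∷ʳ y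
      noPair′ x∈ αx∈ with ∈-++⁻ pre x∈ | ∈-++⁻ pre αx∈
      ... | inj₁ p | inj₁ q = noPair p q
      ... | inj₁ p | inj₂ (here αx≡y) = αy∉ (subst (_∈ pre) (α-swap αx≡y) p)
      ... | inj₂ (here refl) | inj₁ q = αy∉ q
      ... | inj₂ (here refl) | inj₂ (here αy≡y) = α-fpf y αy≡y
    ... | yes αy∈ with split-∈ αy∈
    ...   | p , [] , refl = ⊥-elim (nc p (αf y) rest (trans eq
              (trans (Listₚ.++-assoc p [ αf y ] (y ∷ rest)) (cong (λ z → p ++ αf y ∷ z ∷ rest) (sym (α-invol y))))))
    -- The letter `e` right after `αf y` cannot have its partner before `y`, because `y` is the
    -- first letter that closes a pair. So `αf e` lies beyond `y`, and the two pairs cross.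
    ...   | p , e ∷ q , refl = found
      where
      eq′ : W ≡ p ++ αf y ∷ e ∷ q ++ y ∷ rest
      eq′ = trans eq (Listₚ.++-assoc p (αf y ∷ e ∷ q) (y ∷ rest))
      e∈pre : e ∈ p ++ αf y ∷ e ∷ q
      e∈pre = ∈-++⁺ʳ p (there (here refl))
      αe∈ : αf e ∈ (p ++ αf y ∷ e ∷ q) ++ y ∷ rest
      αe∈ = subst (αf e ∈_) eq (cl (subst (e ∈_) (sym eq) (∈-++⁺ˡ e∈pre)))
      e≢αy : e ≢ αf y
      e≢αy refl = ∉-of-Unique p (subst Unique eq′ uq) (∈-++⁺ʳ p (here refl))
      αe∈rest : αf e ∈ rest
      αe∈rest with ∈-++⁻ (p ++ αf y ∷ e ∷ q) αe∈
      ... | inj₁ bad = ⊥-elim (noPair e∈pre bad)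
      ... | inj₂ (here αe≡y) = ⊥-elim (e≢αy (α-swap αe≡y))
      ... | inj₂ (there p) = p
      found : Interlaced W
      found with split-∈ αe∈rest
      ... | s , t , refl = crossing (αf y) e p [] q s t
        (trans eq′ (cong (λ z → p ++ αf y ∷ e ∷ q ++ z ∷ s ++ αf e ∷ t) (sym (α-invol y))))

-- Extending labels over the glued edges

-- A partial composition of dart labels, general enough for the holonomy of a
-- connection in a group and for paths in a set of vertices.
record Holonomy (b ℓ : Level) : Set (Level.suc (b ⊔ ℓ)) where
  field
    B       : Set b
    Comp    : List B → B → Set ℓ
    Inv     : B → B → Set ℓ
    Inv-sym : ∀ {x y} → Inv x y → Inv y x
    inv     : ∀ x → ∃ λ y → Inv x y
    factor  : ∀ us ts ws {g} → Comp (us ++ ts ++ ws) g → ∃ λ b → Comp ts b × Comp (us ++ b ∷ ws) g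

module Extension (M : OrientedMap) {b ℓ} (H : Holonomy b ℓ) where
  open OrientedMap M
  open Surfaces M
  open Holonomy H

  Antisym : (Dart → B) → Set ℓ
  Antisym f = ∀ d → Inv (f d) (f (αf d))

  FlatAt : (Dart → B) → Dart → Set (b ⊔ ℓ)
  FlatAt f r = ∃ λ b → Comp (map f (tailFace r)) b × Inv (f r) b

  map-agree : ∀ {f g : Dart → B} {W} → (∀ {d} → d ∈ W → f d ≡ g d) → map f W ≡ map g W
  map-agree eq = Listₚ.map-cong-local (All.tabulate eq)

  -- Undoing the gluings: a glued edge gets the value forced by the face it absorbed.
  record Extended (d₀ : Dart) (X rs : List Dart) (f : Dart → B) (g : B) : Set (b ⊔ ℓ) where
    constructor extended
    field
      ext     : Dart → B
      antisym : Antisym ext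
      agrees  : ∀ {d} → d ∉ X → ext d ≡ f d
      flat    : ∀ {r} → r ∈ rs → r ≢ d₀ → FlatAt ext r
      root    : Comp (map ext (face d₀)) g

  -- Induction, undoing the last gluing first. The block `tailFace (αf d)` of the word has a
  -- composite `b`; giving `d` the value `b` and `αf d` an inverse keeps the composite of the
  -- shorter word and closes up the face of `αf d`.
  extend : ∀ {d₀ W X rs} → Surgery d₀ W X rs → ∀ f → Antisym f → ∀ {g} → Comp (map f W) g →
           Extended d₀ X rs f g
  extend start f anti comp = extended f anti (λ _ → refl) (λ { (here refl) r≢ → ⊥-elim (r≢ refl) }) comp
  extend {d₀} (glue {X} {rs} u d w s new) f anti {g} comp
    with factor (map f u) (map f (tailFace (αf d))) (map f w)
           (subst (λ l → Comp l g) (trans (Listₚ.map-++ f u _) (cong (map f u ++_) (Listₚ.map-++ f (tailFace (αf d)) w))) comp)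
  ... | b , comp-t , comp′ with inv b
  ...   | b′ , b-b′ = result (extend s f′ anti′ (subst (λ l → Comp l g) (sym map-f′) comp′))
    where
    t = tailFace (αf d)

    f′ : Dart → B
    f′ = f [ αf d ↦ b′ ] [ d ↦ b ]

    f′-d : f′ d ≡ b
    f′-d = ↦-≡

    f′-αd : f′ (αf d) ≡ b′
    f′-αd = trans (↦-≢ (α-fpf d)) ↦-≡

    f′-other : ∀ {x} → x ≢ d → x ≢ αf d → f′ x ≡ f x
    f′-other x≢d x≢αd = trans (↦-≢ x≢d) (↦-≢ x≢αd)

    anti′ : Antisym f′
    anti′ x = go (x Finₚ.≟ d) (x Finₚ.≟ αf d)
      where
      go : Dec (x ≡ d) → Dec (x ≡ αf d) → Inv (f′ x) (f′ (αf x))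
      go (yes refl) _ rewrite f′-d | f′-αd = b-b′
      go (no _) (yes refl) rewrite α-invol d | f′-d | f′-αd = Inv-sym b-b′
      go (no x≢d) (no x≢αd) rewrite f′-other x≢d x≢αd
        | f′-other {αf x} (λ αx≡d → x≢αd (α-swap αx≡d)) (λ αx≡αd → x≢d (α-inj αx≡αd)) = anti x

    uw-d : d ∉ u ++ w
    uw-d = ∉-of-Unique u (Unique-W s)

    uw-αd : αf d ∉ u ++ w
    uw-αd p = new (W-absorbed s (∈-unremove u p))

    agree : ∀ {x} → x ∈ u ++ w → f′ x ≡ f x
    agree x∈ = f′-other (λ { refl → uw-d x∈ }) (λ { refl → uw-αd x∈ })

    map-f′ : map f′ (u ++ d ∷ w) ≡ map f u ++ b ∷ map f w
    map-f′ = trans (Listₚ.map-++ f′ u (d ∷ w))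
      (cong₂ _++_ (map-agree (agree ∘ ∈-++⁺ˡ)) (cong₂ _∷_ f′-d (map-agree (agree ∘ ∈-++⁺ʳ u))))

    αd∉X : αf d ∉ X
    αd∉X p = new (X-absorbed s p)

    t-absorbed : ∀ {x} → x ∈ t → x ∉ absorbed rs
    t-absorbed x∈ p = new (absorbed-face {rs} (Φ.SameOrbit-sym (Φ.∈-orbit⁻ (there x∈))) p)

    result : Extended d₀ X rs f′ g → Extended d₀ (d ∷ αf d ∷ X) (αf d ∷ rs) f g
    result (extended f* anti* agree* flat* comp*) = extended f* anti*
      (λ x∉ → trans (agree* (x∉ ∘ there ∘ there)) (f′-other (λ { refl → x∉ (here refl) }) (λ { refl → x∉ (there (here refl)) })))
      flat comp*
      where
      -- The recursive call changes only darts of `X`, which belong to the faces in `rs`. The tail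
      -- of the new face is disjoint from these, so the face closed up here stays flat.
      agree-t : ∀ {x} → x ∈ t → f* x ≡ f x
      agree-t x∈ = trans (agree* (λ p → t-absorbed x∈ (X-absorbed s p)))
        (f′-other (λ { refl → t-absorbed x∈ (W-absorbed s (∈-insert u)) })
                  (λ { refl → Uniqueₚ.Unique[x∷xs]⇒x∉xs (Φ.Unique-orbit (αf d)) x∈ }))
      flat : ∀ {r} → r ∈ αf d ∷ rs → r ≢ d₀ → FlatAt f* r
      flat (here refl) _ = b , subst (λ l → Comp l b) (sym (map-agree agree-t)) comp-t ,
        subst (λ z → Inv z b) (sym (trans (agree* αd∉X) f′-αd)) (Inv-sym b-b′)
      flat (there r∈) r≢ = flat* r∈ r≢


module Walks (M : OrientedMap) {a} {A : Set a} (ℓ : OrientedMap.Dart M → A) where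
  open OrientedMap M
  open Surfaces M

  Walk : A → List Dart → A → Set a
  Walk x [] y = x ≡ y
  Walk x (d ∷ W) y = ℓ d ≡ x × Walk (ℓ (αf d)) W y

  Walk-++⁻ : ∀ u {w x y} → Walk x (u ++ w) y → ∃ λ z → Walk x u z × Walk z w y
  Walk-++⁻ [] {x = x} p = x , refl , p
  Walk-++⁻ (d ∷ u) (eq , p) with Walk-++⁻ u p
  ... | z , p , q = z , (eq , p) , q

  Walk-++⁺ : ∀ u {w x y z} → Walk x u z → Walk z w y → Walk x (u ++ w) y
  Walk-++⁺ [] refl q = q
  Walk-++⁺ (d ∷ u) (eq , p) q = eq , Walk-++⁺ u p q

  Walk-cancel : ∀ u {d w x y} → Walk x (u ++ d ∷ αf d ∷ w) y → Walk x (u ++ w) y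
  Walk-cancel u {d} {w} {x} {y} p with Walk-++⁻ u p
  ... | z , p , (refl , _ , q) = Walk-++⁺ u p (subst (λ e → Walk (ℓ e) w y) (α-invol d) q)

Walk-cong : ∀ (M : OrientedMap) {a} {A : Set a} (ℓ ℓ′ : OrientedMap.Dart M → A) → let open OrientedMap M in
            ∀ {W x y} → (∀ {d} → d ∈ W → ℓ′ d ≡ ℓ d × ℓ′ (αf d) ≡ ℓ (αf d)) →
            Walks.Walk M ℓ x W y → Walks.Walk M ℓ′ x W y
Walk-cong M ℓ ℓ′ {[]} eq p = p
Walk-cong M ℓ ℓ′ {d ∷ W} {y = y} eq (ℓd , p) = trans (proj₁ (eq (here refl))) ℓd ,
  subst (λ x → Walks.Walk M ℓ′ x W y) (sym (proj₂ (eq (here refl)))) (Walk-cong M ℓ ℓ′ (eq ∘ there) p)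

-- Double counting: positions picked for different labels are different, so the two picks per label
-- never collide.
two-per-fibre : ∀ {a b} {A : Set a} {B : Set b} (lab : B → A) (Q : List B) (M : List A) → Unique M →
                (∀ {y} → y ∈ M → ∃₂ λ p q → p ∈ Q × q ∈ Q × p ≢ q × lab p ≡ y × lab q ≡ y) →
                length M ℕ.+ length M ≤ length Q
two-per-fibre {B = B} lab Q M uM two with build M uM two
  where
  build : ∀ M → Unique M → (∀ {y} → y ∈ M → ∃₂ λ p q → p ∈ Q × q ∈ Q × p ≢ q × lab p ≡ y × lab q ≡ y) →
          ∃ λ (S : List B) → Unique S × (∀ {p} → p ∈ S → p ∈ Q × lab p ∈ M) × length S ≡ length M ℕ.+ length M
  build [] _ _ = [] , [] , (λ ()) , refl
  build (y ∷ M) (y≢ ∷ uM) two with two (here refl) | build M uM (two ∘ there)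
  ... | p , q , p∈ , q∈ , p≢q , refl , lq | S , uS , sub , len =
    p ∷ q ∷ S , (p≢q ∷ fresh refl) ∷ (fresh lq ∷ uS) , sub′ ,
    cong suc (trans (cong suc len) (sym (ℕₚ.+-suc (length M) (length M))))
    where
    fresh : ∀ {z} → lab z ≡ lab p → All (z ≢_) S
    fresh eq = All.tabulate (λ { s∈ refl → All.lookup y≢ (proj₂ (sub s∈)) (sym eq) })
    sub′ : ∀ {r} → r ∈ p ∷ q ∷ S → r ∈ Q × lab r ∈ lab p ∷ M
    sub′ (here refl) = p∈ , here refl
    sub′ (there (here refl)) = q∈ , here lq
    sub′ (there (there r∈)) = proj₁ (sub r∈) , there (proj₂ (sub r∈))
... | S , uS , sub , len = subst (_≤ length Q) len (Unique-⊆⇒length-≤ uS (proj₁ ∘ sub))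


-- Euler characteristic

-- Half of the dart count: there are `c` cancelled edges, `h` edges in the reduced word and `f - 1`
-- glued edges.
edge-arithmetic : ∀ e c h f {w x} → e ℕ.+ e ≡ w ℕ.+ x → w ≡ c ℕ.+ c ℕ.+ (h ℕ.+ h) → x ℕ.+ 2 ≡ f ℕ.+ f →
                  e ℕ.+ 1 ≡ c ℕ.+ h ℕ.+ f
edge-arithmetic e c h f {w} {x} 2e w≡ x≡ = ℕₚ.*-cancelˡ-≡ (e ℕ.+ 1) (c ℕ.+ h ℕ.+ f) 2 (begin
  2 ℕ.* (e ℕ.+ 1)                         ≡⟨ solve 1 (λ e → con 2 :* (e :+ con 1) := (e :+ e) :+ con 2) refl e ⟩
  (e ℕ.+ e) ℕ.+ 2                         ≡⟨ cong (ℕ._+ 2) 2e ⟩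
  w ℕ.+ x ℕ.+ 2                           ≡⟨ ℕₚ.+-assoc w x 2 ⟩
  w ℕ.+ (x ℕ.+ 2)                         ≡⟨ cong₂ ℕ._+_ w≡ x≡ ⟩
  c ℕ.+ c ℕ.+ (h ℕ.+ h) ℕ.+ (f ℕ.+ f)     ≡⟨ solve 3 (λ c h f → c :+ c :+ (h :+ h) :+ (f :+ f) := con 2 :* (c :+ h :+ f)) refl c h f ⟩
  2 ℕ.* (c ℕ.+ h ℕ.+ f)                   ∎)
  where
  open ≡.≡-Reasoning
  open +-*-Solver

sphere-arithmetic : ∀ v e f x → e ℕ.+ 1 ≡ x ℕ.+ f → (v ℕ.+ f ≡ e ℕ.+ 2) ⇔ (v ≡ x ℕ.+ 1)
sphere-arithmetic v e f x e+1 = mk⇔ (λ eq → ℕₚ.+-cancelʳ-≡ f _ _ (trans eq e+2))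
                                    (λ eq → trans (cong (ℕ._+ f) eq) (sym e+2))
  where
  open +-*-Solver
  e+2 : e ℕ.+ 2 ≡ x ℕ.+ 1 ℕ.+ f
  e+2 = trans (sym (ℕₚ.+-assoc e 1 1)) (trans (cong (ℕ._+ 1) e+1)
    (solve 2 (λ x f → x :+ f :+ con 1 := x :+ con 1 :+ f) refl x f))

module Euler (M : OrientedMap) (face≥2 : ∀ d → 2 ≤ Orbits.period (OrientedMap.φ M) (Surfaces.φ-inj M) d) where
  open OrientedMap M
  open Surfaces M

  -- A face with at least two sides has a nonempty tail. Gluing across `d` therefore replaces `d` by
  -- a path that still starts at the origin of `d`, so that no vertex is lost from the boundary.
  φα∈tail : ∀ e → φ e ∈ tailFace e
  φα∈tail e = ∈-applyUpTo⁺ (λ i → iter φ (suc i) e) {i = 0} (ℕₚ.≤-pred (face≥2 e))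

  vertex : Dart → Dart
  vertex = Σ′.rep

  open Walks M vertex

  vertex-φ : ∀ d → vertex (φ d) ≡ vertex (αf d)
  vertex-φ d = Σ′.rep-f (αf d)

  vertex-φα : ∀ d → vertex (φ (αf d)) ≡ vertex d
  vertex-φα d = trans (vertex-φ (αf d)) (cong vertex (α-invol d))

  Walk-orbit : ∀ (g : ℕ → Dart) → (∀ i → g (suc i) ≡ φ (g i)) → ∀ n →
               Walk (vertex (g 0)) (applyUpTo g n) (vertex (g n))
  Walk-orbit g step zero = refl
  Walk-orbit g step (suc n) = refl , subst (λ x → Walk x (applyUpTo (g ∘ suc) n) (vertex (g (suc n))))
    (trans (cong vertex (step 0)) (vertex-φ (g 0))) (Walk-orbit (g ∘ suc) (step ∘ suc) n)

  Walk-face : ∀ d → Walk (vertex d) (face d) (vertex d)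
  Walk-face d = subst (λ e → Walk (vertex d) (face d) (vertex e)) (Φ.iter-period d)
    (Walk-orbit (λ i → iter φ i d) (λ _ → refl) (Φ.period d))

  Walk-tail : ∀ d → Walk (vertex d) (tailFace (αf d)) (vertex (αf d))
  Walk-tail d = subst (λ x → Walk x (tailFace (αf d)) (vertex (αf d))) (cong vertex (α-invol d)) (proj₂ (Walk-face (αf d)))

  word-Walk : ∀ {d₀ W X rs} → Surgery d₀ W X rs → Walk (vertex d₀) W (vertex d₀)
  word-Walk {d₀} start = Walk-face d₀
  word-Walk (glue u d w s _) with Walk-++⁻ u (word-Walk s)
  ... | z , p , (refl , q) = Walk-++⁺ u p (Walk-++⁺ (tailFace (αf d)) (Walk-tail d) q)

  start-∈ : ∀ {x y} w → Walk x w y → x ∈ y ∷ map vertex w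
  start-∈ [] refl = here refl
  start-∈ (d ∷ w) (refl , _) = there (here refl)

  visits-++ʳ : ∀ u {w} {x y : Dart} → x ∈ y ∷ map vertex w → x ∈ y ∷ map vertex (u ++ w)
  visits-++ʳ u (here eq) = here eq
  visits-++ʳ u {w} {x} (there p) = there (subst (x ∈_) (sym (Listₚ.map-++ vertex u w)) (∈-++⁺ʳ (map vertex u) p))

  -- Faces glued in a tree pattern keep all their corners on the boundary. The base point is listed
  -- separately, because the corner where the new path ends may be the end of the whole word and
  -- then starts no letter.
  visits-all : ∀ {d₀ W X rs} → Surgery d₀ W X rs → ∀ {e} → e ∈ absorbed rs → vertex e ∈ vertex d₀ ∷ map vertex W
  visits-all {d₀} start {e} e∈ = there (∈-map⁺ vertex (subst (e ∈_) (Listₚ.++-identityʳ (face d₀)) e∈))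
  visits-all {d₀} {rs = _ ∷ rs} (glue u d w s _) {e} e∈ with ∈-++⁻ (face (αf d)) {absorbed rs} e∈
  ... | inj₁ (here refl) with Walk-++⁻ u (word-Walk s)
  ...   | _ , _ , (_ , q) = visits-++ʳ u (visits-++ʳ (tailFace (αf d)) (start-∈ w q))
  visits-all {d₀} (glue u d w s _) e∈ | inj₁ (there p) = there (∈-map⁺ vertex (∈-++⁺ʳ u (∈-++⁺ˡ p)))
  visits-all {d₀} (glue u d w s _) {e} e∈ | inj₂ p with visits-all s p
  ... | here eq = here eq
  ... | there q with ∈-map⁻ vertex q
  ...   | x , x∈ , eq with ∈-++⁻ u x∈
  ...     | inj₁ x∈u = there (subst (_∈ _) (sym eq) (∈-map⁺ vertex (∈-++⁺ˡ x∈u)))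
  ...     | inj₂ (here refl) = there (subst (_∈ _) (trans (vertex-φα d) (sym eq))
                                 (∈-map⁺ vertex (∈-++⁺ʳ u (∈-++⁺ˡ (φα∈tail (αf d))))))
  ...     | inj₂ (there x∈w) = there (subst (_∈ _) (sym eq) (∈-map⁺ vertex (∈-++⁺ʳ u (∈-++⁺ʳ (tailFace (αf d)) x∈w))))

  -- A cancelled pair walks along an edge and straight back. Only the turning point `vertex (αf d)`
  -- can disappear, for the walk goes on, or ends, at the origin of `d`.
  reduced-visits : ∀ {W c R x₀} → Reduces W c R → Walk x₀ W x₀ → ∃ λ vs → length vs ≡ c × Walk x₀ R x₀ ×
                   (∀ {y} → y ∈ x₀ ∷ map vertex W → y ∈ vs ++ (x₀ ∷ map vertex R))
  reduced-visits (done _) p = [] , refl , p , id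
  reduced-visits {x₀ = x₀} (cancel {R = R} u d w r) p with reduced-visits r (Walk-cancel u p) | Walk-++⁻ u p
  ... | vs , len , q , sub | z , pu , (refl , _ , pw) = vertex (αf d) ∷ vs , cong suc len , q , sub′
    where
    sub′ : ∀ {y} → y ∈ x₀ ∷ map vertex (u ++ d ∷ αf d ∷ w) → y ∈ (vertex (αf d) ∷ vs) ++ (x₀ ∷ map vertex R)
    sub′ (here eq) = there (sub (here eq))
    sub′ {y} (there y∈) with ∈-map⁻ vertex y∈
    ... | x , x∈ , refl with ∈-++⁻ u x∈
    ...   | inj₁ x∈u = there (sub (there (∈-map⁺ vertex (∈-++⁺ˡ x∈u))))
    ...   | inj₂ (here refl) = there (sub (visits-++ʳ u (subst (_∈ _) (cong vertex (α-invol d)) (start-∈ w pw))))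
    ...   | inj₂ (there (here refl)) = here refl
    ...   | inj₂ (there (there x∈w)) = there (sub (there (∈-map⁺ vertex (∈-++⁺ʳ u x∈w))))

  -- Each vertex of a reduced closed word is passed at two positions of the word;
  -- the base point contributes the extra position nothing.
  twice : ∀ {R x₀} → R ≢ [] → Closed R → NoCancel R → Walk x₀ R x₀ →
          ∃ λ (N : List Dart) → length N ℕ.+ length N ≤ suc (length R) × (∀ {y} → y ∈ x₀ ∷ map vertex R → y ∈ N)
  twice {R} {x₀} R≢[] cl nc walk = N , subst (length N ℕ.+ length N ≤_) (cong suc (Listₚ.length-map just R)) count , sub
    where
    open import Data.List using (deduplicate)
    import Data.List.Membership.Propositional.Properties as ∈ₚ
    import Data.List.Relation.Unary.Unique.DecPropositional.Properties (Finₚ._≟_ {m}) as UDₚ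
    N = deduplicate Finₚ._≟_ (x₀ ∷ map vertex R)
    Q = nothing ∷ map just R
    lab : Maybe Dart → Dart
    lab nothing = x₀
    lab (just d) = vertex d
    sub : ∀ {y} → y ∈ x₀ ∷ map vertex R → y ∈ N
    sub = ∈ₚ.∈-deduplicate⁺ Finₚ._≟_
    Two : Dart → Set
    Two y = ∃₂ λ p q → p ∈ Q × q ∈ Q × p ≢ q × lab p ≡ y × lab q ≡ y
    two : ∀ {y} → y ∈ N → Two y
    two y∈ with ∈ₚ.∈-deduplicate⁻ Finₚ._≟_ (x₀ ∷ map vertex R) y∈
    ... | here refl = base R refl
      where
      base : ∀ S → R ≡ S → Two x₀
      base [] eq = ⊥-elim (R≢[] eq)
      base (s ∷ S) refl = nothing , just s , here refl , there (here refl) , (λ ()) , refl , proj₁ walk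
    ... | there p with ∈-map⁻ vertex p
    -- The partner `αf d` ends at the origin of `d`, so the following letter starts there. That
    -- letter is not `d`, since the word has no cancellation. If no letter follows, the second
    -- position is `nothing`.
    ...   | d , d∈ , refl with split-∈ (cl d∈)
    ...     | u , w , eq with Walk-++⁻ u (subst (λ l → Walk x₀ l x₀) eq walk)
    ...       | _ , _ , (_ , q) = next w eq q
      where
      next : ∀ w → R ≡ u ++ αf d ∷ w → Walk (vertex (αf (αf d))) w x₀ → Two (vertex d)
      next [] eq q = just d , nothing , there (∈-map⁺ just d∈) , here refl , (λ ()) , refl ,
        trans (sym q) (cong vertex (α-invol d))
      next (s ∷ w) eq (q , _) = just d , just s , there (∈-map⁺ just d∈) ,
        there (∈-map⁺ just (subst (s ∈_) (sym eq) (∈-++⁺ʳ u (there (here refl))))) ,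
        (λ { refl → nc u (αf d) w (subst (λ z → R ≡ u ++ αf d ∷ z ∷ w) (sym (α-invol d)) eq) }) , refl ,
        trans q (cong vertex (α-invol d))
    count = two-per-fibre lab Q N (UDₚ.deduplicate-! (x₀ ∷ map vertex R)) two

  -- A dart carries the labels of its two ends, composition is concatenation of matching paths, and
  -- a closed face has consistent labels at its corners. Extension in this structure spreads vertex
  -- labels from the boundary word to the whole surface.
  Paths : Holonomy 0ℓ 0ℓ
  Paths = record
    { B = ℕ × ℕ
    ; Comp = Chain
    ; Inv = λ (a , b) (c , d) → a ≡ d × b ≡ c
    ; Inv-sym = λ (p , q) → sym q , sym p
    ; inv = λ (a , b) → (b , a) , refl , refl
    ; factor = factor
    }
    where
    Chain : List (ℕ × ℕ) → ℕ × ℕ → Set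
    Chain [] (x , y) = x ≡ y
    Chain ((a , b) ∷ l) (x , y) = a ≡ x × Chain l (b , y)
    cut : ∀ ts {ws x y} → Chain (ts ++ ws) (x , y) → ∃ λ z → Chain ts (x , z) × Chain ws (z , y)
    cut [] p = _ , refl , p
    cut (_ ∷ ts) (eq , p) with cut ts p
    ... | z , p , q = z , (eq , p) , q
    paste : ∀ ts {ws x y z} → Chain ts (x , z) → Chain ws (z , y) → Chain (ts ++ ws) (x , y)
    paste [] refl q = q
    paste (_ ∷ ts) (eq , p) q = eq , paste ts p q
    factor : ∀ us ts ws {g} → Chain (us ++ ts ++ ws) g → ∃ λ b → Chain ts b × Chain (us ++ b ∷ ws) g
    factor us ts ws p with cut us p
    ... | x , pu , q with cut ts q
    ...   | y , pt , pw = (x , y) , pt , paste us pu (refl , pw)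

  module P = Holonomy Paths
  module PE = Extension M Paths

  -- Undoing the cancellations: each of them introduces one new vertex.
  unfold-labels : ∀ {W c} → Reduces W c [] → Unique W → ∃ λ (ℓ : Dart → ℕ) → Walks.Walk M ℓ 0 W 0 ×
                  (∀ i → i < c → ∃ λ d → d ∈ W × ℓ d ≡ suc i)
  unfold-labels (done _) _ = (λ _ → 0) , refl , λ _ ()
  unfold-labels (cancel {c} u d w r) uq with unfold-labels r (cancel-Unique u uq)
  ... | ℓ , walk , values with Walks.Walk-++⁻ M ℓ u walk
  ...   | z , pu , pw = ℓ′ , Walks.Walk-++⁺ M ℓ′ u (Walk-cong M ℓ ℓ′ (agree ∘ ∈-++⁺ˡ) pu)
            (ℓ′-d , refl , subst (λ x → Walks.Walk M ℓ′ x w 0) (sym (trans (cong ℓ′ (α-invol d)) ℓ′-d))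
               (Walk-cong M ℓ ℓ′ (agree ∘ ∈-++⁺ʳ u) pw)) , values′
    where
    ℓ′ : Dart → ℕ
    ℓ′ = ℓ [ αf d ↦ suc c ] [ d ↦ z ]
    ℓ′-d : ℓ′ d ≡ z
    ℓ′-d = ↦-≡
    ℓ′-αd : ℓ′ (αf d) ≡ suc c
    ℓ′-αd = trans (↦-≢ (α-fpf d)) ↦-≡
    ℓ′-other : ∀ {x} → x ≢ d → x ≢ αf d → ℓ′ x ≡ ℓ x
    ℓ′-other x≢d x≢αd = trans (↦-≢ x≢d) (↦-≢ x≢αd)
    d∉ : d ∉ u ++ w
    d∉ p = ∉-of-Unique u uq (∈-unremove u p)
    αd∉ : αf d ∉ u ++ w
    αd∉ = ∉-of-Unique u (Unique-remove u uq)
    agree : ∀ {x} → x ∈ u ++ w → ℓ′ x ≡ ℓ x × ℓ′ (αf x) ≡ ℓ (αf x)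
    agree x∈ = ℓ′-other (λ { refl → d∉ x∈ }) (λ { refl → αd∉ x∈ }) ,
      ℓ′-other (λ αx≡d → αd∉ (subst (_∈ u ++ w) (α-swap αx≡d) x∈)) (λ αx≡αd → d∉ (subst (_∈ u ++ w) (α-inj αx≡αd) x∈))
    values′ : ∀ i → i < suc c → ∃ λ x → x ∈ u ++ d ∷ αf d ∷ w × ℓ′ x ≡ suc i
    values′ i (s≤s i≤c) with ℕₚ.m≤n⇒m<n∨m≡n i≤c
    ... | inj₁ i<c = let x , x∈ , eq = values i i<c in
          x , ∈-unremove u (∈-unremove u x∈) , trans (proj₁ (agree x∈)) eq
    ... | inj₂ refl = αf d , ∈-++⁺ʳ u (there (here refl)) , ℓ′-αd

  Walk⇒Chain : ∀ (ℓ : Dart → ℕ) W {x y} → Walks.Walk M ℓ x W y → P.Comp (map (λ d → ℓ d , ℓ (αf d)) W) (x , y)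
  Walk⇒Chain ℓ [] p = p
  Walk⇒Chain ℓ (d ∷ W) (eq , p) = eq , Walk⇒Chain ℓ W p

  consecutive : ∀ (f : Dart → ℕ × ℕ) (g : ℕ → Dart) n {x y} → P.Comp (map f (applyUpTo g (suc n))) (x , y) →
                proj₁ (f (g 0)) ≡ x × (∀ i → i < n → proj₂ (f (g i)) ≡ proj₁ (f (g (suc i)))) × proj₂ (f (g n)) ≡ y
  consecutive f g zero (eq , p) = eq , (λ _ ()) , p
  consecutive f g (suc n) (eq , p) with consecutive f (g ∘ suc) n p
  ... | eq′ , cons , last = eq , (λ { zero _ → sym eq′ ; (suc i) (s≤s i<n) → cons i i<n }) , last

  around : ∀ (f : Dart → ℕ × ℕ) r {x} → P.Comp (map f (face r)) (x , x) → ∀ {e} → SameFace r e →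
           proj₂ (f e) ≡ proj₁ (f (φ e))
  around f r comp {e} so with ∈-applyUpTo⁻ (λ i → iter φ i r) {n = Φ.period r} (Φ.∈-orbit⁺ so)
                            | consecutive f (λ i → iter φ i r) (Φ.period-1 r) comp
  ... | i , s≤s i≤ , refl | first , cons , last with ℕₚ.m≤n⇒m<n∨m≡n i≤
  ...   | inj₁ i< = cons i i<
  ...   | inj₂ refl = trans last (trans (sym first) (cong (proj₁ ∘ f) (sym (Φ.iter-period r))))

  module _ {d₀} (C : Complete {d₀}) where
    open Complete C

    module _ {c R} (red : Reduces W c R) where

      R-closed : Closed R
      R-closed = Reduces-Closed red (Unique-W surgery) W-closed

      R-unique : Unique R
      R-unique = Reduces-Unique red (Unique-W surgery)

      half : ℕ
      half = length (proj₁ (pair-reps R-unique (paired _ ℕₚ.≤-refl R-unique R-closed)))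

      length-R : length R ≡ half ℕ.+ half
      length-R = proj₁ (proj₂ (pair-reps R-unique (paired _ ℕₚ.≤-refl R-unique R-closed)))

      #E+1 : #E ℕ.+ 1 ≡ c ℕ.+ half ℕ.+ #F
      #E+1 = edge-arithmetic #E c half #F (trans #E+#E≡m (dart-count C))
        (trans (Reduces-length red) (cong ((c ℕ.+ c) ℕ.+_) length-R))
        (trans (length-X surgery) (cong₂ ℕ._+_ (sym (#F≡ C)) (sym (#F≡ C))))

      sphere⇔ : (#V ℕ.+ #F ≡ #E ℕ.+ 2) ⇔ (#V ≡ c ℕ.+ half ℕ.+ 1)
      sphere⇔ = sphere-arithmetic #V #E #F (c ℕ.+ half) #E+1

      V≤ : ∀ (N : List Dart) → (∀ {y} → y ∈ vertex d₀ ∷ map vertex R → y ∈ N) → #V ≤ c ℕ.+ length N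
      V≤ N sub with reduced-visits red (word-Walk surgery)
      ... | vs , refl , _ , sub′ = ℕₚ.≤-trans
        (OrbitCount.cover⇒#orbits≤ M σf σ-inj (vs ++ N) (λ d → vertex d , visited d , Σ′.SameOrbit-sym (Σ′.rep-∈ d)))
        (ℕₚ.≤-reflexive (Listₚ.length-++ vs))
        where
        visited : ∀ d → vertex d ∈ vs ++ N
        visited d with ∈-++⁻ vs (sub′ (visits-all surgery (all-absorbed C d)))
        ... | inj₁ p = ∈-++⁺ˡ p
        ... | inj₂ p = ∈-++⁺ʳ vs (sub p)

      sphere⇒trivial : #V ℕ.+ #F ≡ #E ℕ.+ 2 → R ≢ [] → ⊥
      sphere⇒trivial sph R≢[]
        with reduced-visits red (word-Walk surgery)
      ... | _ , _ , walkR , _ with twice R≢[] R-closed (Reduces-NoCancel red) walkR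
      ...   | N , 2N≤ , sub = ℕₚ.<-irrefl refl (begin-strict
        c ℕ.+ length N            ≤⟨ ℕₚ.+-monoʳ-≤ c N≤ ⟩
        c ℕ.+ half                <⟨ ℕₚ.m<m+n (c ℕ.+ half) (s≤s z≤n) ⟩
        c ℕ.+ half ℕ.+ 1          ≡⟨ sym (Equivalence.to sphere⇔ sph) ⟩
        #V                        ≤⟨ V≤ N sub ⟩
        c ℕ.+ length N            ∎)
        where
        open ℕₚ.≤-Reasoning
        -- The one extra position is absorbed by parity: `2 * length N ≤ 2 * half + 1` already gives
        -- `length N ≤ half`.
        N≤ : length N ≤ half
        N≤ = ℕₚ.≮⇒≥ λ h<N → ℕₚ.<-irrefl refl (begin-strict
          suc (half ℕ.+ half)       <⟨ s≤s (ℕₚ.≤-reflexive (sym (ℕₚ.+-suc half half))) ⟩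
          suc half ℕ.+ suc half     ≤⟨ ℕₚ.+-mono-≤ h<N h<N ⟩
          length N ℕ.+ length N     ≤⟨ 2N≤ ⟩
          suc (length R)            ≡⟨ cong suc length-R ⟩
          suc (half ℕ.+ half)       ∎)

    -- The labels obtained by undoing the cancellations extend over the glued edges. Since every
    -- face then closes up, the label of an origin is constant on vertices, and the `c + 1` values
    -- `0` to `c` tell as many vertices apart.
    ≤V : ∀ {c} → Reduces W c [] → suc c ≤ #V
    ≤V {c} red with unfold-labels red (Unique-W surgery)
    ... | ℓ , walk , values with PE.extend surgery (λ d → ℓ d , ℓ (αf d)) (λ d → cong ℓ (sym (α-invol d)) , refl) {0 , 0} (Walk⇒Chain ℓ W walk)
    ...   | PE.extended f anti agree flat root =
      let ds , len , _ , sep = build c ℕₚ.≤-refl in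
      subst (_≤ #V) len (OrbitCount.separated⇒≤#orbits M σf σ-inj ds sep)
      where
      closed-face : ∀ {r} → r ∈ rs → ∃ λ x → P.Comp (map f (face r)) (x , x)
      closed-face {r} r∈ with r Finₚ.≟ d₀
      ... | yes refl = 0 , root
      ... | no r≢ with flat r∈ r≢
      ...   | (x , y) , comp , (eq₁ , eq₂) = y , eq₁ , subst (λ z → P.Comp (map f (tailFace r)) (z , y)) (sym eq₂) comp
      label : Dart → ℕ
      label = proj₁ ∘ f
      label-φ : ∀ e → label (φ e) ≡ label (αf e)
      label-φ e with faces-covered C e
      ... | r , r∈ , so = trans (sym (around f r (proj₂ (closed-face r∈)) so)) (proj₂ (anti e))
      label-σ : ∀ d → label (σf d) ≡ label d
      label-σ d = trans (cong (label ∘ σf) (sym (α-invol d))) (trans (label-φ (αf d)) (cong label (α-invol d)))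
      label-orbit : ∀ {d e} → Σ′.SameOrbit d e → label d ≡ label e
      label-orbit (zero , refl) = refl
      label-orbit {d} (suc k , refl) = trans (label-orbit (k , refl)) (sym (label-σ (iter σf k d)))
      attained : ∀ i → i ≤ c → ∃ λ d → label d ≡ i
      attained zero _ = d₀ , proj₁ root
      attained (suc i) i<c with values i i<c
      ... | d , d∈ , eq = d , trans (cong proj₁ (agree (Unique-++-disjoint (Unique-WX surgery) d∈))) eq
      build : ∀ n → n ≤ c → ∃ λ ds → length ds ≡ suc n × All (λ d → label d ≤ n) ds ×
              AllPairs (λ x y → ¬ Σ′.SameOrbit x y) ds
      build zero n≤ with attained 0 n≤
      ... | d , eq = d ∷ [] , refl , ℕₚ.≤-reflexive eq ∷ [] , [] ∷ []
      build (suc n) n≤ with attained (suc n) n≤ | build n (ℕₚ.≤-trans (ℕₚ.n≤1+n n) n≤)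
      ... | d , eq | ds , len , small , sep = d ∷ ds , cong suc len ,
        ℕₚ.≤-reflexive eq ∷ All.map (λ le → ℕₚ.≤-trans le (ℕₚ.n≤1+n n)) small ,
        All.map (λ le so → ℕₚ.<-irrefl (trans (sym (label-orbit so)) eq) (s≤s le)) small ∷ sep

    trivial⇒sphere : ∀ {c} → Reduces W c [] → #V ℕ.+ #F ≡ #E ℕ.+ 2
    trivial⇒sphere {c} red = Equivalence.from (sphere⇔ red)
      (trans (ℕₚ.≤-antisym (subst (#V ≤_) (ℕₚ.+-comm c 1) (V≤ red (vertex d₀ ∷ []) id)) (≤V red))
        (trans (ℕₚ.+-comm 1 c) (cong (ℕ._+ 1) (sym (ℕₚ.+-identityʳ c)))))

-- Holonomy of connections

module Connections (M : OrientedMap) {c ℓ} (G : Group c ℓ) where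
  open OrientedMap M
  open Surfaces M
  open Group G renaming (refl to ≈-refl; sym to ≈-sym; trans to ≈-trans; setoid to ≈-setoid; inverse to ⁻¹-inverse)
  open import Algebra.Properties.Group G using (inverseʳ-unique; inverseˡ-unique; ⁻¹-anti-homo-∙; x∙y⁻¹≈ε⇒x≈y)
  open import Relation.Binary.Reasoning.Setoid ≈-setoid

  prod : List Carrier → Carrier
  prod [] = ε
  prod (x ∷ xs) = x ∙ prod xs

  prod-++ : ∀ xs {ys} → prod (xs ++ ys) ≈ prod xs ∙ prod ys
  prod-++ [] = ≈-sym (identityˡ _)
  prod-++ (x ∷ xs) = ≈-trans (∙-congˡ (prod-++ xs)) (≈-sym (assoc x _ _))

  ∙≈ε-sym : ∀ {x y} → x ∙ y ≈ ε → y ∙ x ≈ ε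
  ∙≈ε-sym {x} {y} p = ≈-trans (∙-congʳ (inverseʳ-unique x y p)) (inverseˡ x)

  GroupHolonomy : Holonomy c ℓ
  GroupHolonomy = record
    { B = Carrier
    ; Comp = λ l g → prod l ≈ g
    ; Inv = λ x y → x ∙ y ≈ ε
    ; Inv-sym = ∙≈ε-sym
    ; inv = λ x → x ⁻¹ , inverseʳ x
    ; factor = λ us ts ws p → prod ts , ≈-refl , ≈-trans (collapse us ts ws) p
    }
    where
    collapse : ∀ us ts ws → prod (us ++ prod ts ∷ ws) ≈ prod (us ++ ts ++ ws)
    collapse us ts ws = ≈-trans (prod-++ us)
      (≈-trans (∙-congˡ (≈-sym (prod-++ ts))) (≈-sym (prod-++ us)))

  open Extension M GroupHolonomy using (Antisym; FlatAt; extended; extend)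

  hol : (Dart → Carrier) → List Dart → Carrier
  hol a W = prod (map a W)

  Flat : (Dart → Carrier) → Dart → Set ℓ
  Flat a e = hol a (face e) ≈ ε

  hol-++ : ∀ a u {w} → hol a (u ++ w) ≈ hol a u ∙ hol a w
  hol-++ a u {w} = ≈-trans (reflexive (cong prod (Listₚ.map-++ a u w))) (prod-++ (map a u))

  Flat-φ : ∀ a {e} → Flat a e → Flat a (φ e)
  Flat-φ a {e} flat = begin
    hol a (face (φ e))               ≡⟨ cong (hol a) (Φ.orbit-f e) ⟩
    hol a (tailFace e ++ [ e ])      ≈⟨ hol-++ a (tailFace e) ⟩
    hol a (tailFace e) ∙ (a e ∙ ε)   ≈⟨ ∙-congˡ (identityʳ (a e)) ⟩
    hol a (tailFace e) ∙ a e         ≈⟨ ∙≈ε-sym flat ⟩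
    ε                                ∎

  Flat-face : ∀ a {e e′} → SameFace e e′ → Flat a e → Flat a e′
  Flat-face a (zero , refl) flat = flat
  Flat-face a (suc k , refl) flat = Flat-φ a (Flat-face a (k , refl) flat)

  -- Flatness of the absorbed face says that `d` and the path around that face have equal holonomy,
  -- so a gluing changes nothing. The absorbed face is never that of `d₀`, which is absorbed from
  -- the start.
  hol-surgery : ∀ a → Antisym a → ∀ {d₀ W X rs} → Surgery d₀ W X rs →
                (∀ e → ¬ SameFace d₀ e → Flat a e) → hol a (face d₀) ≈ hol a W
  hol-surgery a anti start flat = ≈-refl
  hol-surgery a anti {d₀} (glue {rs = rs} u d w s new) flat = begin
    hol a (face d₀)                     ≈⟨ hol-surgery a anti s flat ⟩
    hol a (u ++ d ∷ w)                  ≈⟨ hol-++ a u ⟩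
    hol a u ∙ (a d ∙ hol a w)           ≈⟨ ∙-congˡ (∙-congʳ a-d) ⟩
    hol a u ∙ (hol a t ∙ hol a w)       ≈⟨ ∙-congˡ (hol-++ a t) ⟨
    hol a u ∙ hol a (t ++ w)            ≈⟨ hol-++ a u ⟨
    hol a (u ++ t ++ w)                 ∎
    where
    t = tailFace (αf d)
    a-d : a d ≈ hol a t
    a-d = ≈-trans (inverseˡ-unique _ _ (anti d)) (≈-sym (inverseʳ-unique _ _
            (flat (αf d) (λ so → new (absorbed-face {rs} so (root-absorbed s))))))

  hol-reduces : ∀ a → Antisym a → ∀ {W n R} → Reduces W n R → hol a W ≈ hol a R
  hol-reduces a anti (done _) = ≈-refl
  hol-reduces a anti {R = R} (cancel u d w r) = begin
    hol a (u ++ d ∷ αf d ∷ w)                    ≈⟨ hol-++ a u ⟩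
    hol a u ∙ (a d ∙ (a (αf d) ∙ hol a w))       ≈⟨ ∙-congˡ (assoc _ _ _) ⟨
    hol a u ∙ ((a d ∙ a (αf d)) ∙ hol a w)       ≈⟨ ∙-congˡ (∙-congʳ (anti d)) ⟩
    hol a u ∙ (ε ∙ hol a w)                      ≈⟨ ∙-congˡ (identityˡ _) ⟩
    hol a u ∙ hol a w                            ≈⟨ hol-++ a u ⟨
    hol a (u ++ w)                               ≈⟨ hol-reduces a anti r ⟩
    hol a R                                      ∎

  hol-paired : (∀ x y → x ∙ y ≈ y ∙ x) → ∀ a → Antisym a → ∀ {W} → Paired W → hol a W ≈ ε
  hol-paired comm a anti [] = ≈-refl
  hol-paired comm a anti (pair d u w p) = begin
    a d ∙ hol a (u ++ αf d ∷ w)                  ≈⟨ ∙-congˡ (hol-++ a u) ⟩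
    a d ∙ (hol a u ∙ (a (αf d) ∙ hol a w))       ≈⟨ ∙-congˡ (assoc _ _ _) ⟨
    a d ∙ ((hol a u ∙ a (αf d)) ∙ hol a w)       ≈⟨ ∙-congˡ (∙-congʳ (comm _ _)) ⟩
    a d ∙ ((a (αf d) ∙ hol a u) ∙ hol a w)       ≈⟨ ∙-congˡ (assoc _ _ _) ⟩
    a d ∙ (a (αf d) ∙ (hol a u ∙ hol a w))       ≈⟨ assoc _ _ _ ⟨
    (a d ∙ a (αf d)) ∙ (hol a u ∙ hol a w)       ≈⟨ ∙-cong (anti d) (≈-sym (hol-++ a u)) ⟩
    ε ∙ hol a (u ++ w)                           ≈⟨ identityˡ _ ⟩
    hol a (u ++ w)                               ≈⟨ hol-paired comm a anti p ⟩
    ε                                            ∎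

  hol-trivial : ∀ a {W} → (∀ {z} → z ∈ W → a z ≡ ε) → hol a W ≈ ε
  hol-trivial a {[]} triv = ≈-refl
  hol-trivial a {d ∷ W} triv = ≈-trans (∙-cong (reflexive (triv (here refl))) (hol-trivial a (triv ∘ there))) (identityˡ ε)

  hol-skip : ∀ a p {w} → (∀ {z} → z ∈ p → a z ≡ ε) → hol a (p ++ w) ≈ hol a w
  hol-skip a p triv = ≈-trans (hol-++ a p) (≈-trans (∙-congʳ (hol-trivial a triv)) (identityˡ _))

  commutator : Carrier → Carrier → Carrier
  commutator X Y = X ∙ (Y ∙ (X ⁻¹ ∙ Y ⁻¹))

  commutator≈ε⇒commute : ∀ X Y → commutator X Y ≈ ε → X ∙ Y ≈ Y ∙ X
  commutator≈ε⇒commute X Y eq = x∙y⁻¹≈ε⇒x≈y (X ∙ Y) (Y ∙ X)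
    (≈-trans (∙-congˡ (⁻¹-anti-homo-∙ Y X)) (≈-trans (assoc X Y _) eq))

  -- The connection is supported on the two crossing edges; every other letter contributes `ε`, and
  -- the crossing pattern reads off the commutator.
  hol-crossing : ∀ {R} → Unique R → Interlaced R → ∀ X Y → ∃ λ a → Antisym a × hol a R ≈ commutator X Y
  hol-crossing {R} uq (crossing x e p q r s t eq) X Y = a , anti , (begin
    hol a R                                                            ≡⟨ cong (hol a) eq ⟩
    hol a (p ++ x ∷ q ++ e ∷ r ++ αf x ∷ s ++ αf e ∷ t)                ≈⟨ hol-skip a p (in-rest ∘ ∈-++⁺ˡ) ⟩
    a x ∙ hol a (q ++ e ∷ r ++ αf x ∷ s ++ αf e ∷ t)                   ≈⟨ ∙-cong (reflexive a-x) (hol-skip a q (in-rest ∘ ∈-++⁺ʳ p ∘ ∈-++⁺ˡ)) ⟩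
    X ∙ (a e ∙ hol a (r ++ αf x ∷ s ++ αf e ∷ t))                      ≈⟨ ∙-congˡ (∙-cong (reflexive a-e) (hol-skip a r (in-rest ∘ ∈-++⁺ʳ p ∘ ∈-++⁺ʳ q ∘ ∈-++⁺ˡ))) ⟩
    X ∙ (Y ∙ (a (αf x) ∙ hol a (s ++ αf e ∷ t)))                       ≈⟨ ∙-congˡ (∙-congˡ (∙-cong (reflexive a-αx) (hol-skip a s (in-rest ∘ ∈-++⁺ʳ p ∘ ∈-++⁺ʳ q ∘ ∈-++⁺ʳ r ∘ ∈-++⁺ˡ)))) ⟩
    X ∙ (Y ∙ (X ⁻¹ ∙ (a (αf e) ∙ hol a t)))                            ≈⟨ ∙-congˡ (∙-congˡ (∙-congˡ (∙-cong (reflexive a-αe)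
                                                                            (hol-trivial a (in-rest ∘ ∈-++⁺ʳ p ∘ ∈-++⁺ʳ q ∘ ∈-++⁺ʳ r ∘ ∈-++⁺ʳ s))))) ⟩
    X ∙ (Y ∙ (X ⁻¹ ∙ (Y ⁻¹ ∙ ε)))                                      ≈⟨ ∙-congˡ (∙-congˡ (∙-congˡ (identityʳ _))) ⟩
    commutator X Y                                                     ∎)
    where
    rest = p ++ q ++ r ++ s ++ t
    lift : ∀ hs {y B T} p → B ↭ hs ++ T → p ++ y ∷ B ↭ (y ∷ hs) ++ (p ++ T)
    lift hs {y} {B} p B↭ = ↭-trans (Permₚ.shift y p B) (↭-prep y (↭-trans (Permₚ.++⁺ˡ p B↭) (Permₚ.shifts p hs)))
    -- Moving the four special letters to the front makes all the required distinctness facts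
    -- instances of one uniqueness proof.
    uq′ : Unique (x ∷ e ∷ αf x ∷ αf e ∷ rest)
    uq′ = Unique-resp-↭ (lift (e ∷ αf x ∷ αf e ∷ []) p (lift (αf x ∷ αf e ∷ []) q (lift (αf e ∷ []) r (lift [] s ↭-refl)))) (subst Unique eq uq)
    a : Dart → Carrier
    a = (λ _ → ε) [ αf e ↦ Y ⁻¹ ] [ e ↦ Y ] [ αf x ↦ X ⁻¹ ] [ x ↦ X ]
    e≢x : e ≢ x
    e≢x refl = Uniqueₚ.Unique[x∷xs]⇒x∉xs uq′ (here refl)
    αe≢x : αf e ≢ x
    αe≢x αe≡x = Uniqueₚ.Unique[x∷xs]⇒x∉xs uq′ (there (there (here (sym αe≡x))))
    a-x : a x ≡ X
    a-x = ↦-≡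
    a-αx : a (αf x) ≡ X ⁻¹
    a-αx = trans (↦-≢ (α-fpf x)) ↦-≡
    a-e : a e ≡ Y
    a-e = trans (↦-≢ e≢x) (trans (↦-≢ (λ e≡αx → αe≢x (sym (α-swap (sym e≡αx))))) ↦-≡)
    a-αe : a (αf e) ≡ Y ⁻¹
    a-αe = trans (↦-≢ αe≢x) (trans (↦-≢ (λ αe≡αx → e≢x (α-inj αe≡αx))) (trans (↦-≢ (α-fpf e)) ↦-≡))
    a-other : ∀ {z} → z ≢ x → z ≢ αf x → z ≢ e → z ≢ αf e → a z ≡ ε
    a-other z≢x z≢αx z≢e z≢αe = trans (↦-≢ z≢x) (trans (↦-≢ z≢αx) (trans (↦-≢ z≢e) (↦-≢ z≢αe)))
    in-rest : ∀ {z} → z ∈ rest → a z ≡ ε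
    in-rest {z} z∈ with uq′
    ... | px ∷ (pe ∷ (pαx ∷ (pαe ∷ _))) = a-other {z}
      (λ { refl → All.lookup px (there (there (there z∈))) refl })
      (λ { refl → All.lookup pαx (there z∈) refl })
      (λ { refl → All.lookup pe (there (there z∈)) refl })
      (λ { refl → All.lookup pαe z∈ refl })
    anti : Antisym a
    anti z = go (z Finₚ.≟ x) (z Finₚ.≟ αf x) (z Finₚ.≟ e) (z Finₚ.≟ αf e)
      where
      go : Dec (z ≡ x) → Dec (z ≡ αf x) → Dec (z ≡ e) → Dec (z ≡ αf e) → a z ∙ a (αf z) ≈ ε
      go (yes refl) _ _ _ = ≈-trans (∙-cong (reflexive a-x) (reflexive a-αx)) (inverseʳ X)
      go _ (yes refl) _ _ = ≈-trans (∙-cong (reflexive a-αx) (reflexive (trans (cong a (α-invol x)) a-x))) (inverseˡ X)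
      go _ _ (yes refl) _ = ≈-trans (∙-cong (reflexive a-e) (reflexive a-αe)) (inverseʳ Y)
      go _ _ _ (yes refl) = ≈-trans (∙-cong (reflexive a-αe) (reflexive (trans (cong a (α-invol e)) a-e))) (inverseˡ Y)
      go (no z≢x) (no z≢αx) (no z≢e) (no z≢αe) = ≈-trans (∙-cong (reflexive (a-other {z} z≢x z≢αx z≢e z≢αe))
        (reflexive (a-other {αf z} (λ αz≡ → z≢αx (α-swap αz≡)) (λ αz≡ → z≢x (α-inj αz≡))
                            (λ αz≡ → z≢αe (α-swap αz≡)) (λ αz≡ → z≢e (α-inj αz≡))))) (identityˡ ε)

  module _ (face≥2 : ∀ d → 2 ≤ Φ.period d) where
    open Euler M face≥2

    last-face-flat : ((∀ x y → x ∙ y ≈ y ∙ x) ⊎ (#V ℕ.+ #F ≡ #E ℕ.+ 2)) → ∀ a → Antisym a → ∀ d₀ →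
                     (∀ e → ¬ SameFace d₀ e → Flat a e) → Flat a d₀
    last-face-flat hyp a anti d₀ flat = ≈-trans (hol-surgery a anti surgery flat) (trivial hyp)
      where
      C = completion d₀
      open Complete C
      trivial : ((∀ x y → x ∙ y ≈ y ∙ x) ⊎ (#V ℕ.+ #F ≡ #E ℕ.+ 2)) → hol a W ≈ ε
      trivial (inj₁ comm) = hol-paired comm a anti (paired _ ℕₚ.≤-refl (Unique-W surgery) W-closed)
      trivial (inj₂ sph) with reduction (length W) W ℕₚ.≤-refl
      ... | n , [] , red = hol-reduces a anti red
      ... | n , _ ∷ _ , red = ⊥-elim (sphere⇒trivial C red sph (λ ()))

    -- The values are prescribed on the reduced word. Cancelled pairs contribute nothing, so the
    -- commutator is also the holonomy of `W`; extension then overwrites the glued edges so that all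
    -- other faces become flat and the exceptional face inherits it.
    last-face-commutator : #V ℕ.+ #F ≢ #E ℕ.+ 2 → ∀ X Y d₀ → ∃ λ a → Antisym a ×
                           (∀ e → ¬ SameFace d₀ e → Flat a e) × hol a (face d₀) ≈ commutator X Y
    last-face-commutator ¬sph X Y d₀ with completion d₀
    ... | C with reduction (length (Complete.W C)) (Complete.W C) ℕₚ.≤-refl
    ...   | n , [] , red = ⊥-elim (¬sph (trivial⇒sphere C red))
    ...   | n , R@(_ ∷ _) , red with hol-crossing (R-unique C red)
                                  (interlaced (λ ()) (R-unique C red) (R-closed C red) (Reduces-NoCancel red)) X Y
    ...     | a , anti , hol-R with extend surgery a anti (≈-trans (hol-reduces a anti red) hol-R)
      where open Complete C
    ...       | extended a* anti* _ flat* root = a* , anti* , flat , root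
      where
      flat : ∀ e → ¬ SameFace d₀ e → Flat a* e
      flat e ¬so with faces-covered C e
      ... | r , r∈ , so with flat* r∈ (λ { refl → ¬so so })
      ...   | b , comp , inv = Flat-face a* so (≈-trans (∙-congˡ comp) inv)

-- Linear algebra over a division ring

EM : Setω
EM = ∀ {ℓ} → ExcludedMiddle ℓ

module DivisionRings (lem : EM) {ℓ₁ ℓ₂} (D : DivisionRing ℓ₁ ℓ₂) where
  open DivisionRing D renaming (refl to ≈-refl; sym to ≈-sym; trans to ≈-trans; setoid to ≈-setoid)
  open import Algebra.Properties.Ring ring
  import Algebra.Properties.Semiring.Sum semiring as Sum
  open import Relation.Binary.Reasoning.Setoid ≈-setoid

  _≈?_ : ∀ x y → Dec (x ≈ y)
  x ≈? y = lem

  ¬≉⇒≈ : ∀ {x y} → ¬ x ≉ y → x ≈ y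
  ¬≉⇒≈ {x} {y} ¬¬eq with x ≈? y
  ... | yes eq = eq
  ... | no neq = ⊥-elim (¬¬eq neq)

  1≉0 : 1# ≉ 0#
  1≉0 eq = 0≉1 (≈-sym eq)

  inv : ∀ x → x ≉ 0# → Carrier
  inv x nz = proj₁ (inverse x nz)

  *-inv : ∀ x nz → x * inv x nz ≈ 1#
  *-inv x nz = proj₁ (proj₂ (inverse x nz))

  inv-* : ∀ x nz → inv x nz * x ≈ 1#
  inv-* x nz = proj₂ (proj₂ (inverse x nz))

  *-cancelˡ : ∀ {x y z} → x ≉ 0# → x * y ≈ x * z → y ≈ z
  *-cancelˡ {x} {y} {z} nz eq = begin
    y                      ≈⟨ *-identityˡ y ⟨
    1# * y                 ≈⟨ *-congʳ (inv-* x nz) ⟨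
    inv x nz * x * y       ≈⟨ *-assoc _ _ _ ⟩
    inv x nz * (x * y)     ≈⟨ *-congˡ eq ⟩
    inv x nz * (x * z)     ≈⟨ *-assoc _ _ _ ⟨
    inv x nz * x * z       ≈⟨ *-congʳ (inv-* x nz) ⟩
    1# * z                 ≈⟨ *-identityˡ z ⟩
    z                      ∎

  *≈0⇒ʳ : ∀ {x y} → x ≉ 0# → x * y ≈ 0# → y ≈ 0#
  *≈0⇒ʳ {x} nz eq = *-cancelˡ nz (≈-trans eq (≈-sym (zeroʳ x)))

  *-nonzero : ∀ {x y} → x ≉ 0# → y ≉ 0# → x * y ≉ 0#
  *-nonzero x≉0 y≉0 eq = y≉0 (*≈0⇒ʳ x≉0 eq)

  inv-nonzero : ∀ x nz → inv x nz ≉ 0#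
  inv-nonzero x nz eq = 1≉0 (≈-trans (≈-sym (*-inv x nz)) (≈-trans (*-congˡ eq) (zeroʳ x)))

  -≈0⇒≈ : ∀ {x y} → x - y ≈ 0# → x ≈ y
  -≈0⇒≈ {x} {y} = x∙y⁻¹≈ε⇒x≈y x y

  ≈⇒-≈0 : ∀ {x y} → x ≈ y → x - y ≈ 0#
  ≈⇒-≈0 {x} {y} eq = ≈-trans (+-congʳ eq) (-‿inverseʳ y)

  neg-nonzero : ∀ {x} → x ≉ 0# → - x ≉ 0#
  neg-nonzero {x} nz eq = nz (≈-trans (≈-sym (-‿involutive x)) (≈-trans (-‿cong eq) -0#≈0#))

  units : Group (ℓ₁ ⊔ ℓ₂) ℓ₂
  units = record
    { Carrier = Σ Carrier (_≉ 0#)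
    ; _≈_ = λ x y → proj₁ x ≈ proj₁ y
    ; _∙_ = λ (x , x≉0) (y , y≉0) → x * y , *-nonzero x≉0 y≉0
    ; ε = 1# , 1≉0
    ; _⁻¹ = λ (x , nz) → inv x nz , inv-nonzero x nz
    ; isGroup = record
      { isMonoid = record
        { isSemigroup = record
          { isMagma = record
            { isEquivalence = record { refl = ≈-refl ; sym = ≈-sym ; trans = ≈-trans }
            ; ∙-cong = *-cong }
          ; assoc = λ _ _ _ → *-assoc _ _ _ }
        ; identity = (λ _ → *-identityˡ _) , (λ _ → *-identityʳ _) }
      ; inverse = (λ (x , nz) → inv-* x nz) , (λ (x , nz) → *-inv x nz)
      ; ⁻¹-cong = λ {(x , nx)} {(y , ny)} eq → *-cancelˡ nx (≈-trans (*-inv x nx)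
          (≈-trans (≈-sym (*-inv y ny)) (*-congʳ (≈-sym eq)))) } }

  -- Abstract, so that sums of known length do not unfold during unification.
  abstract
    ∑ : ∀ {k} → (Fin k → Carrier) → Carrier
    ∑ = Sum.sum

    ∑-empty : ∀ {f : Fin 0 → Carrier} → ∑ f ≡ 0#
    ∑-empty = refl

    ∑-suc : ∀ {k} (f : Fin (suc k) → Carrier) → ∑ f ≡ f fz + ∑ (f ∘ fs)
    ∑-suc f = refl

    ∑-cong : ∀ {k} {f g : Fin k → Carrier} → (∀ i → f i ≈ g i) → ∑ f ≈ ∑ g
    ∑-cong = Sum.sum-cong-≋

    ∑-zero : ∀ {k} {f : Fin k → Carrier} → (∀ i → f i ≈ 0#) → ∑ f ≈ 0#
    ∑-zero {k} eq = ≈-trans (∑-cong eq) (Sum.sum-replicate-zero k)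

    ∑-+ : ∀ {k} (f g : Fin k → Carrier) → ∑ (λ i → f i + g i) ≈ ∑ f + ∑ g
    ∑-+ = Sum.∑-distrib-+

    ∑-comm : ∀ {k l} (f : Fin k → Fin l → Carrier) → ∑ (λ i → ∑ (λ j → f i j)) ≈ ∑ (λ j → ∑ (λ i → f i j))
    ∑-comm = Sum.∑-comm

    *-∑ : ∀ {k} x (f : Fin k → Carrier) → x * ∑ f ≈ ∑ (λ i → x * f i)
    *-∑ = Sum.*-distribˡ-sum

    ∑-* : ∀ {k} x (f : Fin k → Carrier) → ∑ f * x ≈ ∑ (λ i → f i * x)
    ∑-* = Sum.*-distribʳ-sum

    ∑-remove : ∀ {k} i (f : Fin (suc k) → Carrier) → ∑ f ≈ f i + ∑ (λ j → f (Fin.punchIn i j))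
    ∑-remove i f = Sum.sum-remove {i = i} f

  ∑-- : ∀ {k} (f g : Fin k → Carrier) → ∑ (λ i → f i - g i) ≈ ∑ f - ∑ g
  ∑-- f g = begin
    ∑ (λ i → f i - g i)                              ≈⟨ +-identityʳ _ ⟨
    ∑ (λ i → f i - g i) + 0#                         ≈⟨ +-congˡ (-‿inverseʳ (∑ g)) ⟨
    ∑ (λ i → f i - g i) + (∑ g - ∑ g)                ≈⟨ +-assoc _ _ _ ⟨
    ∑ (λ i → f i - g i) + ∑ g - ∑ g                  ≈⟨ +-congʳ (∑-+ (λ i → f i - g i) g) ⟨
    ∑ (λ i → f i - g i + g i) - ∑ g                  ≈⟨ +-congʳ (∑-cong (λ i → cancel (f i) (g i))) ⟩
    ∑ f - ∑ g                                        ∎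
    where
    cancel : ∀ x y → x - y + y ≈ x
    cancel x y = ≈-trans (+-assoc _ _ _) (≈-trans (+-congˡ (-‿inverseˡ y)) (+-identityʳ x))

  sumFin≡∑ : ∀ n {k} (f : Fin k → Carrier) → LinAlg.sumFin D n f ≡ ∑ f
  sumFin≡∑ n {zero} f = sym ∑-empty
  sumFin≡∑ n {suc k} f = trans (cong (f fz +_) (sumFin≡∑ n (f ∘ fs))) (sym (∑-suc f))

  -- Gaussian elimination. The unknowns stand on the left, so right multiples of one equation may be
  -- subtracted from the others; the pivot unknown `i₀` is then recovered from the first equation.
  underdetermined : ∀ r {N} (A : Fin N → Fin r → Carrier) → r < N →
                    ∃ λ (c : Fin N → Carrier) → (∀ j → ∑ (λ i → c i * A i j) ≈ 0#) × ∃ λ i → c i ≉ 0#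
  underdetermined zero {suc N} A _ = (λ _ → 1#) , (λ ()) , fz , 1≉0
  underdetermined (suc r) {suc N} A (s≤s r<N) with lem {P = ∃ λ i → A i fz ≉ 0#}
  ... | no none with underdetermined r (λ i j → A i (fs j)) (ℕₚ.m≤n⇒m≤1+n r<N)
  ...   | c , eqs , nz = c , (λ where
              fz → ∑-zero (λ i → ≈-trans (*-congˡ (¬≉⇒≈ (λ p → none (i , p)))) (zeroʳ (c i)))
              (fs j) → eqs j) , nz
  underdetermined (suc r) {suc N} A (s≤s r<N) | yes (i₀ , pivot)
    with underdetermined r B r<N
    where
    B : Fin N → Fin r → Carrier
    B i j = A (Fin.punchIn i₀ i) (fs j) - A (Fin.punchIn i₀ i) fz * (inv (A i₀ fz) pivot * A i₀ (fs j))
  ... | c′ , eqs , (i , nz) = c , solves , Fin.punchIn i₀ i , λ eq → nz (≈-trans (reflexive (sym (VecFₚ.insertAt-punchIn c′ i₀ v i))) eq)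
    where
    p S v : Carrier
    p = inv (A i₀ fz) pivot
    S = ∑ (λ i → c′ i * A (Fin.punchIn i₀ i) fz)
    v = - (S * p)
    c : Fin (suc N) → Carrier
    c = insertAt c′ i₀ v
    rest : ∀ j → ∑ (λ i → c′ i * A (Fin.punchIn i₀ i) j) ≈ S * (p * A i₀ j)
    rest fz = ≈-sym (≈-trans (*-congˡ (inv-* _ pivot)) (*-identityʳ S))
    rest (fs j) = -≈0⇒≈ (begin
      ∑ (λ i → c′ i * A (Fin.punchIn i₀ i) (fs j)) - S * (p * A i₀ (fs j))
        ≈⟨ +-congˡ (-‿cong (∑-* _ _)) ⟩
      ∑ (λ i → c′ i * A (Fin.punchIn i₀ i) (fs j)) - ∑ (λ i → c′ i * A (Fin.punchIn i₀ i) fz * (p * A i₀ (fs j)))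
        ≈⟨ ∑-- _ _ ⟨
      ∑ (λ i → c′ i * A (Fin.punchIn i₀ i) (fs j) - c′ i * A (Fin.punchIn i₀ i) fz * (p * A i₀ (fs j)))
        ≈⟨ ∑-cong (λ i → ≈-trans (+-congˡ (-‿cong (*-assoc _ _ _))) (≈-sym (x[y-z]≈xy-xz (c′ i) _ _))) ⟩
      ∑ (λ i → c′ i * (A (Fin.punchIn i₀ i) (fs j) - A (Fin.punchIn i₀ i) fz * (p * A i₀ (fs j))))
        ≈⟨ eqs j ⟩
      0# ∎)
    solves : ∀ j → ∑ (λ i → c i * A i j) ≈ 0#
    solves j = begin
      ∑ (λ i → c i * A i j)
        ≈⟨ ∑-remove i₀ (λ i → c i * A i j) ⟩
      c i₀ * A i₀ j + ∑ (λ i → c (Fin.punchIn i₀ i) * A (Fin.punchIn i₀ i) j)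
        ≈⟨ +-cong (*-congʳ (reflexive (VecFₚ.insertAt-lookup c′ i₀ v)))
                  (∑-cong (λ i → *-congʳ (reflexive (VecFₚ.insertAt-punchIn c′ i₀ v i)))) ⟩
      v * A i₀ j + ∑ (λ i → c′ i * A (Fin.punchIn i₀ i) j)
        ≈⟨ +-cong (≈-trans (≈-sym (-‿distribˡ-* (S * p) (A i₀ j))) (-‿cong (*-assoc _ _ _))) (rest j) ⟩
      - (S * (p * A i₀ j)) + S * (p * A i₀ j)
        ≈⟨ -‿inverseˡ _ ⟩
      0# ∎

  -- Menelaus' theorem in vertex coordinates

  prodTo : (ℕ → Carrier) → ℕ → Carrier
  prodTo a zero = 1#
  prodTo a (suc k) = prodTo a k * a k

  sumTo : ℕ → (ℕ → Carrier) → Carrier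
  sumTo k f = ∑ {k} (f ∘ toℕ)

  sumTo-shift : ∀ k f → f 0 + sumTo k (f ∘ suc) ≈ sumTo k f + f k
  sumTo-shift zero f = ≈-trans (+-congˡ (reflexive ∑-empty)) (≈-trans (+-comm _ _) (+-congʳ (reflexive (sym ∑-empty))))
  sumTo-shift (suc k) f = begin
    f 0 + ∑ (f ∘ suc ∘ toℕ)                     ≈⟨ +-congˡ (reflexive (∑-suc (f ∘ suc ∘ toℕ))) ⟩
    f 0 + (f 1 + sumTo k (f ∘ suc ∘ suc))       ≈⟨ +-congˡ (sumTo-shift k (f ∘ suc)) ⟩
    f 0 + (sumTo k (f ∘ suc) + f (suc k))       ≈⟨ +-assoc _ _ _ ⟨
    f 0 + sumTo k (f ∘ suc) + f (suc k)         ≈⟨ +-congʳ (reflexive (sym (∑-suc (f ∘ toℕ)))) ⟩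
    sumTo (suc k) f + f (suc k)                 ∎

  -- Menelaus: the points u i - a i u (i+1) on the sides of a k-gon with
  -- independent vertices are dependent iff the product of the ratios is 1.
  module Menelaus {J : Set} (k′ : ℕ) (u e : ℕ → J → Carrier) (p a : ℕ → Carrier) (p≉0 : ∀ i → p i ≉ 0#)
                  (e≈ : ∀ i j → e i j ≈ p i * (u i j - a i * u (suc i) j))
                  (u-closes : ∀ j → u (suc k′) j ≈ u 0 j)
                  (indep : ∀ (c : ℕ → Carrier) → (∀ j → sumTo (suc k′) (λ i → c i * u i j) ≈ 0#) →
                           ∀ i → i < suc k′ → c i ≈ 0#) where

    private
      k = suc k′

      -- What vertex `i` receives from the side before it. Vertex 0 receives from the last side
      -- `k′`, because `u (suc k′)` is `u 0` again.
      shifted : (ℕ → Carrier) → ℕ → Carrier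
      shifted g zero = g k′ * a k′
      shifted g (suc i) = g i * a i

      regroup : ∀ g j → sumTo k (λ i → g i * (u i j - a i * u (suc i) j)) ≈ sumTo k (λ i → (g i - shifted g i) * u i j)
      regroup g j = begin
        sumTo k (λ i → g i * (u i j - a i * u (suc i) j))
          ≈⟨ ∑-cong (λ i → ≈-trans (x[y-z]≈xy-xz _ _ _) (+-congˡ (-‿cong (≈-sym (*-assoc _ _ _))))) ⟩
        sumTo k (λ i → g i * u i j - Y (suc i))
          ≈⟨ ∑-- _ _ ⟩
        sumTo k (λ i → g i * u i j) - sumTo k (Y ∘ suc)
          ≈⟨ +-congˡ (-‿cong Y-shift) ⟩
        sumTo k (λ i → g i * u i j) - sumTo k Y
          ≈⟨ ∑-- _ _ ⟨
        sumTo k (λ i → g i * u i j - Y i)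
          ≈⟨ ∑-cong (λ i → ≈-sym ([y-z]x≈yx-zx _ _ _)) ⟩
        sumTo k (λ i → (g i - shifted g i) * u i j) ∎
        where
        Y : ℕ → Carrier
        Y i = shifted g i * u i j
        Y-shift : sumTo k (Y ∘ suc) ≈ sumTo k Y
        Y-shift = +-cancelˡ (Y 0) _ _ (≈-trans (sumTo-shift k Y) (≈-trans (+-congˡ (*-congˡ (u-closes j))) (+-comm _ _)))

      dependence : ∀ (c : ℕ → Carrier) j → sumTo k (λ i → c i * e i j) ≈ sumTo k (λ i → (c i * p i - shifted (λ i → c i * p i) i) * u i j)
      dependence c j = ≈-trans (∑-cong (λ i → ≈-trans (*-congˡ (e≈ (toℕ i) j)) (≈-sym (*-assoc _ _ _))))
                               (regroup (λ i → c i * p i) j)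

    -- Independence of the vertices forces `g i ≈ g (i - 1) * a (i - 1)` all around the polygon.
    -- Hence `g` consists of multiples of `g 0`, which cannot vanish, and a full turn multiplies
    -- `g 0` by the product.
    dependent⇒prod : ∀ (c : ℕ → Carrier) → (∀ j → sumTo k (λ i → c i * e i j) ≈ 0#) →
                     ∀ {i} → i < k → c i ≉ 0# → prodTo a k ≈ 1#
    dependent⇒prod c dep {i} i<k ci≉0 = *-cancelˡ g0≉0 (begin
      g 0 * (prodTo a k′ * a k′)       ≈⟨ *-assoc _ _ _ ⟨
      g 0 * prodTo a k′ * a k′         ≈⟨ *-congʳ (g≈ k′ ℕₚ.≤-refl) ⟨
      g k′ * a k′                      ≈⟨ g≈shifted 0 (s≤s z≤n) ⟨
      g 0                              ≈⟨ *-identityʳ _ ⟨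
      g 0 * 1#                         ∎)
      where
      g : ℕ → Carrier
      g i = c i * p i
      g≈shifted : ∀ i → i < k → g i ≈ shifted g i
      g≈shifted i i<k = -≈0⇒≈ (indep (λ i → g i - shifted g i) (λ j → ≈-trans (≈-sym (dependence c j)) (dep j)) i i<k)
      g≈ : ∀ i → i ≤ k′ → g i ≈ g 0 * prodTo a i
      g≈ zero _ = ≈-sym (*-identityʳ _)
      g≈ (suc i) i<k′ = begin
        g (suc i)                 ≈⟨ g≈shifted (suc i) (s≤s i<k′) ⟩
        g i * a i                 ≈⟨ *-congʳ (g≈ i (ℕₚ.<⇒≤ i<k′)) ⟩
        g 0 * prodTo a i * a i    ≈⟨ *-assoc _ _ _ ⟩
        g 0 * prodTo a (suc i)    ∎
      g0≉0 : g 0 ≉ 0#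
      g0≉0 g0≈0 = *-nonzero ci≉0 (p≉0 i) (≈-trans (g≈ i (ℕₚ.≤-pred i<k)) (≈-trans (*-congʳ g0≈0) (zeroˡ _)))

    prod⇒dependent : prodTo a k ≈ 1# → ∃ λ (c : ℕ → Carrier) → (∀ j → sumTo k (λ i → c i * e i j) ≈ 0#) × c 0 ≉ 0#
    prod⇒dependent prod≈1 = c , (λ j → ≈-trans (dependence c j) (∑-zero (λ i →
        ≈-trans (*-congʳ (≈⇒-≈0 (balanced (toℕ i)))) (zeroˡ _)))) , *-nonzero 1≉0 (inv-nonzero _ _)
      where
      c : ℕ → Carrier
      -- The partial products solve the recursion between consecutive sides; that the full product
      -- is 1 closes it up at vertex 0. Dividing by `p i` undoes the normalization of the edge
      -- points.
      c i = prodTo a i * inv (p i) (p≉0 i)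
      cp : ∀ i → c i * p i ≈ prodTo a i
      cp i = ≈-trans (*-assoc _ _ _) (≈-trans (*-congˡ (inv-* _ _)) (*-identityʳ _))
      balanced : ∀ i → c i * p i ≈ shifted (λ i → c i * p i) i
      balanced zero = ≈-trans (cp 0) (≈-sym (≈-trans (*-congʳ (cp k′)) prod≈1))
      balanced (suc i) = ≈-trans (cp (suc i)) (*-congʳ (≈-sym (cp i)))

-- Centralizers, bases and dimensions over division rings

opposite : ∀ {ℓ₁ ℓ₂} → DivisionRing ℓ₁ ℓ₂ → DivisionRing ℓ₁ ℓ₂
opposite D = record
  { ring = Op.ring (DivisionRing.ring D)
  ; 0≉1 = DivisionRing.0≉1 D
  ; inverse = λ x nz → let y , xy , yx = DivisionRing.inverse D x nz in y , yx , xy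
  }

module OppositeSums (lem : EM) {ℓ₁ ℓ₂} (D : DivisionRing ℓ₁ ℓ₂) where
  open DivisionRing D using (Carrier; _+_)
  open DivisionRings lem D
  module O = DivisionRings lem (opposite D)

  ∑ᵒ≡∑ : ∀ {k} (f : Fin k → Carrier) → O.∑ f ≡ ∑ f
  ∑ᵒ≡∑ {zero} f = trans O.∑-empty (sym ∑-empty)
  ∑ᵒ≡∑ {suc k} f = trans (O.∑-suc f) (trans (cong (f fz +_) (∑ᵒ≡∑ (f ∘ fs))) (sym (∑-suc f)))

module Subfields (lem : EM) {ℓ₁ ℓ₂} (D : DivisionRing ℓ₁ ℓ₂) where
  open DivisionRing D renaming (refl to ≈-refl; sym to ≈-sym; trans to ≈-trans; setoid to ≈-setoid)
  open DivisionRings lem D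
  open import Algebra.Properties.Ring ring
  open import Relation.Binary.Reasoning.Setoid ≈-setoid

  Cent : ∀ {p} → (Carrier → Set p) → Carrier → Set (ℓ₁ ⊔ ℓ₂ ⊔ p)
  Cent A x = ∀ l → A l → x * l ≈ l * x

  -- Sub-division-rings: the notion has to cover centralizers, whose commutativity is a separate
  -- matter.
  record IsSubfield {p} (F : Carrier → Set p) : Set (ℓ₁ ⊔ ℓ₂ ⊔ p) where
    field
      0-closed  : F 0#
      1-closed  : F 1#
      +-closed  : ∀ {x y} → F x → F y → F (x + y)
      *-closed  : ∀ {x y} → F x → F y → F (x * y)
      neg-closed : ∀ {x} → F x → F (- x)
      inv-closed : ∀ {x} nz → F x → F (inv x nz)

  Cent-isSubfield : ∀ {p} (A : Carrier → Set p) → IsSubfield (Cent A)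
  Cent-isSubfield A = record
    { 0-closed = λ l _ → ≈-trans (zeroˡ l) (≈-sym (zeroʳ l))
    ; 1-closed = λ l _ → ≈-trans (*-identityˡ l) (≈-sym (*-identityʳ l))
    ; +-closed = λ cx cy l al → ≈-trans (distribʳ _ _ _) (≈-trans (+-cong (cx l al) (cy l al)) (≈-sym (distribˡ _ _ _)))
    ; *-closed = λ {x} {y} cx cy l al → begin
        x * y * l      ≈⟨ *-assoc _ _ _ ⟩
        x * (y * l)    ≈⟨ *-congˡ (cy l al) ⟩
        x * (l * y)    ≈⟨ *-assoc _ _ _ ⟨
        x * l * y      ≈⟨ *-congʳ (cx l al) ⟩
        l * x * y      ≈⟨ *-assoc _ _ _ ⟩
        l * (x * y)    ∎
    ; neg-closed = λ cx l al → ≈-trans (≈-sym (-‿distribˡ-* _ _)) (≈-trans (-‿cong (cx l al)) (-‿distribʳ-* _ _))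
    ; inv-closed = λ {x} nz cx l al → *-cancelˡ nz (begin
        x * (inv x nz * l)      ≈⟨ *-assoc _ _ _ ⟨
        x * inv x nz * l        ≈⟨ *-congʳ (*-inv x nz) ⟩
        1# * l                  ≈⟨ *-identityˡ l ⟩
        l                       ≈⟨ *-identityʳ l ⟨
        l * 1#                  ≈⟨ *-congˡ (*-inv x nz) ⟨
        l * (x * inv x nz)      ≈⟨ *-assoc _ _ _ ⟨
        l * x * inv x nz        ≈⟨ *-congʳ (cx l al) ⟨
        x * l * inv x nz        ≈⟨ *-assoc _ _ _ ⟩
        x * (l * inv x nz)      ∎)
    }

  Indep : ∀ {p r} (F : Carrier → Set p) → (Fin r → Carrier) → Set (ℓ₁ ⊔ ℓ₂ ⊔ p)
  Indep {r = r} F β = ∀ (c : Fin r → Carrier) → (∀ i → F (c i)) → ∑ (λ i → c i * β i) ≈ 0# → ∀ i → c i ≈ 0#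

  Span : ∀ {p r} (F : Carrier → Set p) → (Fin r → Carrier) → Carrier → Set (ℓ₁ ⊔ ℓ₂ ⊔ p)
  Span {r = r} F β x = ∃ λ (c : Fin r → Carrier) → (∀ i → F (c i)) × ∑ (λ i → c i * β i) ≈ x

  cons : ∀ {a r} {X : Set a} → X → (Fin r → X) → Fin (suc r) → X
  cons x f fz = x
  cons x f (fs i) = f i

  ∑-cons : ∀ {r} x (c β : Fin r → Carrier) y → ∑ (λ i → cons x c i * cons y β i) ≈ x * y + ∑ (λ i → c i * β i)
  ∑-cons x c β y = reflexive (∑-suc (λ i → cons x c i * cons y β i))

  cons-closed : ∀ {p r} {F : Carrier → Set p} {x} {c : Fin r → Carrier} → F x → (∀ i → F (c i)) → ∀ i → F (cons x c i)
  cons-closed fx fc fz = fx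
  cons-closed fx fc (fs i) = fc i

  Indep-tail : ∀ {p r} {F : Carrier → Set p} {β : Fin (suc r) → Carrier} → IsSubfield F → Indep F β → Indep F (β ∘ fs)
  Indep-tail {F = F} {β} sub ind c fc eq i = ind (cons 0# c) (cons-closed {F = F} 0-closed fc) (begin
    ∑ (λ i → cons 0# c i * β i)                 ≡⟨ ∑-suc (λ i → cons 0# c i * β i) ⟩
    0# * β fz + ∑ (λ i → c i * β (fs i))        ≈⟨ +-cong (zeroˡ _) eq ⟩
    0# + 0#                                     ≈⟨ +-identityˡ _ ⟩
    0#                                          ∎) (fs i)
    where open IsSubfield sub

  -- Artin's argument: commuting a relation with l ∈ A kills its leading coefficient.
  kernel : ∀ {p} (A : Carrier → Set p) → A 1# → (∀ {x y} → A x → A y → A (x * y)) →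
           ∀ r (β : Fin r → Carrier) → Indep (Cent A) β →
           ∀ (y : Fin r → Carrier) → (∀ k → A k → ∑ (λ i → y i * (k * β i)) ≈ 0#) → ∀ i → y i ≈ 0#
  kernel A 1∈ *∈ zero β ind y ker ()
  kernel {p} A 1∈ *∈ (suc r) β ind y ker with y fz ≈? 0#
  ... | yes y0≈0 = λ where
        fz → y0≈0
        (fs i) → kernel A 1∈ *∈ r (β ∘ fs) (Indep-tail (Cent-isSubfield A) ind) (y ∘ fs) (λ k ak → begin
          ∑ (λ i → y (fs i) * (k * β (fs i)))                              ≈⟨ +-identityˡ _ ⟨
          0# + ∑ (λ i → y (fs i) * (k * β (fs i)))                         ≈⟨ +-congʳ (≈-trans (*-congʳ y0≈0) (zeroˡ _)) ⟨
          y fz * (k * β fz) + ∑ (λ i → y (fs i) * (k * β (fs i)))          ≡⟨ ∑-suc (λ i → y i * (k * β i)) ⟨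
          ∑ (λ i → y i * (k * β i))                                        ≈⟨ ker k ak ⟩
          0#                                                               ∎) i
  -- After normalizing the leading coefficient to 1, the commuted relations show that all
  -- coefficients lie in the centralizer. The relation for `k = 1` then contradicts the independence
  -- of `β`.
  ... | no y0≉0 = ⊥-elim (1≉0 (≈-trans (≈-sym y′0) (ind y′ y′-cent y′-rel fz)))
    where
    y′ : Fin (suc r) → Carrier
    y′ i = inv (y fz) y0≉0 * y i
    y′0 : y′ fz ≈ 1#
    y′0 = inv-* _ _
    ker′ : ∀ k → A k → ∑ (λ i → y′ i * (k * β i)) ≈ 0#
    ker′ k ak = begin
      ∑ (λ i → y′ i * (k * β i))                              ≈⟨ ∑-cong (λ i → *-assoc _ _ _) ⟩
      ∑ (λ i → inv (y fz) y0≉0 * (y i * (k * β i)))           ≈⟨ *-∑ _ _ ⟨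
      inv (y fz) y0≉0 * ∑ (λ i → y i * (k * β i))             ≈⟨ *-congˡ (ker k ak) ⟩
      inv (y fz) y0≉0 * 0#                                    ≈⟨ zeroʳ _ ⟩
      0#                                                      ∎
    commuted : ∀ l → A l → ∀ k → A k → ∑ (λ i → (y′ i * l - l * y′ i) * (k * β i)) ≈ 0#
    commuted l al k ak = begin
      ∑ (λ i → (y′ i * l - l * y′ i) * (k * β i))
        ≈⟨ ∑-cong (λ i → ≈-trans ([y-z]x≈yx-zx _ _ _) (+-cong (≈-trans (*-assoc _ _ _) (*-congˡ (≈-sym (*-assoc _ _ _)))) (-‿cong (*-assoc _ _ _)))) ⟩
      ∑ (λ i → y′ i * (l * k * β i) - l * (y′ i * (k * β i)))
        ≈⟨ ∑-- _ _ ⟩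
      ∑ (λ i → y′ i * (l * k * β i)) - ∑ (λ i → l * (y′ i * (k * β i)))
        ≈⟨ +-cong (ker′ (l * k) (*∈ al ak)) (-‿cong (≈-trans (≈-sym (*-∑ _ _)) (≈-trans (*-congˡ (ker′ k ak)) (zeroʳ l)))) ⟩
      0# - 0#
        ≈⟨ -‿inverseʳ 0# ⟩
      0# ∎
    head≈0 : ∀ l → y′ fz * l - l * y′ fz ≈ 0#
    head≈0 l = ≈⇒-≈0 (≈-trans (*-congʳ y′0) (≈-trans (*-identityˡ l) (≈-sym (≈-trans (*-congˡ y′0) (*-identityʳ l)))))
    y′-cent : ∀ i → Cent A (y′ i)
    y′-cent fz l al = -≈0⇒≈ (head≈0 l)
    y′-cent (fs i) l al = -≈0⇒≈ (kernel A 1∈ *∈ r (β ∘ fs) (Indep-tail (Cent-isSubfield A) ind)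
      (λ i → y′ (fs i) * l - l * y′ (fs i)) (λ k ak → begin
        ∑ (λ i → (y′ (fs i) * l - l * y′ (fs i)) * (k * β (fs i)))
          ≈⟨ +-identityˡ _ ⟨
        0# + ∑ (λ i → (y′ (fs i) * l - l * y′ (fs i)) * (k * β (fs i)))
          ≈⟨ +-congʳ (≈-trans (*-congʳ (head≈0 l)) (zeroˡ _)) ⟨
        (y′ fz * l - l * y′ fz) * (k * β fz) + ∑ (λ i → (y′ (fs i) * l - l * y′ (fs i)) * (k * β (fs i)))
          ≡⟨ ∑-suc (λ i → (y′ i * l - l * y′ i) * (k * β i)) ⟨
        ∑ (λ i → (y′ i * l - l * y′ i) * (k * β i))
          ≈⟨ commuted l al k ak ⟩
        0# ∎) i)
    y′-rel : ∑ (λ i → y′ i * β i) ≈ 0#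
    y′-rel = ≈-trans (∑-cong (λ i → *-congˡ (≈-sym (*-identityˡ _)))) (ker′ 1# 1∈)

  record Basis {p q} (F : Carrier → Set p) (S : Carrier → Set q) (L : List Carrier) : Set (ℓ₁ ⊔ ℓ₂ ⊔ p ⊔ q) where
    field
      dim    : ℕ
      vec    : Fin dim → Carrier
      vec∈   : ∀ i → S (vec i)
      indep  : Indep F vec
      spans  : ∀ {x} → x ∈ L → S x → Span F vec x

  -- Greedy choice along `L`: an element of `S` is added when it lies outside the span so far. If
  -- `L` lists the whole ring, the result is a basis of `S` in the usual sense.
  basis : ∀ {p q} {F : Carrier → Set p} {S : Carrier → Set q} → IsSubfield F → ∀ L → Basis F S L
  basis sub [] = record { dim = 0 ; vec = λ () ; vec∈ = λ () ; indep = λ _ _ _ () ; spans = λ () }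
  basis {F = F} {S} sub (x ∷ L) with basis {S = S} sub L
  ... | B with lem {P = S x × ¬ Span F (Basis.vec B) x}
  ...   | no skip = record { Basis B ; spans = λ where
            (here refl) sx → span-x sx
            (there y∈) sy → Basis.spans B y∈ sy }
    where
    span-x : S x → Span F (Basis.vec B) x
    span-x sx with lem {P = Span F (Basis.vec B) x}
    ... | yes sp = sp
    ... | no ¬sp = ⊥-elim (skip (sx , ¬sp))
  ...   | yes (sx , ¬span) = record
            { dim = suc dim ; vec = cons x vec ; vec∈ = cons-closed {F = S} sx vec∈ ; indep = indep′ ; spans = spans′ }
    where
    open Basis B
    open IsSubfield sub
    indep′ : Indep F (cons x vec)
    indep′ c fc eq with c fz ≈? 0#
    ... | yes c0≈0 = λ where
          fz → c0≈0
          (fs i) → indep (c ∘ fs) (fc ∘ fs) (begin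
            ∑ (λ i → c (fs i) * vec i)                     ≈⟨ +-identityˡ _ ⟨
            0# + ∑ (λ i → c (fs i) * vec i)                ≈⟨ +-congʳ (≈-trans (*-congʳ c0≈0) (zeroˡ x)) ⟨
            c fz * x + ∑ (λ i → c (fs i) * vec i)          ≡⟨ ∑-suc (λ i → c i * cons x vec i) ⟨
            ∑ (λ i → c i * cons x vec i)                   ≈⟨ eq ⟩
            0#                                             ∎) i
    ... | no c0≉0 = ⊥-elim (¬span ((λ i → - p * c (fs i)) , (λ i → *-closed (neg-closed (inv-closed c0≉0 (fc fz))) (fc (fs i))) , (begin
            ∑ (λ i → - p * c (fs i) * vec i)               ≈⟨ ∑-cong (λ i → *-assoc _ _ _) ⟩
            ∑ (λ i → - p * (c (fs i) * vec i))             ≈⟨ *-∑ _ _ ⟨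
            - p * ∑ (λ i → c (fs i) * vec i)               ≈⟨ *-congˡ (+-inverseʳ-unique (c fz * x) _ (≈-trans (reflexive (sym (∑-suc (λ i → c i * cons x vec i)))) eq)) ⟩
            - p * - (c fz * x)                             ≈⟨ -‿distribˡ-* _ _ ⟨
            - (p * - (c fz * x))                           ≈⟨ -‿cong (-‿distribʳ-* _ _) ⟨
            - - (p * (c fz * x))                           ≈⟨ -‿involutive _ ⟩
            p * (c fz * x)                                 ≈⟨ *-assoc _ _ _ ⟨
            p * c fz * x                                   ≈⟨ *-congʳ (inv-* _ _) ⟩
            1# * x                                         ≈⟨ *-identityˡ x ⟩
            x                                              ∎)))
      where p = inv (c fz) c0≉0
    spans′ : ∀ {y} → y ∈ x ∷ L → S y → Span F (cons x vec) y
    spans′ (here refl) _ = cons 1# (λ _ → 0#) , cons-closed {F = F} 1-closed (λ _ → 0-closed) ,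
      ≈-trans (∑-cons _ _ _ _) (≈-trans (+-cong (*-identityˡ x) (∑-zero (λ i → zeroˡ _))) (+-identityʳ x))
    spans′ (there y∈) sy with spans y∈ sy
    ... | c , fc , eq = cons 0# c , cons-closed {F = F} 0-closed fc ,
      ≈-trans (∑-cons _ _ _ _) (≈-trans (+-cong (zeroˡ x) eq) (+-identityˡ _))

module MaximalSubfield (lem : EM) {ℓ₁ ℓ₂} (D : DivisionRing ℓ₁ ℓ₂) where
  open DivisionRing D renaming (refl to ≈-refl; sym to ≈-sym; trans to ≈-trans; setoid to ≈-setoid)
  open DivisionRings lem D
  open Subfields lem D
  open import Algebra.Properties.Ring ring
  open import Relation.Binary.Reasoning.Setoid ≈-setoid
  open OppositeSums lem D
  private
    module OS = Subfields lem (opposite D)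

  Whole : Carrier → Set
  Whole _ = ⊤

  Center : Carrier → Set (ℓ₁ ⊔ ℓ₂)
  Center = Cent Whole

  -- For a self-centralizing commutative K, a basis β of D over K and a basis b of
  -- K over the centre, the matrix b j * β i has trivial left and right kernels.
  dim-square : ∀ {p} {K : Carrier → Set p} → IsSubfield K → (∀ {x y} → K x → K y → x * y ≈ y * x) →
               (∀ {x} → Cent K x → K x) →
               ∀ {r d} (β : Fin r → Carrier) (b : Fin d → Carrier) → (∀ j → K (b j)) →
               Indep K β → (∀ x → Span K β x) → Indep Center b → (∀ {x} → K x → Span Center b x) → r ≡ d
  dim-square {K = K} subK comm self {r} {d} β b b∈ indβ spanβ indb spanb = ℕₚ.≤-antisym r≤d d≤r
    where
    open IsSubfield subK
    r≤d : r ≤ d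
    r≤d = ℕₚ.≮⇒≥ λ d<r → bad (underdetermined d (λ i j → b j * β i) d<r)
      where
      bad : ¬ (∃ λ (y : Fin r → Carrier) → (∀ j → ∑ (λ i → y i * (b j * β i)) ≈ 0#) × ∃ λ i → y i ≉ 0#)
      -- The equations at the `b j` extend to all of `K` by linearity over the centre. Since `K`
      -- contains its centralizer, `β` is independent over the latter and the kernel is trivial.
      bad (y , eqs , i , nz) = nz (kernel K 1-closed *-closed r β
        (λ c fc → indβ c (self ∘ fc)) y all i)
        where
        all : ∀ k → K k → ∑ (λ i → y i * (k * β i)) ≈ 0#
        all k kk with spanb kk
        ... | z , zc , z≈k = begin
          ∑ (λ i → y i * (k * β i))
            ≈⟨ ∑-cong (λ i → *-congˡ (*-congʳ z≈k)) ⟨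
          ∑ (λ i → y i * (∑ (λ j → z j * b j) * β i))
            ≈⟨ ∑-cong (λ i → ≈-trans (*-congˡ (∑-* _ _)) (*-∑ _ _)) ⟩
          ∑ (λ i → ∑ (λ j → y i * (z j * b j * β i)))
            ≈⟨ ∑-comm (λ i j → y i * (z j * b j * β i)) ⟩
          ∑ (λ j → ∑ (λ i → y i * (z j * b j * β i)))
            ≈⟨ ∑-cong (λ j → ∑-cong (λ i → pull i j)) ⟩
          ∑ (λ j → ∑ (λ i → z j * (y i * (b j * β i))))
            ≈⟨ ∑-cong (λ j → ≈-trans (≈-sym (*-∑ _ _)) (≈-trans (*-congˡ (eqs j)) (zeroʳ _))) ⟩
          ∑ (λ (j : Fin d) → 0#)
            ≈⟨ ∑-zero {d} (λ _ → ≈-refl) ⟩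
          0# ∎
          where
          pull : ∀ i j → y i * (z j * b j * β i) ≈ z j * (y i * (b j * β i))
          pull i j = begin
            y i * (z j * b j * β i)        ≈⟨ *-congˡ (*-assoc _ _ _) ⟩
            y i * (z j * (b j * β i))      ≈⟨ *-assoc _ _ _ ⟨
            y i * z j * (b j * β i)        ≈⟨ *-congʳ (zc j (y i) _) ⟨
            z j * y i * (b j * β i)        ≈⟨ *-assoc _ _ _ ⟩
            z j * (y i * (b j * β i))      ∎
    d≤r : d ≤ r
    -- Here the unknowns stand on the right. In the opposite ring they become left coefficients, and
    -- the kernel lemma applies with the whole ring, whose centralizer is the centre.
    d≤r = ℕₚ.≮⇒≥ λ r<d → bad (O.underdetermined r (λ j i → b j * β i) r<d)
      where
      bad : ¬ (∃ λ (y : Fin d → Carrier) → (∀ i → O.∑ (λ j → b j * β i * y j) ≈ 0#) × ∃ λ j → y j ≉ 0#)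
      bad (y , eqs , j , nz) = nz (OS.kernel Whole _ _ d b indᵒ y all j)
        where
        indᵒ : OS.Indep (OS.Cent Whole) b
        indᵒ c fc eq = indb c (λ i l w → ≈-sym (fc i l w)) (≈-trans (∑-cong (λ i → ≈-sym (fc i (b i) _)))
          (≈-trans (reflexive (sym (∑ᵒ≡∑ (λ i → b i * c i)))) eq))
        all : ∀ x → Whole x → O.∑ (λ j → (b j * x) * y j) ≈ 0#
        all x _ with spanβ x
        ... | k , kk , k≈x = begin
          O.∑ (λ j → b j * x * y j)
            ≡⟨ ∑ᵒ≡∑ (λ j → b j * x * y j) ⟩
          ∑ (λ j → b j * x * y j)
            ≈⟨ ∑-cong (λ j → *-congʳ (*-congˡ k≈x)) ⟨
          ∑ (λ j → b j * ∑ (λ i → k i * β i) * y j)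
            ≈⟨ ∑-cong (λ j → ≈-trans (*-congʳ (*-∑ _ _)) (∑-* _ _)) ⟩
          ∑ (λ j → ∑ (λ i → b j * (k i * β i) * y j))
            ≈⟨ ∑-comm (λ j i → b j * (k i * β i) * y j) ⟩
          ∑ (λ i → ∑ (λ j → b j * (k i * β i) * y j))
            ≈⟨ ∑-cong (λ i → ∑-cong (λ j → pull i j)) ⟩
          ∑ (λ i → ∑ (λ j → k i * (b j * β i * y j)))
            ≈⟨ ∑-cong (λ i → ≈-trans (≈-sym (*-∑ _ _)) (≈-trans (*-congˡ (≈-trans (reflexive (sym (∑ᵒ≡∑ (λ j → b j * β i * y j)))) (eqs i))) (zeroʳ _))) ⟩
          ∑ (λ (i : Fin r) → 0#)
            ≈⟨ ∑-zero {r} (λ _ → ≈-refl) ⟩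
          0# ∎
          where
          pull : ∀ i j → b j * (k i * β i) * y j ≈ k i * (b j * β i * y j)
          pull i j = begin
            b j * (k i * β i) * y j        ≈⟨ *-congʳ (*-assoc _ _ _) ⟨
            b j * k i * β i * y j          ≈⟨ *-congʳ (*-congʳ (comm (b∈ j) (kk i))) ⟩
            k i * b j * β i * y j          ≈⟨ *-congʳ (*-assoc _ _ _) ⟩
            k i * (b j * β i) * y j        ≈⟨ *-assoc _ _ _ ⟩
            k i * (b j * β i * y j)        ∎

-- Wedderburn's little theorem

lookup-inj : ∀ {a} {A : Set a} {xs : List A} → Unique xs → ∀ {i j} → lookup xs i ≡ lookup xs j → i ≡ j
lookup-inj (x≢ ∷ u) {fz} {fz} eq = refl
lookup-inj (x≢ ∷ u) {fz} {fs j} eq = ⊥-elim (All.lookup x≢ (∈-lookup j) eq)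
lookup-inj (x≢ ∷ u) {fs i} {fz} eq = ⊥-elim (All.lookup x≢ (∈-lookup i) (sym eq))
lookup-inj (x≢ ∷ u) {fs i} {fs j} eq = cong fs (lookup-inj u eq)

-- Fixing the carrier to `Fin N` with propositional equality lets induction on the size range over
-- one type of structures and makes cardinalities lengths of lists.
record FinDiv (N : ℕ) : Set where
  infixl 6 _+_
  infixl 7 _*_
  infix 8 -_
  field
    _+_ _*_ : Fin N → Fin N → Fin N
    -_      : Fin N → Fin N
    0# 1#   : Fin N
    isRing  : Algebra.Structures.IsRing _≡_ _+_ _*_ -_ 0# 1#
    0≢1     : 0# ≢ 1#
    inverse : ∀ x → x ≢ 0# → Σ (Fin N) (λ y → (x * y ≡ 1#) × (y * x ≡ 1#))

  divisionRing : DivisionRing 0ℓ 0ℓ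
  divisionRing = record { ring = record { isRing = isRing } ; 0≉1 = 0≢1 ; inverse = inverse }

-- Reindexes a finite sub-division-ring by `Fin N`. This serves for the centralizers in the
-- induction and for a ring all of whose elements occur in a list.
module FiniteSubfield (lem : EM) {ℓ₁ ℓ₂} (D : DivisionRing ℓ₁ ℓ₂) where
  open DivisionRing D renaming (refl to ≈-refl; sym to ≈-sym; trans to ≈-trans; setoid to ≈-setoid)
  open DivisionRings lem D
  open Subfields lem D

  module _ {N} (e : Fin N → Carrier) (e-inj : ∀ {i j} → e i ≈ e j → i ≡ j)
           (sub : IsSubfield (λ x → ∃ λ i → e i ≈ x)) where
    open IsSubfield sub

    private
      image : Fin N → ∃ λ i → e i ≈ e i
      image i = i , ≈-refl
      plus times : Fin N → Fin N → Fin N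
      plus i j = proj₁ (+-closed (i , ≈-refl) (j , ≈-refl))
      times i j = proj₁ (*-closed (i , ≈-refl) (j , ≈-refl))
      neg : Fin N → Fin N
      neg i = proj₁ (neg-closed (i , ≈-refl))
      zero′ one′ : Fin N
      zero′ = proj₁ 0-closed
      one′ = proj₁ 1-closed
      e-plus : ∀ i j → e (plus i j) ≈ e i + e j
      e-plus i j = proj₂ (+-closed (i , ≈-refl) (j , ≈-refl))
      e-neg : ∀ i → e (neg i) ≈ - e i
      e-neg i = proj₂ (neg-closed (i , ≈-refl))

    e-times : ∀ i j → e (times i j) ≈ e i * e j
    e-times i j = proj₂ (*-closed (i , ≈-refl) (j , ≈-refl))

    private
      raw : RawRing 0ℓ 0ℓ
      raw = record { Carrier = Fin N ; _≈_ = _≡_ ; _+_ = plus ; _*_ = times ; -_ = neg ; 0# = zero′ ; 1# = one′ }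

      mono : IsRingMonomorphism raw rawRing e
      mono = record
        { isRingHomomorphism = record
          { isSemiringHomomorphism = record
            { isNearSemiringHomomorphism = record
              { +-isMonoidHomomorphism = record
                { isMagmaHomomorphism = record
                  { isRelHomomorphism = record { cong = λ { refl → ≈-refl } }
                  ; homo = e-plus }
                ; ε-homo = proj₂ 0-closed }
              ; *-homo = e-times }
            ; 1#-homo = proj₂ 1-closed }
          ; -‿homo = e-neg }
        ; injective = e-inj }

    finDiv : FinDiv N
    finDiv = record
      { _+_ = plus ; _*_ = times ; -_ = neg ; 0# = zero′ ; 1# = one′
      ; isRing = RingMonomorphism.isRing mono (Ring.isRing ring)
      ; 0≢1 = λ eq → 0≉1 (≈-trans (≈-sym (proj₂ 0-closed)) (≈-trans (reflexive (cong e eq)) (proj₂ 1-closed)))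
      ; inverse = λ i i≢0 →
          let nz : e i ≉ 0#
              nz eq = i≢0 (e-inj (≈-trans eq (≈-sym (proj₂ 0-closed))))
              j , ej = inv-closed nz (i , ≈-refl)
          in j , e-inj (≈-trans (e-times i j) (≈-trans (*-congˡ ej) (≈-trans (*-inv _ nz) (≈-sym (proj₂ 1-closed)))))
               , e-inj (≈-trans (e-times j i) (≈-trans (*-congʳ ej) (≈-trans (inv-* _ nz) (≈-sym (proj₂ 1-closed)))))
      }

    image-commutes : (∀ i j → FinDiv._*_ finDiv i j ≡ FinDiv._*_ finDiv j i) →
                     ∀ {x y} → (∃ λ i → e i ≈ x) → (∃ λ j → e j ≈ y) → x * y ≈ y * x
    image-commutes comm {x} {y} (i , ex) (j , ey) = begin
      x * y              ≈⟨ *-cong ex ey ⟨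
      e i * e j          ≈⟨ e-times i j ⟨
      e (times i j)      ≈⟨ reflexive (cong e (comm i j)) ⟩
      e (times j i)      ≈⟨ e-times j i ⟩
      e j * e i          ≈⟨ *-cong ey ex ⟩
      y * x              ∎
      where open import Relation.Binary.Reasoning.Setoid ≈-setoid

  enumerate : ∀ (L : List Carrier) → ∃ λ N → ∃ λ (e : Fin N → Carrier) →
              (∀ {i j} → e i ≈ e j → i ≡ j) × (∀ i → e i ∈ L) × (∀ {x} → x ∈ L → ∃ λ i → e i ≈ x)
  enumerate [] = 0 , (λ ()) , (λ { {()} }) , (λ ()) , λ ()
  enumerate (x ∷ L) with enumerate L
  ... | N , e , inj , e∈ , cov with lem {P = ∃ λ i → e i ≈ x}
  ...   | yes found = N , e , inj , (λ i → there (e∈ i)) , λ { (here refl) → found ; (there y∈) → cov y∈ }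
  ...   | no new = suc N , cons x e , inj′ , (λ { fz → here refl ; (fs i) → there (e∈ i) }) , λ { (here refl) → fz , ≈-refl ; (there y∈) → let i , eq = cov y∈ in fs i , eq }
    where
    inj′ : ∀ {i j} → cons x e i ≈ cons x e j → i ≡ j
    inj′ {fz} {fz} eq = refl
    inj′ {fz} {fs j} eq = ⊥-elim (new (j , ≈-sym eq))
    inj′ {fs i} {fz} eq = ⊥-elim (new (i , eq))
    inj′ {fs i} {fs j} eq = cong fs (inj eq)

module Classes (lem : EM) {A : Set} (R : A → A → Set) (R-refl : ∀ {x} → R x x)
               (R-sym : ∀ {x y} → R x y → R y x) (R-trans : ∀ {x y z} → R x y → R y z → R x z) where

  R? : ∀ x y → Dec (R x y)
  R? x y = lem

  filter-filter : ∀ {P Q : A → Set} (P? : ∀ x → Dec (P x)) (Q? : ∀ x → Dec (Q x)) L →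
                  (∀ {z} → P z → Q z) → filter P? (filter Q? L) ≡ filter P? L
  filter-filter P? Q? [] imp = refl
  filter-filter P? Q? (x ∷ L) imp with Q? x
  ... | yes qx with P? x
  ...   | yes _ = cong (x ∷_) (filter-filter P? Q? L imp)
  ...   | no _ = filter-filter P? Q? L imp
  filter-filter P? Q? (x ∷ L) imp | no ¬qx with P? x
  ... | yes px = ⊥-elim (¬qx (imp px))
  ... | no _ = filter-filter P? Q? L imp

  length-filters : ∀ {P : A → Set} (P? : ∀ x → Dec (P x)) L →
                   length L ≡ length (filter P? L) ℕ.+ length (filter (¬? ∘ P?) L)
  length-filters P? [] = refl
  length-filters P? (x ∷ L) with P? x
  ... | yes _ = cong suc (length-filters P? L)
  ... | no _ = trans (cong suc (length-filters P? L)) (sym (ℕₚ.+-suc _ _))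

  record Representatives (s : ℕ) (L : List A) : Set where
    field
      reps  : List A
      count : length L ≡ s ℕ.* length reps
      reps∈ : ∀ {x} → x ∈ reps → x ∈ L
      apart : AllPairs (λ x y → ¬ R x y) reps
      cover : ∀ {x} → x ∈ L → ∃ λ r → r ∈ reps × R r x

  -- Splits off the class of the head repeatedly. A class other than that of `x` loses nothing when
  -- the class of `x` is removed, so the common size `s` survives; `n` is fuel, since the recursion
  -- is on a filtered list.
  representatives : ∀ n {s} L → length L ≤ n → (∀ {x} → x ∈ L → length (filter (R? x) L) ≡ s) → Representatives s L
  representatives n {s} [] _ _ = record
    { reps = [] ; count = sym (ℕₚ.*-zeroʳ s) ; reps∈ = λ () ; apart = [] ; cover = λ () }
  representatives (suc n) {s} L@(x ∷ L₀) (s≤s len) size = record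
    { reps = x ∷ reps
    ; count = trans (length-filters (R? x) L) (trans (cong₂ ℕ._+_ (size (here refl)) count) (sym (ℕₚ.*-suc s (length reps))))
    ; reps∈ = λ { (here refl) → here refl ; (there r∈) → proj₁ (∈rest (reps∈ r∈)) }
    ; apart = All.tabulate (λ r∈ → proj₂ (∈rest (reps∈ r∈))) ∷ apart
    ; cover = cover′
    }
    where
    rest : List A
    rest = filter (¬? ∘ R? x) L
    ∈rest : ∀ {y} → y ∈ rest → y ∈ L × ¬ R x y
    ∈rest = ∈-filter⁻ (¬? ∘ R? x) {xs = L}
    short : length rest ≤ n
    short with R? x x
    ... | no ¬r = ⊥-elim (¬r R-refl)
    ... | yes _ = ℕₚ.≤-trans (Listₚ.length-filter (¬? ∘ R? x) L₀) len
    size′ : ∀ {y} → y ∈ rest → length (filter (R? y) rest) ≡ s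
    size′ {y} y∈ = trans (cong length (filter-filter (R? y) (¬? ∘ R? x) L
      (λ ryz rxz → proj₂ (∈rest y∈) (R-trans rxz (R-sym ryz))))) (size (proj₁ (∈rest y∈)))
    open Representatives (representatives n rest short size′)
    cover′ : ∀ {y} → y ∈ L → ∃ λ r → r ∈ x ∷ reps × R r y
    cover′ {y} y∈ with R? x y
    ... | yes rxy = x , here refl , rxy
    ... | no ¬rxy with cover (∈-filter⁺ (¬? ∘ R? x) y∈ ¬rxy)
    ...   | r , r∈ , rry = r , there r∈ , rry

^-injectiveʳ : ∀ {q i j} → 1 < q → q ℕ.^ i ≡ q ℕ.^ j → i ≡ j
^-injectiveʳ {q} {i} {j} 1<q eq with ℕₚ.<-cmp i j
... | tri< i<j _ _ = ⊥-elim (ℕₚ.<⇒≢ (ℕₚ.^-monoʳ-< q 1<q i<j) eq)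
... | tri≈ _ i≡j _ = i≡j
... | tri> _ _ j<i = ⊥-elim (ℕₚ.<⇒≢ (ℕₚ.^-monoʳ-< q 1<q j<i) (sym eq))

square-injective : ∀ {i j} → i ℕ.* i ≡ j ℕ.* j → i ≡ j
square-injective {i} {j} eq with ℕₚ.<-cmp i j
... | tri< i<j _ _ = ⊥-elim (ℕₚ.<⇒≢ (ℕₚ.*-mono-< i<j i<j) eq)
... | tri≈ _ i≡j _ = i≡j
... | tri> _ _ j<i = ⊥-elim (ℕₚ.<⇒≢ (ℕₚ.*-mono-< j<i j<i) (sym eq))

-- T divides N - 1 and N - q, hence q - 1, but N ≥ κ² forces T > κ ≥ q.
class-equation-absurd : ∀ {N κ q T s d} → 1 < q → q ≤ κ → κ < N → N ≡ κ ℕ.^ d →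
                        N ≡ suc ((κ ℕ.∸ 1) ℕ.* T) → N ≡ T ℕ.* s ℕ.+ q → ⊥
class-equation-absurd {d = zero} 1<q q≤κ κ<N N≡ _ _ = ℕₚ.<⇒≱ (ℕₚ.<-trans (ℕₚ.<-≤-trans 1<q q≤κ) κ<N) (ℕₚ.≤-reflexive N≡)
class-equation-absurd {κ = κ} {d = suc zero} 1<q q≤κ κ<N N≡ _ _ = ℕₚ.<⇒≢ κ<N (sym (trans N≡ (ℕₚ.*-identityʳ κ)))
class-equation-absurd {N} {suc κ′} {q = suc (suc q′)} {T} {s} {suc (suc d)} (s≤s (s≤s z≤n)) q≤κ κ<N N≡ cls eqn =
  ℕₚ.<⇒≱ T< (∣⇒≤ T∣)
  where
  κ = suc κ′
  T∣ : T ∣ suc q′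
  T∣ = ∣m+n∣m⇒∣n (subst (T ∣_) eqn′ (divides κ′ refl)) (divides s (ℕₚ.*-comm T s))
    where
    eqn′ : κ′ ℕ.* T ≡ T ℕ.* s ℕ.+ suc q′
    eqn′ = ℕₚ.suc-injective (trans (sym cls) (trans eqn (ℕₚ.+-suc (T ℕ.* s) (suc q′))))
  κ²≤N : κ ℕ.* κ ≤ N
  κ²≤N = ℕₚ.≤-trans (ℕₚ.*-monoʳ-≤ κ (ℕₚ.m≤m*n κ (κ ℕ.^ d) {{ℕₚ.m^n≢0 κ d}})) (ℕₚ.≤-reflexive (sym N≡))
  T< : suc q′ < T
  T< = ℕₚ.≰⇒> λ T≤ → ℕₚ.<-irrefl refl (begin-strict
    κ ℕ.* κ                     ≤⟨ κ²≤N ⟩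
    N                           ≡⟨ cls ⟩
    suc (κ′ ℕ.* T)              ≤⟨ s≤s (ℕₚ.*-monoʳ-≤ κ′ (ℕₚ.≤-trans T≤ (ℕₚ.≤-pred q≤κ))) ⟩
    suc (κ′ ℕ.* κ′)             ≤⟨ s≤s (ℕₚ.*-monoʳ-≤ κ′ (ℕₚ.n≤1+n κ′)) ⟩
    suc (κ′ ℕ.* κ)              <⟨ ℕₚ.+-monoˡ-< (κ′ ℕ.* κ) (ℕₚ.≤-trans (s≤s (s≤s z≤n)) q≤κ) ⟩
    κ ℕ.+ κ′ ℕ.* κ              ∎)
    where open ℕₚ.≤-Reasoning

module _ {q r : ℕ} where
  abstract
    digits : Fin (q ℕ.^ r) → Fin r → Fin q
    digits = Fin.finToFun

    undigits : (Fin r → Fin q) → Fin (q ℕ.^ r)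
    undigits = Fin.funToFin

    digits-undigits : ∀ f i → digits (undigits f) i ≡ f i
    digits-undigits = Finₚ.finToFun-funToFin

    digits-injective : ∀ {k l} → (∀ i → digits k i ≡ digits l i) → k ≡ l
    digits-injective {k} {l} eq = trans (sym (Finₚ.funToFin-finToFin {r} {q} k))
      (trans (funToFin-cong eq) (Finₚ.funToFin-finToFin {r} {q} l))
      where
      funToFin-cong : ∀ {m n} {f g : Fin m → Fin n} → (∀ i → f i ≡ g i) → Fin.funToFin f ≡ Fin.funToFin g
      funToFin-cong {zero} eq = refl
      funToFin-cong {suc m} eq = cong₂ Fin.combine (eq fz) (funToFin-cong (eq ∘ fs))

module _ (lem : EM) {N : ℕ} where

  abstract
    elements : (Fin N → Set) → List (Fin N)
    elements P = filter {P = P} (λ x → lem) (allFin N)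

    ∈-elements⁺ : ∀ {P : Fin N → Set} {x} → P x → x ∈ elements P
    ∈-elements⁺ px = ∈-filter⁺ (λ x → lem) (∈-allFin _) px

    ∈-elements⁻ : ∀ {P : Fin N → Set} {x} → x ∈ elements P → P x
    ∈-elements⁻ x∈ = proj₂ (∈-filter⁻ (λ x → lem) {xs = allFin N} x∈)

    Unique-elements : ∀ (P : Fin N → Set) → Unique (elements P)
    Unique-elements P = Uniqueₚ.filter⁺ (λ x → lem) (Uniqueₚ.allFin⁺ N)

  card : (Fin N → Set) → ℕ
  card P = length (elements P)

  length≡card : ∀ {xs} {P : Fin N → Set} → Unique xs → (∀ {x} → x ∈ xs → P x) → (∀ {x} → P x → x ∈ xs) → length xs ≡ card P
  length≡card u sound complete = ℕₚ.≤-antisym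
    (Unique-⊆⇒length-≤ u (λ x∈ → ∈-elements⁺ (sound x∈)))
    (Unique-⊆⇒length-≤ (Unique-elements _) (λ x∈ → complete (∈-elements⁻ x∈)))

  card-⊤ : ∀ {P : Fin N → Set} → (∀ x → P x) → card P ≡ N
  card-⊤ all = trans (sym (length≡card (Uniqueₚ.allFin⁺ N) (λ {x} _ → all x) (λ _ → ∈-allFin _))) (Listₚ.length-tabulate id)

  card-mono : ∀ {P Q : Fin N → Set} → (∀ {x} → P x → Q x) → card P ≤ card Q
  card-mono imp = Unique-⊆⇒length-≤ (Unique-elements _) (λ x∈ → ∈-elements⁺ (imp (∈-elements⁻ x∈)))

  card-insert : ∀ {P Q : Fin N → Set} z → ¬ P z → Q z → (∀ {x} → P x → Q x) → (∀ {x} → Q x → x ≢ z → P x) →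
                card Q ≡ suc (card P)
  card-insert {P} {Q} z ¬pz qz P⊆Q Q∖z⊆P = sym (length≡card {z ∷ elements P}
    (All.tabulate (λ { x∈ refl → ¬pz (∈-elements⁻ x∈) }) ∷ Unique-elements P)
    (λ { (here refl) → qz ; (there x∈) → P⊆Q (∈-elements⁻ x∈) })
    λ {x} qx → complete qx (x Finₚ.≟ z))
    where
    complete : ∀ {x} → Q x → Dec (x ≡ z) → x ∈ z ∷ elements P
    complete qx (yes refl) = here refl
    complete qx (no x≢z) = there (∈-elements⁺ (Q∖z⊆P qx x≢z))

module Counting (lem : EM) {N} (F : FinDiv N) where
  D = FinDiv.divisionRing F
  open DivisionRing D using (_+_; _*_; -_; _-_; 0#; 1#; *-assoc; *-identityˡ; *-identityʳ; zeroˡ; zeroʳ)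
  open DivisionRings lem D
  open Subfields lem D
  open MaximalSubfield lem D
  open import Algebra.Properties.Ring (DivisionRing.ring D)

  nontrivial : ∀ {P : Fin N → Set} → IsSubfield P → 1 < card lem P
  nontrivial {P} sub = Unique-⊆⇒length-≤ {xs = 0# ∷ 1# ∷ []} ((DivisionRing.0≉1 D ∷ []) ∷ [] ∷ [])
    (λ { (here refl) → ∈-elements⁺ lem 0-closed ; (there (here refl)) → ∈-elements⁺ lem 1-closed })
    where open IsSubfield sub

  ∑-closed : ∀ {P : Fin N → Set} → IsSubfield P → ∀ {r} (f : Fin r → Fin N) → (∀ i → P (f i)) → P (∑ f)
  ∑-closed {P} sub {zero} f pf = subst P (sym ∑-empty) (IsSubfield.0-closed sub)
  ∑-closed {P} sub {suc r} f pf = subst P (sym (∑-suc f)) (IsSubfield.+-closed sub (pf fz) (∑-closed sub (f ∘ fs) (pf ∘ fs)))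

  -- Coefficient tuples are coded by numbers below `q ^ dim` through their base `q` digits.
  -- Independence makes the resulting combinations distinct, and spanning makes them exhaust `S`.
  card-power : ∀ {P S : Fin N → Set} → IsSubfield P → (B : Basis P S (allFin N)) → let open Basis B in
               (∀ c → (∀ i → P (c i)) → S (∑ (λ i → c i * vec i))) → card lem S ≡ card lem P ℕ.^ dim
  card-power {P} {S} sub B lin = trans
    (sym (length≡card lem {xs = map comb (allFin (q ℕ.^ dim))} (Unique-map comb (Uniqueₚ.allFin⁺ _) (λ _ _ → comb-inj)) sound complete))
    (trans (Listₚ.length-map comb (allFin (q ℕ.^ dim))) (Listₚ.length-tabulate id))
    where
    open Basis B
    open IsSubfield sub
    q = card lem P
    coef : Fin (q ℕ.^ dim) → Fin dim → Fin N
    coef k i = lookup (elements lem P) (digits k i)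
    coef∈ : ∀ k i → P (coef k i)
    coef∈ k i = ∈-elements⁻ lem (∈-lookup (digits k i))
    comb : Fin (q ℕ.^ dim) → Fin N
    comb k = ∑ (λ i → coef k i * vec i)
    comb-inj : ∀ {k l} → comb k ≡ comb l → k ≡ l
    comb-inj {k} {l} eq = digits-injective same
      where
      difference : ∑ (λ i → (coef k i - coef l i) * vec i) ≡ 0#
      difference = trans (∑-cong (λ i → [y-z]x≈yx-zx (vec i) (coef k i) (coef l i))) (trans (∑-- _ _) (≈⇒-≈0 eq))
      same : ∀ i → digits k i ≡ digits l i
      same i = lookup-inj (Unique-elements lem P)
        (-≈0⇒≈ (indep (λ i → coef k i - coef l i) (λ i → +-closed (coef∈ k i) (neg-closed (coef∈ l i))) difference i))
    sound : ∀ {x} → x ∈ map comb (allFin (q ℕ.^ dim)) → S x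
    sound x∈ with ∈-map⁻ comb x∈
    ... | k , _ , refl = lin (coef k) (coef∈ k)
    complete : ∀ {x} → S x → x ∈ map comb (allFin (q ℕ.^ dim))
    complete {x} sx with spans (∈-allFin x) sx
    ... | c , pc , eq = subst (_∈ map comb _) (trans (∑-cong (λ i → cong (_* vec i) (coef≡ i))) eq) (∈-map⁺ comb (∈-allFin k))
      where
      ix : Fin dim → Fin q
      ix i = Any.index (∈-elements⁺ lem (pc i))
      k = undigits ix
      coef≡ : ∀ i → coef k i ≡ c i
      coef≡ i = trans (cong (lookup (elements lem P)) (digits-undigits ix i)) (sym (lookup-index (∈-elements⁺ lem (pc i))))

  K : Fin N → Fin N → Set
  K a = Cent (_≡ a)

  Conj : Fin N → Fin N → Fin N → Set
  Conj x y g = g ≢ 0# × g * x ≡ y * g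

  Class : Fin N → Fin N → Set
  Class x y = ∃ (Conj x y)

  conjugate : ∀ {g} (g≢0 : g ≢ 0#) x → Conj x (g * x * inv g g≢0) g
  conjugate {g} g≢0 x = g≢0 , sym (trans (*-assoc (g * x) _ g) (trans (cong (g * x *_) (inv-* g g≢0)) (*-identityʳ (g * x))))

  Conj-unique : ∀ {x y z g} → Conj x y g → Conj x z g → y ≡ z
  Conj-unique {x} {y} {z} {g} (g≢0 , p) (_ , q) = trans (sym (undo y)) (trans (cong (_* inv g g≢0) (trans (sym p) q)) (undo z))
    where
    undo : ∀ w → w * g * inv g g≢0 ≡ w
    undo w = trans (*-assoc w g _) (trans (cong (w *_) (*-inv g g≢0)) (*-identityʳ w))

  Class-refl : ∀ {x} → Class x x
  Class-refl {x} = 1# , 1≉0 , trans (*-identityˡ x) (sym (*-identityʳ x))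

  Class-sym : ∀ {x y} → Class x y → Class y x
  Class-sym {x} {y} (g , g≢0 , eq) = inv g g≢0 , inv-nonzero g g≢0 , *-cancelˡ g≢0 (begin
    g * (inv g g≢0 * y)      ≡⟨ *-assoc g _ y ⟨
    g * inv g g≢0 * y        ≡⟨ cong (_* y) (*-inv g g≢0) ⟩
    1# * y                   ≡⟨ *-identityˡ y ⟩
    y                        ≡⟨ *-identityʳ y ⟨
    y * 1#                   ≡⟨ cong (y *_) (*-inv g g≢0) ⟨
    y * (g * inv g g≢0)      ≡⟨ *-assoc y g _ ⟨
    y * g * inv g g≢0        ≡⟨ cong (_* inv g g≢0) eq ⟨
    g * x * inv g g≢0        ≡⟨ *-assoc g x _ ⟩
    g * (x * inv g g≢0)      ∎)
    where open ≡.≡-Reasoning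

  Class-trans : ∀ {x y z} → Class x y → Class y z → Class x z
  Class-trans {x} {y} {z} (g , g≢0 , p) (h , h≢0 , q) = h * g , *-nonzero h≢0 g≢0 ,
    trans (*-assoc h g x) (trans (cong (h *_) p) (trans (sym (*-assoc h y g)) (trans (cong (_* g) q) (*-assoc z h g))))

  Class-center : ∀ {x y} → Class x y → Center x → Center y
  Class-center {x} {y} (g , g≢0 , eq) cx = subst Center x≡y cx
    where
    x≡y : x ≡ y
    x≡y = Conj-unique (g≢0 , sym (cx g tt)) (g≢0 , eq)

  module ClassSize (a : Fin N) where

    SameConj : Fin N → Fin N → Set
    SameConj g h = ∀ {y} → Conj a y g ⇔ Conj a y h

    private
      SameConj-from : ∀ {g h y} → Conj a y g → Conj a y h → SameConj g h
      SameConj-from {g} {h} cg ch {z} = mk⇔ (λ cg′ → subst (λ w → Conj a w h) (Conj-unique cg cg′) ch)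
                                          (λ ch′ → subst (λ w → Conj a w g) (Conj-unique ch ch′) cg)
      open Classes lem SameConj (mk⇔ id id)
        (λ p → mk⇔ (Equivalence.from p) (Equivalence.to p))
        (λ p q → mk⇔ (λ c → Equivalence.to q (Equivalence.to p c)) (λ c → Equivalence.from p (Equivalence.from q c)))
      G : List (Fin N)
      G = elements lem (_≢ 0#)
      K* : Fin N → Set
      K* k = k ≢ 0# × K a k

      -- A nonzero `h` conjugates `a` as `g` does exactly when `inv g * h` commutes with `a`, so the
      -- fibre is the coset of `g` modulo `K*`.
      fibre : ∀ {g} → g ∈ G → length (filter (R? g) G) ≡ card lem K*
      fibre {g} g∈ = trans
        (length≡card lem {P = λ h → h ≢ 0# × SameConj g h} (Uniqueₚ.filter⁺ (R? g) (Unique-elements lem _))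
          (λ h∈ → let h∈G , so = ∈-filter⁻ (R? g) {xs = G} h∈ in ∈-elements⁻ lem h∈G , so)
          (λ (h≢0 , so) → ∈-filter⁺ (R? g) (∈-elements⁺ lem h≢0) so))
        (trans (sym (length≡card lem {xs = map (g *_) (elements lem K*)}
            (Unique-map (g *_) (Unique-elements lem K*) (λ _ _ → *-cancelˡ g≢0)) sound complete))
          (Listₚ.length-map (g *_) (elements lem K*)))
        where
        g≢0 : g ≢ 0#
        g≢0 = ∈-elements⁻ lem g∈
        y = g * a * inv g g≢0
        cg : Conj a y g
        cg = conjugate g≢0 a
        sound : ∀ {h} → h ∈ map (g *_) (elements lem K*) → h ≢ 0# × SameConj g h
        sound h∈ with ∈-map⁻ (g *_) h∈
        ... | k , k∈ , refl = gk≢0 , SameConj-from cg (gk≢0 , (begin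
            g * k * a       ≡⟨ *-assoc g k a ⟩
            g * (k * a)     ≡⟨ cong (g *_) (proj₂ kk a refl) ⟩
            g * (a * k)     ≡⟨ *-assoc g a k ⟨
            g * a * k       ≡⟨ cong (_* k) (proj₂ cg) ⟩
            y * g * k       ≡⟨ *-assoc y g k ⟩
            y * (g * k)     ∎))
          where
          open ≡.≡-Reasoning
          kk = ∈-elements⁻ lem {P = K*} k∈
          gk≢0 = *-nonzero g≢0 (proj₁ kk)
        complete : ∀ {h} → h ≢ 0# × SameConj g h → h ∈ map (g *_) (elements lem K*)
        complete {h} (h≢0 , so) = subst (_∈ map (g *_) _) gk≡h
          (∈-map⁺ (g *_) (∈-elements⁺ lem (k≢0 , λ { l refl → *-cancelˡ g≢0 (begin
            g * (k * a)     ≡⟨ *-assoc g k a ⟨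
            g * k * a       ≡⟨ cong (_* a) gk≡h ⟩
            h * a           ≡⟨ proj₂ (Equivalence.to so cg) ⟩
            y * h           ≡⟨ cong (y *_) gk≡h ⟨
            y * (g * k)     ≡⟨ *-assoc y g k ⟨
            y * g * k       ≡⟨ cong (_* k) (proj₂ cg) ⟨
            g * a * k       ≡⟨ *-assoc g a k ⟩
            g * (a * k)     ∎) })))
          where
          open ≡.≡-Reasoning
          k = inv g g≢0 * h
          k≢0 = *-nonzero (inv-nonzero g g≢0) h≢0
          gk≡h : g * k ≡ h
          gk≡h = trans (sym (*-assoc g _ h)) (trans (cong (_* h) (*-inv g g≢0)) (*-identityˡ h))

      open Representatives (representatives (length G) G ℕₚ.≤-refl fibre)

      conj : Fin N → Fin N
      conj g with g Finₚ.≟ 0#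
      ... | yes _ = a
      ... | no g≢0 = g * a * inv g g≢0

      conj-Conj : ∀ {g} → g ≢ 0# → Conj a (conj g) g
      conj-Conj {g} g≢0 with g Finₚ.≟ 0#
      ... | yes g≡0 = ⊥-elim (g≢0 g≡0)
      ... | no g≢0′ = conjugate g≢0′ a

      rep≢0 : ∀ {g} → g ∈ reps → g ≢ 0#
      rep≢0 g∈ = ∈-elements⁻ lem (reps∈ g∈)

      unique-conj : ∀ {rs} → (∀ {g} → g ∈ rs → g ≢ 0#) → AllPairs (λ g h → ¬ SameConj g h) rs → Unique (map conj rs)
      unique-conj nz [] = []
      unique-conj {g ∷ rs} nz (g≁ ∷ ap) = All.tabulate (λ {z} z∈ eq → let h , h∈ , z≡ = ∈-map⁻ conj z∈ in
          All.lookup g≁ h∈ (SameConj-from (conj-Conj (nz (here refl)))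
            (subst (λ w → Conj a w h) (sym (trans eq z≡)) (conj-Conj (nz (there h∈))))))
        ∷ unique-conj (nz ∘ there) ap

      length-reps : length reps ≡ card lem (Class a)
      length-reps = trans (sym (Listₚ.length-map conj reps)) (length≡card lem (unique-conj rep≢0 apart)
        (λ y∈ → let g , g∈ , y≡ = ∈-map⁻ conj y∈ in g , subst (λ w → Conj a w g) (sym y≡) (conj-Conj (rep≢0 g∈)))
        (λ {y} (g , cg) → let r , r∈ , so = cover (∈-elements⁺ lem (proj₁ cg)) in
          subst (_∈ map conj reps) (Conj-unique (conj-Conj (rep≢0 r∈)) (Equivalence.from so cg)) (∈-map⁺ conj r∈)))

    -- The `N - 1` nonzero elements split into cosets of the nonzero part of `K a`, one for each
    -- conjugate of `a`.
    orbit-stabilizer : N ≡ suc ((card lem (K a) ℕ.∸ 1) ℕ.* card lem (Class a))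
    orbit-stabilizer = trans (sym (card-⊤ lem {P = λ _ → ⊤} _))
      (trans (card-insert lem {P = _≢ 0#} 0# (λ p → p refl) tt _ (λ _ → id))
        (cong suc (trans count (cong₂ ℕ._*_ (cong ℕ.pred (sym K≡)) length-reps))))
      where
      K≡ : card lem (K a) ≡ suc (card lem K*)
      K≡ = card-insert lem {P = K*} 0# (λ p → proj₁ p refl) (IsSubfield.0-closed (Cent-isSubfield (_≡ a))) proj₂ (λ k x≢0 → x≢0 , k)

  -- In a minimal counterexample all centralizers of noncentral elements are
  -- maximal subfields of one size, which contradicts the class equation.
  module _ (minimal : ∀ {M} → M < N → (G : FinDiv M) → ∀ i j → FinDiv._*_ G i j ≡ FinDiv._*_ G j i) where

    card-K< : ∀ {a} → ¬ Center a → card lem (K a) < N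
    card-K< {a} a∉Z with lem {P = ∃ λ z → ¬ K a z}
    ... | no all = ⊥-elim (a∉Z (λ z _ → decide z))
      where
      decide : ∀ z → a * z ≡ z * a
      decide z with lem {P = K a z}
      ... | yes kz = sym (kz a refl)
      ... | no ¬kz = ⊥-elim (all (z , ¬kz))
    ... | yes (z , ¬kz) = subst (card lem (K a) <_) (Listₚ.length-tabulate id)
      (Unique-⊆⇒length-≤ {xs = z ∷ elements lem (K a)}
        (All.tabulate (λ { x∈ refl → ¬kz (∈-elements⁻ lem x∈) }) ∷ Unique-elements lem (K a)) (λ _ → ∈-allFin _))

    K-comm : ∀ {a} → ¬ Center a → ∀ {x y} → K a x → K a y → x * y ≡ y * x
    K-comm {a} a∉Z kx ky with FiniteSubfield.enumerate lem D (elements lem (K a))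
    ... | M , e , inj , e∈ , cov = FiniteSubfield.image-commutes lem D e inj sub
            (minimal M<N (FiniteSubfield.finDiv lem D e inj sub)) (to kx) (to ky)
      where
      to : ∀ {x} → K a x → ∃ λ i → e i ≡ x
      to kx = cov (∈-elements⁺ lem kx)
      from : ∀ {x} → (∃ λ i → e i ≡ x) → K a x
      from (i , refl) = ∈-elements⁻ lem (e∈ i)
      open IsSubfield (Cent-isSubfield (_≡ a))
      sub : IsSubfield (λ x → ∃ λ i → e i ≡ x)
      sub = record
        { 0-closed = to 0-closed ; 1-closed = to 1-closed
        ; +-closed = λ p q → to (+-closed (from p) (from q)) ; *-closed = λ p q → to (*-closed (from p) (from q))
        ; neg-closed = λ p → to (neg-closed (from p)) ; inv-closed = λ nz p → to (inv-closed nz (from p)) }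
      M<N : M < N
      M<N = ℕₚ.≤-<-trans (ℕₚ.≤-reflexive (trans (sym (trans (Listₚ.length-map e (allFin M)) (Listₚ.length-tabulate id)))
        (length≡card lem (Unique-map e (Uniqueₚ.allFin⁺ M) (λ _ _ → inj))
          (λ x∈ → let i , _ , eq = ∈-map⁻ e x∈ in from (i , sym eq))
          (λ kx → let i , eq = to kx in subst (_∈ map e (allFin M)) eq (∈-map⁺ e (∈-allFin i)))))) (card-K< a∉Z)

    q : ℕ
    q = card lem Center

    Center-isSubfield : IsSubfield Center
    Center-isSubfield = Cent-isSubfield Whole

    -- `K a` is commutative by minimality and contains `a`, so whatever commutes with all of `K a`
    -- lies in `K a`. Thus its dimension over the centre and the dimension of the ring over it are
    -- the same `d`.
    dimension : ∀ {a} → ¬ Center a → ∃ λ d → card lem (K a) ≡ q ℕ.^ d × N ≡ card lem (K a) ℕ.^ d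
    dimension {a} a∉Z = Basis.dim B , κ≡ , trans N≡ (cong (card lem (K a) ℕ.^_) r≡d)
      where
      K-sub = Cent-isSubfield (_≡ a)
      B : Basis Center (K a) (allFin N)
      B = basis Center-isSubfield (allFin N)
      B′ : Basis (K a) Whole (allFin N)
      B′ = basis K-sub (allFin N)
      Center⊆K : ∀ {x} → Center x → K a x
      Center⊆K cx l _ = cx l tt
      κ≡ : card lem (K a) ≡ q ℕ.^ Basis.dim B
      κ≡ = card-power Center-isSubfield B (λ c cc → ∑-closed K-sub _
        (λ i → IsSubfield.*-closed K-sub (Center⊆K (cc i)) (Basis.vec∈ B i)))
      N≡ : N ≡ card lem (K a) ℕ.^ Basis.dim B′
      N≡ = trans (sym (card-⊤ lem {P = Whole} _)) (card-power K-sub B′ _)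
      r≡d : Basis.dim B′ ≡ Basis.dim B
      r≡d = dim-square K-sub (K-comm a∉Z) (λ ckx l l≡a → ckx l (λ { m refl → cong₂ _*_ l≡a (sym l≡a) }))
        (Basis.vec B′) (Basis.vec B) (Basis.vec∈ B) (Basis.indep B′) (λ x → Basis.spans B′ (∈-allFin x) tt)
        (Basis.indep B) (λ {x} kx → Basis.spans B (∈-allFin x) kx)

    -- The dimension does not depend on the element: `N ≡ q ^ (d * d)` determines `d` because
    -- `q > 1`.
    same-size : ∀ {a b} → ¬ Center a → ¬ Center b → card lem (K a) ≡ card lem (K b)
    same-size {a} {b} a∉Z b∉Z with dimension a∉Z | dimension b∉Z
    ... | d , κ≡ , N≡ | d′ , κ≡′ , N≡′ = trans κ≡ (trans (cong (q ℕ.^_) d≡d′) (sym κ≡′))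
      where
      N≡q^ : ∀ {κ d} → κ ≡ q ℕ.^ d → N ≡ κ ℕ.^ d → N ≡ q ℕ.^ (d ℕ.* d)
      N≡q^ {d = d} refl N≡ = trans N≡ (ℕₚ.^-*-assoc q d d)
      d≡d′ : d ≡ d′
      d≡d′ = square-injective (^-injectiveʳ (nontrivial Center-isSubfield) (trans (sym (N≡q^ {d = d} κ≡ N≡)) (N≡q^ {d = d′} κ≡′ N≡′)))

    same-class-size : ∀ {a b} → ¬ Center a → ¬ Center b → card lem (Class a) ≡ card lem (Class b)
    same-class-size {a} {b} a∉Z b∉Z = ℕₚ.*-cancelˡ-≡ _ _ (card lem (K a) ℕ.∸ 1) {{ℕ.>-nonZero κ-1>0}}
      (trans (ℕₚ.suc-injective (trans (sym (ClassSize.orbit-stabilizer a)) (ClassSize.orbit-stabilizer b)))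
        (cong (λ κ → (κ ℕ.∸ 1) ℕ.* card lem (Class b)) (same-size b∉Z a∉Z)))
      where
      κ-1>0 : 0 < card lem (K a) ℕ.∸ 1
      κ-1>0 = ℕₚ.m<n⇒0<n∸m (nontrivial (Cent-isSubfield (_≡ a)))

    noncentral-absurd : ∀ {a} → ¬ ¬ Center a
    noncentral-absurd {a} a∉Z with dimension a∉Z
    ... | d , _ , N≡κ^d = class-equation-absurd {d = d} (nontrivial Center-isSubfield)
      (card-mono lem (λ cx l _ → cx l tt)) (card-K< a∉Z) N≡κ^d (ClassSize.orbit-stabilizer a) class-equation
      where
      open Classes lem Class Class-refl Class-sym Class-trans
      L : List (Fin N)
      L = elements lem (λ x → ¬ Center x)
      class-length : ∀ {x} → x ∈ L → length (filter (R? x) L) ≡ card lem (Class a)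
      class-length {x} x∈ = trans (length≡card lem (Uniqueₚ.filter⁺ (R? x) (Unique-elements lem _))
          (λ y∈ → proj₂ (∈-filter⁻ (R? x) {xs = L} y∈))
          (λ c → ∈-filter⁺ (R? x) (∈-elements⁺ lem (λ cy → x∉Z (Class-center (Class-sym c) cy))) c))
        (same-class-size x∉Z a∉Z)
        where
        x∉Z : ¬ Center x
        x∉Z = ∈-elements⁻ lem x∈
      open Representatives (representatives (length L) L ℕₚ.≤-refl class-length)
      class-equation : N ≡ card lem (Class a) ℕ.* length reps ℕ.+ q
      class-equation = trans (sym (card-⊤ lem {P = Whole} _)) (trans (sym (length≡card lem
          (Uniqueₚ.++⁺ (Unique-elements lem _) (Unique-elements lem Center) (λ (p , c) → ∈-elements⁻ lem p (∈-elements⁻ lem c)))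
          _ (λ {x} _ → either x)))
        (trans (Listₚ.length-++ L) (cong (ℕ._+ q) count)))
        where
        either : ∀ x → x ∈ L ++ elements lem Center
        either x with lem {P = Center x}
        ... | yes cx = ∈-++⁺ʳ L (∈-elements⁺ lem cx)
        ... | no x∉Z = ∈-++⁺ˡ (∈-elements⁺ lem x∉Z)

wedderburn : (lem : EM) → ∀ n {N} → N ≤ n → (F : FinDiv N) → ∀ x y → FinDiv._*_ F x y ≡ FinDiv._*_ F y x
wedderburn lem zero z≤n F ()
wedderburn lem (suc n) {N} N≤ F x y with lem {P = FinDiv._*_ F x y ≡ FinDiv._*_ F y x}
... | yes eq = eq
... | no neq = ⊥-elim (Counting.noncentral-absurd lem F
        (λ M<N → wedderburn lem n (ℕₚ.≤-pred (ℕₚ.≤-trans M<N N≤))) {x} (λ cx → neq (cx y tt)))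

module Infinite (lem : EM) {ℓ₁ ℓ₂} (D : DivisionRing ℓ₁ ℓ₂) where
  open DivisionRing D
  open DivisionRings lem D using (¬≉⇒≈)
  open Subfields lem D
  open FiniteSubfield lem D

  -- If a list exhausted the ring, removing duplicates would index it by some `Fin N`, and
  -- Wedderburn's theorem would make it commutative.
  noncommutative⇒infinite : ¬ IsCommutative D → ∀ L → ∃ λ x → ∀ {y} → y ∈ L → x ≉ y
  noncommutative⇒infinite ¬comm L with lem {P = ∃ λ x → ∀ {y} → y ∈ L → x ≉ y}
  ... | yes found = found
  ... | no none with enumerate L
  ...   | N , e , inj , _ , cov = ⊥-elim (¬comm λ a b → image-commutes e inj sub
            (wedderburn lem N ℕₚ.≤-refl (finDiv e inj sub)) (image a) (image b))
    where
    image : ∀ x → ∃ λ i → e i ≈ x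
    image x with lem {P = ∃ λ y → y ∈ L × x ≈ y}
    ... | yes (y , y∈ , x≈y) = let i , eq = cov y∈ in i , DivisionRing.trans D eq (DivisionRing.sym D x≈y)
    ... | no ∉ = ⊥-elim (none (x , λ y∈ x≈y → ∉ (_ , y∈ , x≈y)))
    sub : IsSubfield (λ x → ∃ λ i → e i ≈ x)
    sub = record { 0-closed = image _ ; 1-closed = image _ ; +-closed = λ _ _ → image _
                 ; *-closed = λ _ _ → image _ ; neg-closed = λ _ → image _ ; inv-closed = λ _ _ → image _ }

-- Points in general position

module GeneralPosition (lem : EM) {ℓ₁ ℓ₂} (D : DivisionRing ℓ₁ ℓ₂) (n : ℕ)
  (infinite : ∀ (L : List (DivisionRing.Carrier D)) → ∃ λ x → ∀ {y} → y ∈ L → ¬ (DivisionRing._≈_ D x y)) where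
  open DivisionRing D renaming (refl to ≈-refl; sym to ≈-sym; trans to ≈-trans; setoid to ≈-setoid)
  open DivisionRings lem D
  open OppositeSums lem D
  open LinAlg D n
  open import Algebra.Properties.Ring ring
  open import Relation.Binary.Reasoning.Setoid ≈-setoid

  infix 8 _·_
  _·_ : Vector → Vector → Carrier
  x · b = ∑ (λ j → x j * b j)

  δ : Fin (suc n) → Vector
  δ i j with i Finₚ.≟ j
  ... | yes _ = 1#
  ... | no _ = 0#

  δ-· : ∀ i b → δ i · b ≈ b i
  δ-· i b = begin
    δ i · b                                                               ≈⟨ ∑-remove i (λ j → δ i j * b j) ⟩
    δ i i * b i + ∑ (λ j → δ i (Fin.punchIn i j) * b (Fin.punchIn i j))   ≈⟨ +-cong (≈-trans (*-congʳ on) (*-identityˡ (b i)))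
                                                                                    (∑-zero (λ j → ≈-trans (*-congʳ (off j)) (zeroˡ _))) ⟩
    b i + 0#                                                              ≈⟨ +-identityʳ _ ⟩
    b i                                                                   ∎
    where
    on : δ i i ≈ 1#
    on with i Finₚ.≟ i
    ... | yes _ = ≈-refl
    ... | no i≢i = ⊥-elim (i≢i refl)
    off : ∀ j → δ i (Fin.punchIn i j) ≈ 0#
    off j with i Finₚ.≟ Fin.punchIn i j
    ... | yes eq = ⊥-elim (Finₚ.punchInᵢ≢i i j (sym eq))
    ... | no _ = ≈-refl

  line-· : ∀ x t y b → (λ j → x j + t * y j) · b ≈ x · b + t * (y · b)
  line-· x t y b = begin
    ∑ (λ j → (x j + t * y j) * b j)               ≈⟨ ∑-cong (λ j → ≈-trans (distribʳ _ _ _) (+-congˡ (*-assoc _ _ _))) ⟩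
    ∑ (λ j → x j * b j + t * (y j * b j))         ≈⟨ ∑-+ _ _ ⟩
    x · b + ∑ (λ j → t * (y j * b j))             ≈⟨ +-congˡ (*-∑ _ _) ⟨
    x · b + t * (y · b)                           ∎

  -- On a line that leaves the hyperplane of b, only finitely many points lie on
  -- the hyperplane of b or on the others.
  avoid : ∀ (bs : List Vector) → (∀ {b} → b ∈ bs → NonZero b) → ∃ λ (x : Vector) → ∀ {b} → b ∈ bs → x · b ≉ 0#
  avoid [] _ = (λ _ → 0#) , λ ()
  avoid (b ∷ bs) nz with avoid bs (nz ∘ there)
  ... | x , off with (x · b) ≈? 0#
  ...   | no xb≉0 = x , λ { (here refl) → xb≉0 ; (there b∈) → off b∈ }
  ...   | yes xb≈0 with nz (here refl)
  ...     | i , bi≉0 = (λ j → x j + t * y j) , λ where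
              (here refl) eq → *-nonzero t≉0 yb≉0 (≈-trans (≈-sym (≈-trans (+-congʳ xb≈0) (+-identityˡ _))) (≈-trans (≈-sym (line-· x t y b)) eq))
              (there b∈) eq → avoids b∈ (≈-trans (≈-sym (line-· x t y _)) eq)
    where
    y : Vector
    y = δ i
    yb≉0 : y · b ≉ 0#
    yb≉0 eq = bi≉0 (≈-trans (≈-sym (δ-· i b)) eq)
    root : Vector → Carrier
    root b with (y · b) ≈? 0#
    ... | yes _ = 0#
    ... | no yb≉0 = - (x · b) * inv (y · b) yb≉0
    t : Carrier
    -- `root` gives the parameter at which the line meets a hyperplane it crosses. Zero is excluded
    -- as well, since at this parameter the line is at `x`, which lies on the hyperplane of the new
    -- `b`.
    t = proj₁ (infinite (0# ∷ map root bs))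
    t≉0 : t ≉ 0#
    t≉0 = proj₂ (infinite (0# ∷ map root bs)) (here refl)
    avoids : ∀ {b} → b ∈ bs → x · b + t * (y · b) ≉ 0#
    avoids {b} b∈ eq with (y · b) ≈? 0# | proj₂ (infinite (0# ∷ map root bs)) (there (∈-map⁺ root b∈))
    ... | yes yb≈0 | _ = off b∈ (≈-trans (≈-sym (≈-trans (+-congˡ (≈-trans (*-congˡ yb≈0) (zeroʳ t))) (+-identityʳ _))) eq)
    ... | no yb≉0 | t≉ = t≉ (begin
      t                                        ≈⟨ *-identityʳ t ⟨
      t * 1#                                   ≈⟨ *-congˡ (*-inv _ yb≉0) ⟨
      t * (y · b * inv (y · b) yb≉0)           ≈⟨ *-assoc _ _ _ ⟨
      t * (y · b) * inv (y · b) yb≉0           ≈⟨ *-congʳ (+-inverseʳ-unique _ _ eq) ⟩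
      - (x · b) * inv (y · b) yb≉0             ∎)

  -- There are `n` equations in `n + 1` unknowns. The unknown form stands on the right of the
  -- vectors, hence the opposite ring.
  annihilator : ∀ (v : Fin n → Vector) → ∃ λ (b : Vector) → NonZero b × ∀ i → v i · b ≈ 0#
  annihilator v with O.underdetermined n (λ j i → v i j) (ℕₚ.n<1+n n)
  ... | b , eqs , nz = b , nz , λ i → ≈-trans (reflexive (sym (∑ᵒ≡∑ (λ j → v i j * b j)))) (eqs i)

  -- Being outside a span is witnessed by a form vanishing on it. Only vectors of larger index are
  -- compared: this is what adding vectors in front provides, and it suffices for independence, as a
  -- relation can be tested at its least index.
  OutsideSpans : ∀ {N} → (Fin N → Vector) → Set (ℓ₁ ⊔ ℓ₂)
  OutsideSpans {N} V = ∀ k (s : Fin n → Fin N) → (∀ j → k Fin.< s j) →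
                       ∃ λ (b : Vector) → (∀ j → V (s j) · b ≈ 0#) × V k · b ≉ 0#

  outside-spans : ∀ N → ∃ λ (V : Fin N → Vector) → OutsideSpans V
  outside-spans zero = (λ ()) , λ ()
  outside-spans (suc N) with outside-spans N
  ... | V , out = V′ , out′
    where
    b : (Fin n → Fin N) → Vector
    b s = proj₁ (annihilator (V ∘ s))
    -- One hyperplane for each `n`-tuple of earlier vectors. The tuples are enumerated through their
    -- codes, because a given tuple agrees only pointwise with a decoded one.
    bs : List Vector
    bs = map (b ∘ digits) (allFin (N ℕ.^ n))
    bs-nz : ∀ {w} → w ∈ bs → NonZero w
    bs-nz w∈ with ∈-map⁻ (b ∘ digits) w∈
    ... | k , _ , refl = proj₁ (proj₂ (annihilator (V ∘ digits k)))
    V′ : Fin (suc N) → Vector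
    V′ fz = proj₁ (avoid bs bs-nz)
    V′ (fs i) = V i
    pred : ∀ {k : Fin (suc N)} {t} → k Fin.< t → ∃ λ t′ → t ≡ fs t′
    pred {t = fs t′} _ = t′ , refl
    out′ : OutsideSpans V′
    out′ k s k<s = go k k<s
      where
      s′ : Fin n → Fin N
      s′ j = proj₁ (pred (k<s j))
      s≡ : ∀ j → s j ≡ fs (s′ j)
      s≡ j = proj₂ (pred (k<s j))
      go : ∀ k → (∀ j → k Fin.< s j) → ∃ λ (b : Vector) → (∀ j → V′ (s j) · b ≈ 0#) × V′ k · b ≉ 0#
      go fz _ = b (digits e) , (λ j → ≈-trans (reflexive (cong (λ i → V′ i · b (digits e)) (trans (s≡ j) (cong fs (sym (digits-undigits s′ j))))))
                                        (proj₂ (proj₂ (annihilator (V ∘ digits e))) j)) ,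
                proj₂ (avoid bs bs-nz) (∈-map⁺ (b ∘ digits) (∈-allFin e))
        where e = undigits s′
      go (fs k′) k<s with out k′ s′ (λ j → ℕₚ.≤-pred (subst (fs k′ Fin.<_) (s≡ j) (k<s j)))
      ... | b , eqs , nz = b , (λ j → ≈-trans (reflexive (cong (λ i → V′ i · b) (s≡ j))) (eqs j)) , nz

  -- In a relation let `h` have the least `w h` among the nonzero coefficients, and apply a form
  -- that vanishes on the other vectors involved: what remains is `c h * (U h · b)`, a product of
  -- nonzero factors. Vectors with zero coefficient may precede `w h`, so they are replaced by the
  -- spare one.
  general-position : ∀ N → ∃ λ (V : Fin N → Vector) → ∀ {k} → k ≤ suc n → (w : Fin k → Fin N) →
                     (∀ {i j} → w i ≡ w j → i ≡ j) → LinIndep (V ∘ w)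
  general-position N with outside-spans (suc N)
  ... | V , out = V ∘ Fin.inject₁ , indep
    where
    indep : ∀ {k} → k ≤ suc n → (w : Fin k → Fin N) → (∀ {i j} → w i ≡ w j → i ≡ j) → LinIndep (V ∘ Fin.inject₁ ∘ w)
    indep {suc k} (s≤s k≤n) w w-inj c rel i = ¬≉⇒≈ λ ci≉0 →
      absurd (least {P = λ t → ∃ λ i → c i ≉ 0# × toℕ (w i) ≡ t} (λ t → lem) (toℕ (w i)) (i , ci≉0 , refl))
      where
      absurd : ¬ (∃ λ t → (∃ λ i → c i ≉ 0# × toℕ (w i) ≡ t) × t ≤ toℕ (w i) × (∀ u → u < t → ¬ (∃ λ i → c i ≉ 0# × toℕ (w i) ≡ u)))
      absurd (_ , (h , ch≉0 , refl) , _ , minimal) = go (out (Fin.inject₁ (w h)) s s-above)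
        where
        -- The last vector serves as a spare index when fewer than n are needed.
        target : ∀ j → Dec (c j ≉ 0#) → Fin (suc N)
        target j (yes _) = Fin.inject₁ (w j)
        target j (no _) = Fin.fromℕ N
        pick : ∀ (j : Fin n) → Dec (toℕ j < k) → Fin (suc N)
        pick j (yes j<k) = target (Fin.punchIn h (fromℕ< j<k)) lem
        pick j (no _) = Fin.fromℕ N
        s : Fin n → Fin (suc N)
        s j = pick j (toℕ j ℕ.<? k)
        below-top : Fin.inject₁ (w h) Fin.< Fin.fromℕ N
        below-top = subst (toℕ (Fin.inject₁ (w h)) ℕ.<_) (sym (Finₚ.toℕ-fromℕ N)) (subst (ℕ._< N) (sym (Finₚ.toℕ-inject₁ (w h))) (Finₚ.toℕ<n (w h)))
        target-above : ∀ j → h ≢ j → ∀ d → Fin.inject₁ (w h) Fin.< target j d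
        target-above j h≢j (no _) = below-top
        target-above j h≢j (yes cj≉0) = ≡.subst₂ ℕ._<_ (sym (Finₚ.toℕ-inject₁ (w h))) (sym (Finₚ.toℕ-inject₁ (w j)))
          (ℕₚ.≤∧≢⇒< (ℕₚ.≮⇒≥ (λ wj<wh → minimal _ wj<wh (j , cj≉0 , refl))) (λ eq → h≢j (w-inj (Finₚ.toℕ-injective eq))))
        s-above : ∀ j → Fin.inject₁ (w h) Fin.< s j
        s-above j with toℕ j ℕ.<? k
        ... | yes j<k = target-above _ (λ eq → Finₚ.punchInᵢ≢i h (fromℕ< j<k) (sym eq)) lem
        ... | no _ = below-top
        go : ¬ (∃ λ (b : Vector) → (∀ j → V (s j) · b ≈ 0#) × V (Fin.inject₁ (w h)) · b ≉ 0#)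
        go (b , eqs , nz) = *-nonzero ch≉0 nz (begin
          c h * (U h · b)
            ≈⟨ +-identityʳ _ ⟨
          c h * (U h · b) + 0#
            ≈⟨ +-congˡ (∑-zero others) ⟨
          c h * (U h · b) + ∑ (λ j → c (Fin.punchIn h j) * (U (Fin.punchIn h j) · b))
            ≈⟨ ∑-remove h (λ i → c i * (U i · b)) ⟨
          ∑ (λ i → c i * (U i · b))
            ≈⟨ ∑-cong (λ i → ≈-trans (*-∑ _ _) (∑-cong (λ j → ≈-sym (*-assoc _ _ _)))) ⟩
          ∑ (λ i → ∑ (λ j → c i * U i j * b j))
            ≈⟨ ∑-comm (λ i j → c i * U i j * b j) ⟩
          ∑ (λ j → ∑ (λ i → c i * U i j * b j))
            ≈⟨ ∑-zero (λ j → ≈-trans (≈-sym (∑-* (b j) (λ i → c i * U i j)))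
                  (≈-trans (*-congʳ (≈-trans (reflexive (sym (sumFin≡∑ n (λ i → c i * U i j)))) (rel j))) (zeroˡ (b j)))) ⟩
          0# ∎)
          where
          U : Fin (suc k) → Vector
          U i = V (Fin.inject₁ (w i))
          target-zero : ∀ j d → V (target j d) · b ≈ 0# → c j * (U j · b) ≈ 0#
          target-zero j (yes _) eq = ≈-trans (*-congˡ eq) (zeroʳ _)
          target-zero j (no cj≈0) eq = ≈-trans (*-congʳ (¬≉⇒≈ cj≈0)) (zeroˡ _)
          pick-eq : ∀ (j : Fin k) j′ → toℕ j′ ≡ toℕ j → ∀ d → V (pick j′ d) · b ≈ 0# → V (target (Fin.punchIn h j) lem) · b ≈ 0#
          pick-eq j j′ eq (yes j′<k) p = subst (λ i → V (target (Fin.punchIn h i) lem) · b ≈ 0#)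
            (Finₚ.toℕ-injective (trans (Finₚ.toℕ-fromℕ< j′<k) eq)) p
          pick-eq j j′ eq (no j′≮k) p = ⊥-elim (j′≮k (subst (_< k) (sym eq) (Finₚ.toℕ<n j)))
          others : ∀ j → c (Fin.punchIn h j) * (U (Fin.punchIn h j) · b) ≈ 0#
          others j = target-zero _ lem (pick-eq j j′ (Finₚ.toℕ-fromℕ< j<n) (toℕ j′ ℕ.<? k) (eqs j′))
            where
            j<n = ℕₚ.<-≤-trans (Finₚ.toℕ<n j) k≤n
            j′ = fromℕ< j<n

-- Realizations

module Realizations (lem : EM) (P : PolygonalSubdivision) {ℓ₁ ℓ₂} (D : DivisionRing ℓ₁ ℓ₂) (n : ℕ) where
  open PolygonalSubdivision P renaming (map to M)
  open Surfaces M
  open DivisionRing D renaming (refl to ≈-refl; sym to ≈-sym; trans to ≈-trans; setoid to ≈-setoid)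
  open DivisionRings lem D
  open LinAlg D n
  open import Algebra.Properties.Ring ring
  open import Relation.Binary.Reasoning.Setoid ≈-setoid
  private
    module G = Connections M units

  face≥2 : ∀ d → 2 ≤ Φ.period d
  face≥2 d = face-≥2 d (Φ.period d) (Φ.isPeriod d)

  -- One representing vector per vertex, equal along `σf`-orbits and not merely proportional, so
  -- that ratios on edges are well defined and multiply around faces.
  record Frame : Set (ℓ₁ ⊔ ℓ₂) where
    field
      U       : Dart → Vector
      U-σ     : ∀ d → U (σf d) ≡ U d
      U-indep : ∀ d k → FaceSize d k → LinIndep (λ (i : Fin k) → U (bd d (toℕ i)))

    U-φ : ∀ d → U (φ d) ≡ U (αf d)
    U-φ d = U-σ (αf d)

    lc : Carrier → Carrier → Dart → Vector
    lc x y d j = x * U d j + y * U (αf d) j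

    lc-cong : ∀ {x x′ y y′} d j → x ≈ x′ → y ≈ y′ → lc x y d j ≈ lc x′ y′ d j
    lc-cong d j x≈ y≈ = +-cong (*-congʳ x≈) (*-congʳ y≈)

    lc-scale : ∀ t x y d j → t * lc x y d j ≈ lc (t * x) (t * y) d j
    lc-scale t x y d j = ≈-trans (distribˡ _ _ _) (+-cong (≈-sym (*-assoc _ _ _)) (≈-sym (*-assoc _ _ _)))

    lc-flip : ∀ x y d j → lc x y (αf d) j ≈ lc y x d j
    lc-flip x y d j = ≈-trans (+-comm _ _) (+-congʳ (*-congˡ (reflexive (cong (λ e → U e j) (α-invol d)))))

    lc-10 : ∀ d j → U d j ≈ lc 1# 0# d j
    lc-10 d j = ≈-sym (≈-trans (+-cong (*-identityˡ _) (zeroˡ _)) (+-identityʳ _))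

    lc-01 : ∀ d j → U (αf d) j ≈ lc 0# 1# d j
    lc-01 d j = ≈-sym (≈-trans (+-cong (zeroˡ _) (*-identityˡ _)) (+-identityˡ _))

    lc-00 : ∀ d j → lc 0# 0# d j ≈ 0#
    lc-00 d j = ≈-trans (+-cong (zeroˡ _) (zeroˡ _)) (+-identityˡ 0#)

    -- The ends of an edge are the first two vertices of a face with at least two sides, hence
    -- independent.
    lc-zero : ∀ {x y} d → (∀ j → lc x y d j ≈ 0#) → x ≈ 0# × y ≈ 0#
    lc-zero {x} {y} d eq = go (Φ.period d) (face≥2 d) (Φ.isPeriod d)
     where
     go : ∀ k → 2 ≤ k → FaceSize d k → x ≈ 0# × y ≈ 0#
     go (suc zero) (s≤s ()) _
     go (suc (suc k)) _ size = coef≈0 fz , coef≈0 (fs fz)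
      where
      coef : Fin (suc (suc k)) → Carrier
      coef fz = x
      coef (fs fz) = y
      coef (fs (fs _)) = 0#
      coef≈0 : ∀ i → coef i ≈ 0#
      coef≈0 = U-indep d (suc (suc k)) size coef λ j → begin
        sumFin (λ i → coef i * U (bd d (toℕ i)) j)
          ≡⟨ cong (λ z → x * U d j + (y * U (φ d) j + z)) (sumFin≡∑ n _) ⟩
        x * U d j + (y * U (φ d) j + ∑ {k} (λ i → 0# * U (bd d (suc (suc (toℕ i)))) j))
          ≈⟨ +-congˡ (≈-trans (+-congˡ (∑-zero (λ i → zeroˡ _))) (+-identityʳ _)) ⟩
        x * U d j + y * U (φ d) j
          ≡⟨ cong (λ u → x * U d j + y * u j) (U-φ d) ⟩
        lc x y d j
          ≈⟨ eq j ⟩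
        0# ∎

    lc-unique : ∀ {x y x′ y′} d → (∀ j → lc x y d j ≈ lc x′ y′ d j) → x ≈ x′ × y ≈ y′
    lc-unique {x} {y} {x′} {y′} d eq = -≈0⇒≈ (proj₁ zeros) , -≈0⇒≈ (proj₂ zeros)
      where
      zeros : x - x′ ≈ 0# × y - y′ ≈ 0#
      zeros = lc-zero d λ j → begin
        lc (x - x′) (y - y′) d j
          ≈⟨ +-cong (distribʳ _ _ _) (distribʳ _ _ _) ⟩
        (x * U d j + - x′ * U d j) + (y * U (αf d) j + - y′ * U (αf d) j)
          ≈⟨ interchange _ _ _ _ ⟩
        lc x y d j + lc (- x′) (- y′) d j
          ≈⟨ +-cong (eq j) (+-cong (≈-sym (-‿distribˡ-* _ _)) (≈-sym (-‿distribˡ-* _ _))) ⟩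
        lc x′ y′ d j + (- (x′ * U d j) + - (y′ * U (αf d) j))
          ≈⟨ +-congˡ (-‿+-comm _ _) ⟩
        lc x′ y′ d j - lc x′ y′ d j
          ≈⟨ -‿inverseʳ _ ⟩
        0# ∎
        where open import Algebra.Properties.CommutativeSemigroup +-commutativeSemigroup using (interchange)

  prodTo-shift : ∀ f k → prodTo f (suc k) ≈ f 0 * prodTo (f ∘ suc) k
  prodTo-shift f zero = ≈-trans (*-identityˡ _) (≈-sym (*-identityʳ _))
  prodTo-shift f (suc k) = ≈-trans (*-congʳ (prodTo-shift f k)) (*-assoc _ _ _)

  prod≈prodTo : ∀ (a : Dart → Σ Carrier (_≉ 0#)) g k → proj₁ (G.prod (map a (applyUpTo g k))) ≈ prodTo (proj₁ ∘ a ∘ g) k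
  prod≈prodTo a g zero = ≈-refl
  prod≈prodTo a g (suc k) = ≈-trans (*-congˡ (prod≈prodTo a (g ∘ suc) k)) (≈-sym (prodTo-shift (proj₁ ∘ a ∘ g) k))

  -- Common to both directions of the theorem. The factor `p` allows arbitrary representing vectors
  -- of the edge points; it is 1 for the realizations constructed from connections.
  module Sides (F : Frame) (e : Dart → Vector) (p a : Dart → Σ Carrier (_≉ 0#))
               (e≈ : ∀ d j → e d j ≈ proj₁ (p d) * (Frame.U F d j - proj₁ (a d) * Frame.U F (αf d) j)) where
    open Frame F

    Dependent : Dart → Set (ℓ₁ ⊔ ℓ₂)
    Dependent d = ∀ k → FaceSize d k → LinDep (λ (i : Fin k) → e (bd d (toℕ i)))

    private
      module AtFace (d : Dart) = Menelaus {J = Fin (suc n)} (Φ.period-1 d) (U ∘ bd d) (e ∘ bd d)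
        (proj₁ ∘ p ∘ bd d) (proj₁ ∘ a ∘ bd d) (proj₂ ∘ p ∘ bd d)
        (λ i j → ≈-trans (e≈ (bd d i) j) (*-congˡ (+-congˡ (-‿cong (*-congˡ (reflexive (cong (λ u → u j) (sym (U-φ (bd d i))))))))))
        (λ j → reflexive (cong (λ x → U x j) (Φ.iter-period d)))
        (λ c rel i i<k → ≈-trans (reflexive (cong c (sym (Finₚ.toℕ-fromℕ< i<k))))
          (U-indep d (Φ.period d) (Φ.isPeriod d) (c ∘ toℕ) (λ j → ≈-trans (reflexive (sumFin≡∑ n _)) (rel j)) (fromℕ< i<k)))

      extendBy0 : ∀ {k} → (Fin k → Carrier) → ℕ → Carrier
      extendBy0 {k} c i with i ℕ.<? k
      ... | yes i<k = c (fromℕ< i<k)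
      ... | no _ = 0#

      extendBy0-toℕ : ∀ {k} (c : Fin k → Carrier) i → extendBy0 c (toℕ i) ≡ c i
      extendBy0-toℕ {k} c i with toℕ i ℕ.<? k
      ... | yes i<k = cong c (Finₚ.fromℕ<-toℕ i i<k)
      ... | no i≮k = ⊥-elim (i≮k (Finₚ.toℕ<n i))

    Dependent⇒Flat : ∀ d → Dependent d → G.Flat a d
    Dependent⇒Flat d dep with dep (Φ.period d) (Φ.isPeriod d)
    ... | c , rel , i , ci≉0 = ≈-trans (prod≈prodTo a (bd d) (Φ.period d))
      (AtFace.dependent⇒prod d (extendBy0 c)
        (λ j → ≈-trans (∑-cong (λ i → *-congʳ (reflexive (extendBy0-toℕ c i)))) (≈-trans (reflexive (sym (sumFin≡∑ n _))) (rel j)))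
        (Finₚ.toℕ<n i) (λ eq → ci≉0 (≈-trans (reflexive (sym (extendBy0-toℕ c i))) eq)))

    Flat⇒Dependent : ∀ d → G.Flat a d → Dependent d
    Flat⇒Dependent d flat k size = subst (λ k → LinDep (λ (i : Fin k) → e (bd d (toℕ i))))
        (Φ.IsPeriod-unique {d} (Φ.isPeriod d) size) (dependent
          (AtFace.prod⇒dependent d (≈-trans (≈-sym (prod≈prodTo a (bd d) (Φ.period d))) flat)))
      where
      dependent : (∃ λ (c : ℕ → Carrier) → (∀ j → sumTo (Φ.period d) (λ i → c i * e (bd d i) j) ≈ 0#) × c 0 ≉ 0#) →
                  LinDep (λ (i : Fin (Φ.period d)) → e (bd d (toℕ i)))
      dependent (c , rel , c0≉0) = c ∘ toℕ , (λ j → ≈-trans (reflexive (sumFin≡∑ n _)) (rel j)) , fz , c0≉0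

  module FromRealization (R : Realization P D n) where
    open Realization R

    vertex : Dart → Dart
    vertex = Σ′.rep

    SamePoint-iter : ∀ d k → SamePoint (vx d) (vx (iter σf k d))
    SamePoint-iter d zero = 1# , λ j → ≈-sym (*-identityˡ _)
    SamePoint-iter d (suc k) with SamePoint-iter d k | vx-wd (iter σf k d)
    ... | s , eq | t , eq′ = t * s , λ j → ≈-trans (eq′ j) (≈-trans (*-congˡ (eq j)) (≈-sym (*-assoc _ _ _)))

    abstract
      scale : ∀ d → SamePoint (vx d) (vx (vertex d))
      scale d with Σ′.rep-∈ d
      ... | k , eq = subst (λ v → SamePoint (vx d) (vx v)) eq (SamePoint-iter d k)

    s : Dart → Carrier
    s d = proj₁ (scale d)

    s≉0 : ∀ d → s d ≉ 0#
    s≉0 d eq with vx-nonzero (vertex d)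
    ... | j , nz = nz (≈-trans (proj₂ (scale d) j) (≈-trans (*-congʳ eq) (zeroˡ _)))

    -- A realization fixes vectors only up to factors along an orbit, so the vector at the orbit's
    -- least dart is taken for all. Rescaling by the nonzero `s d` preserves independence on faces.
    frame : Frame
    frame = record { U = vx ∘ vertex ; U-σ = λ d → cong vx (Σ′.rep-f d) ; U-indep = indep }
      where
      indep : ∀ d k → FaceSize d k → LinIndep (λ (i : Fin k) → vx (vertex (bd d (toℕ i))))
      indep d k size c rel i = ¬≉⇒≈ λ ci≉0 → *-nonzero ci≉0 (s≉0 _)
        (face-indep d k size (λ i → c i * s (bd d (toℕ i))) (λ j → begin
          sumFin (λ i → c i * s (bd d (toℕ i)) * vx (bd d (toℕ i)) j)        ≡⟨ sumFin≡∑ n _ ⟩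
          ∑ (λ i → c i * s (bd d (toℕ i)) * vx (bd d (toℕ i)) j)             ≈⟨ ∑-cong (λ i → ≈-trans (*-assoc _ _ _) (*-congˡ (≈-sym (proj₂ (scale (bd d (toℕ i))) j)))) ⟩
          ∑ (λ i → c i * vx (vertex (bd d (toℕ i))) j)                       ≡⟨ sumFin≡∑ n _ ⟨
          sumFin (λ i → c i * vx (vertex (bd d (toℕ i))) j)                  ≈⟨ rel j ⟩
          0#                                                                 ∎) i)

    open Frame frame

    vx≈ : ∀ d j → vx d j ≈ inv (s d) (s≉0 d) * U d j
    vx≈ d j = ≈-sym (≈-trans (*-congˡ (proj₂ (scale d) j)) (≈-trans (≈-sym (*-assoc _ _ _)) (≈-trans (*-congʳ (inv-* _ _)) (*-identityˡ _))))

    abstract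
      -- The edge point has a nonzero coefficient in the collinearity relation, since the two ends
      -- are independent, and can be solved for. Neither coordinate vanishes because the point
      -- differs from both ends.
      coordinates : ∀ d → ∃₂ λ x y → x ≉ 0# × y ≉ 0# × ∀ j → ey d j ≈ lc x y d j
      coordinates d with collinear d
      ... | c , rel , i , ci≉0 = x , y , x≉0 , y≉0 , ey≈
        where
        r r′ : Carrier
        r = inv (s d) (s≉0 d)
        r′ = inv (s (αf d)) (s≉0 (αf d))
        c₀ c₁ c₂ : Carrier
        c₀ = c fz
        c₁ = c (fs fz)
        c₂ = c (fs (fs fz))
        rel′ : ∀ j → c₀ * ey d j + lc (c₁ * r) (c₂ * r′) d j ≈ 0#
        rel′ j = begin
          c₀ * ey d j + (c₁ * r * U d j + c₂ * r′ * U (αf d) j)         ≈⟨ +-congˡ (+-cong (≈-trans (*-assoc _ _ _) (*-congˡ (≈-sym (vx≈ d j))))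
                                                                             (≈-trans (*-assoc _ _ _) (*-congˡ (≈-sym (vx≈ (αf d) j))))) ⟩
          c₀ * ey d j + (c₁ * vx d j + c₂ * vx (αf d) j)                ≈⟨ +-congˡ (+-congˡ (+-identityʳ _)) ⟨
          c₀ * ey d j + (c₁ * vx d j + (c₂ * vx (αf d) j + 0#))         ≈⟨ rel j ⟩
          0#                                                            ∎
        c₀≉0 : c₀ ≉ 0#
        c₀≉0 c₀≈0 = vanish i ci≉0
          where
          zeros : c₁ * r ≈ 0# × c₂ * r′ ≈ 0#
          zeros = lc-zero d λ j → ≈-trans (≈-sym (≈-trans (+-congʳ (≈-trans (*-congʳ c₀≈0) (zeroˡ _))) (+-identityˡ _))) (rel′ j)
          vanish : ∀ i → ¬ c i ≉ 0#
          vanish fz nz = nz c₀≈0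
          vanish (fs fz) nz = *-nonzero nz (inv-nonzero _ _) (proj₁ zeros)
          vanish (fs (fs fz)) nz = *-nonzero nz (inv-nonzero _ _) (proj₂ zeros)
        q x y : Carrier
        q = - inv c₀ c₀≉0
        x = q * (c₁ * r)
        y = q * (c₂ * r′)
        ey≈ : ∀ j → ey d j ≈ lc x y d j
        ey≈ j = begin
          ey d j                                            ≈⟨ *-identityˡ _ ⟨
          1# * ey d j                                       ≈⟨ *-congʳ (inv-* c₀ c₀≉0) ⟨
          inv c₀ c₀≉0 * c₀ * ey d j                         ≈⟨ *-assoc _ _ _ ⟩
          inv c₀ c₀≉0 * (c₀ * ey d j)                       ≈⟨ *-congˡ (+-inverseˡ-unique _ _ (rel′ j)) ⟩
          inv c₀ c₀≉0 * - lc (c₁ * r) (c₂ * r′) d j         ≈⟨ -‿distribʳ-* _ _ ⟨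
          - (inv c₀ c₀≉0 * lc (c₁ * r) (c₂ * r′) d j)       ≈⟨ -‿distribˡ-* _ _ ⟩
          q * lc (c₁ * r) (c₂ * r′) d j                     ≈⟨ lc-scale _ _ _ d j ⟩
          lc x y d j                                        ∎
        multiple : ∀ z t {v : Vector} → (∀ j → v j ≈ t * U z j) → ∀ w → (∀ j → ey d j ≈ w * U z j) → SamePoint (ey d) v
        multiple z t {v} v≈ w e≈ with ey-nonzero d
        ... | j₀ , nz = t * inv w w≉0 , λ j → begin
          v j                                ≈⟨ v≈ j ⟩
          t * U z j                          ≈⟨ *-congˡ (≈-trans (*-congʳ (inv-* w w≉0)) (*-identityˡ _)) ⟨
          t * (inv w w≉0 * w * U z j)        ≈⟨ *-congˡ (*-assoc _ _ _) ⟩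
          t * (inv w w≉0 * (w * U z j))      ≈⟨ *-congˡ (*-congˡ (e≈ j)) ⟨
          t * (inv w w≉0 * ey d j)           ≈⟨ *-assoc _ _ _ ⟨
          t * inv w w≉0 * ey d j             ∎
          where
          w≉0 : w ≉ 0#
          w≉0 w≈0 = nz (≈-trans (e≈ j₀) (≈-trans (*-congʳ w≈0) (zeroˡ _)))
        x≉0 : x ≉ 0#
        x≉0 x≈0 = distinct₂ d (multiple (αf d) _ (vx≈ (αf d)) y (λ j →
          ≈-trans (ey≈ j) (≈-trans (+-congʳ (≈-trans (*-congʳ x≈0) (zeroˡ _))) (+-identityˡ _))))
        y≉0 : y ≉ 0#
        y≉0 y≈0 = distinct₁ d (multiple d _ (vx≈ d) x (λ j →
          ≈-trans (ey≈ j) (≈-trans (+-congˡ (≈-trans (*-congʳ y≈0) (zeroˡ _))) (+-identityʳ _))))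

    p a : Dart → Σ Carrier (_≉ 0#)
    p d = let x , y , x≉0 , y≉0 , _ = coordinates d in x , x≉0
    a d = let x , y , x≉0 , y≉0 , _ = coordinates d in
      - (inv x x≉0 * y) , neg-nonzero (*-nonzero (inv-nonzero x x≉0) y≉0)

    y≈ : ∀ d → proj₁ (proj₂ (coordinates d)) ≈ - (proj₁ (p d) * proj₁ (a d))
    y≈ d with coordinates d
    ... | x , y , x≉0 , y≉0 , _ = begin
      y                                ≈⟨ *-identityˡ y ⟨
      1# * y                           ≈⟨ *-congʳ (*-inv x x≉0) ⟨
      x * inv x x≉0 * y                ≈⟨ *-assoc _ _ _ ⟩
      x * (inv x x≉0 * y)              ≈⟨ -‿involutive _ ⟨
      - - (x * (inv x x≉0 * y))        ≈⟨ -‿cong (-‿distribʳ-* _ _) ⟩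
      - (x * - (inv x x≉0 * y))        ∎

    ey-lc : ∀ d j → ey d j ≈ lc (proj₁ (p d)) (- (proj₁ (p d) * proj₁ (a d))) d j
    ey-lc d j = ≈-trans (proj₂ (proj₂ (proj₂ (proj₂ (coordinates d)))) j) (lc-cong d j ≈-refl (y≈ d))

    ey≈ : ∀ d j → ey d j ≈ proj₁ (p d) * (U d j - proj₁ (a d) * U (αf d) j)
    ey≈ d j = ≈-trans (ey-lc d j) (≈-sym (≈-trans (x[y-z]≈xy-xz _ _ _)
      (+-congˡ (≈-trans (-‿cong (≈-sym (*-assoc _ _ _))) (-‿distribˡ-* _ _)))))

    -- The vectors for the two directions of an edge are proportional, and in the independent ends
    -- their coordinates can be compared; the factor `t` drops out.
    a-antisym : ∀ d → proj₁ (a d) * proj₁ (a (αf d)) ≈ 1#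
    a-antisym d with ey-wd d
    ... | t , eq = *-cancelˡ tp≉0 (begin
      tp * (A * A′)            ≈⟨ *-assoc _ _ _ ⟨
      tp * A * A′              ≈⟨ *-congʳ tpA ⟩
      - B * A′                 ≈⟨ -‿distribˡ-* _ _ ⟨
      - (B * A′)               ≈⟨ proj₁ both ⟩
      tp                       ≈⟨ *-identityʳ tp ⟨
      tp * 1#                  ∎)
      where
      A A′ B tp : Carrier
      A = proj₁ (a d)
      A′ = proj₁ (a (αf d))
      B = proj₁ (p (αf d))
      tp = t * proj₁ (p d)
      both : - (B * A′) ≈ tp × B ≈ t * - (proj₁ (p d) * A)
      both = lc-unique d λ j → begin
        lc (- (B * A′)) B d j                                ≈⟨ lc-flip _ _ d j ⟨
        lc B (- (B * A′)) (αf d) j                           ≈⟨ ey-lc (αf d) j ⟨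
        ey (αf d) j                                          ≈⟨ eq j ⟩
        t * ey d j                                           ≈⟨ *-congˡ (ey-lc d j) ⟩
        t * lc (proj₁ (p d)) (- (proj₁ (p d) * A)) d j       ≈⟨ lc-scale _ _ _ d j ⟩
        lc tp (t * - (proj₁ (p d) * A)) d j                  ∎
      tpA : tp * A ≈ - B
      tpA = begin
        t * proj₁ (p d) * A              ≈⟨ *-assoc _ _ _ ⟩
        t * (proj₁ (p d) * A)            ≈⟨ -‿involutive _ ⟨
        - - (t * (proj₁ (p d) * A))      ≈⟨ -‿cong (-‿distribʳ-* _ _) ⟩
        - (t * - (proj₁ (p d) * A))      ≈⟨ -‿cong (proj₂ both) ⟨
        - B                              ∎
      tp≉0 : tp ≉ 0#
      tp≉0 tp≈0 = proj₂ (p (αf d)) (≈-trans (≈-sym (-‿involutive B)) (≈-trans (-‿cong (≈-trans (≈-sym tpA)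
        (≈-trans (*-congʳ tp≈0) (zeroˡ A)))) -0#≈0#))

    open Sides frame ey p a ey≈ public

  module ToRealization (F : Frame) (a : Dart → Σ Carrier (_≉ 0#))
                       (a-antisym : ∀ d → proj₁ (a d) * proj₁ (a (αf d)) ≈ 1#) where
    open Frame F

    A : Dart → Carrier
    A d = proj₁ (a d)

    A≉0 : ∀ d → A d ≉ 0#
    A≉0 d = proj₂ (a d)

    a-antisym′ : ∀ d → A (αf d) * A d ≈ 1#
    a-antisym′ d = ≈-trans (*-congˡ (reflexive (cong A (sym (α-invol d))))) (a-antisym (αf d))

    e : Dart → Vector
    e d j = U d j - A d * U (αf d) j

    e-lc : ∀ d j → e d j ≈ lc 1# (- A d) d j
    e-lc d j = +-cong (≈-sym (*-identityˡ _)) (-‿distribˡ-* _ _)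

    nonzero : ∀ {v : Vector} → ¬ (∀ j → v j ≈ 0#) → NonZero v
    nonzero {v} v≉0 with lem {P = NonZero v}
    ... | yes nz = nz
    ... | no ¬nz = ⊥-elim (v≉0 (λ j → ¬≉⇒≈ (λ vj≉0 → ¬nz (j , vj≉0))))

    realization : Realization P D n
    realization = record
      { vx = U
      ; ey = e
      ; vx-nonzero = λ d → nonzero λ z → 1≉0 (proj₁ (lc-unique d λ j → ≈-trans (≈-sym (lc-10 d j)) (≈-trans (z j) (≈-sym (lc-00 d j)))))
      ; ey-nonzero = λ d → nonzero λ z → 1≉0 (proj₁ (lc-unique d λ j → ≈-trans (≈-sym (e-lc d j)) (≈-trans (z j) (≈-sym (lc-00 d j)))))
      ; vx-wd = λ d → 1# , λ j → ≈-trans (reflexive (cong (λ u → u j) (U-σ d))) (≈-sym (*-identityˡ _))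
      -- Multiplying `U d - A d * U (αf d)` by `- A (αf d)` interchanges the two ends, since
      -- `A (αf d) * A d ≈ 1#`.
      ; ey-wd = λ d → - A (αf d) , λ j → begin
          e (αf d) j                                          ≈⟨ e-lc (αf d) j ⟩
          lc 1# (- A (αf d)) (αf d) j                         ≈⟨ lc-flip _ _ d j ⟩
          lc (- A (αf d)) 1# d j                              ≈⟨ lc-cong d j (≈-sym (*-identityʳ _)) (≈-sym (≈-trans (neg-neg _ _) (a-antisym′ d))) ⟩
          lc (- A (αf d) * 1#) (- A (αf d) * - A d) d j       ≈⟨ lc-scale _ _ _ d j ⟨
          - A (αf d) * lc 1# (- A d) d j                      ≈⟨ *-congˡ (e-lc d j) ⟨
          - A (αf d) * e d j                                  ∎
      ; collinear = λ d → coef d , (λ j → begin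
          1# * e d j + (- 1# * U d j + (A d * U (αf d) j + 0#))   ≈⟨ +-cong (*-identityˡ _) (+-cong (-1*x≈-x _) (+-identityʳ _)) ⟩
          e d j + (- U d j + A d * U (αf d) j)                    ≈⟨ +-congˡ (≈-trans (+-congˡ (≈-sym (-‿involutive _))) (-‿+-comm _ _)) ⟩
          e d j - e d j                                           ≈⟨ -‿inverseʳ _ ⟩
          0#                                                      ∎) , fz , 1≉0
      ; distinct₁ = λ d (t , eq) → let _ , y≈ = lc-unique d λ j → ≈-trans (≈-sym (lc-10 d j)) (≈-trans (eq j) (scaled t d j)) in
          *-nonzero (t≉0 d t eq) (neg-nonzero (A≉0 d)) (≈-sym y≈)
      ; distinct₂ = λ d (t , eq) → let x≈ , y≈ = lc-unique d λ j → ≈-trans (≈-sym (lc-01 d j)) (≈-trans (eq j) (scaled t d j)) in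
          1≉0 (≈-trans y≈ (≈-trans (*-congʳ (≈-trans (≈-sym (*-identityʳ t)) (≈-sym x≈))) (zeroˡ _)))
      ; distinct₃ = λ d (t , eq) → 1≉0 (proj₂ (lc-unique d λ j → ≈-trans (≈-sym (lc-01 d j)) (≈-trans (eq j)
          (≈-trans (*-congˡ (lc-10 d j)) (≈-trans (lc-scale t 1# 0# d j) (lc-cong d j ≈-refl (zeroʳ t)))))))
      ; face-indep = U-indep
      }
      where
      neg-neg : ∀ x y → - x * - y ≈ x * y
      neg-neg x y = ≈-trans (≈-sym (-‿distribˡ-* _ _)) (≈-trans (-‿cong (≈-sym (-‿distribʳ-* _ _))) (-‿involutive _))
      coef : Dart → Fin 3 → Carrier
      coef d fz = 1#
      coef d (fs fz) = - 1#
      coef d (fs (fs fz)) = A d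
      scaled : ∀ t d j → t * e d j ≈ lc (t * 1#) (t * - A d) d j
      scaled t d j = ≈-trans (*-congˡ (e-lc d j)) (lc-scale _ _ _ d j)
      t≉0 : ∀ d t → (∀ j → U d j ≈ t * e d j) → t ≉ 0#
      t≉0 d t eq t≈0 = 1≉0 (proj₁ (lc-unique d λ j → ≈-trans (≈-sym (lc-10 d j))
        (≈-trans (eq j) (≈-trans (*-congʳ t≈0) (≈-trans (zeroˡ _) (≈-sym (lc-00 d j)))))))

    open Sides F e (λ _ → 1# , 1≉0) a (λ d j → ≈-sym (*-identityˡ _)) public

  -- The vertices of a face are distinct and at most `n + 1` in number, so vectors in general
  -- position, one for each `σf`-orbit, are independent on every face.
  small-faces⇒frame : (∀ (L : List Carrier) → ∃ λ x → ∀ {y} → y ∈ L → x ≉ y) → ¬ HasBigFace P D n → Frame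
  small-faces⇒frame infinite small with GeneralPosition.general-position lem D n infinite m
  ... | V , V-indep = record { U = V ∘ Σ′.rep ; U-σ = λ d → cong V (Σ′.rep-f d) ; U-indep = indep }
    where
    indep : ∀ d k → FaceSize d k → LinIndep (λ (i : Fin k) → V (Σ′.rep (bd d (toℕ i))))
    indep d k size = V-indep (ℕₚ.≮⇒≥ (λ big → small (d , k , size , big))) (λ i → Σ′.rep (bd d (toℕ i))) λ {i} {j} → rep-inj i j
      where
      rep-inj : ∀ i j → Σ′.rep (bd d (toℕ i)) ≡ Σ′.rep (bd d (toℕ j)) → i ≡ j
      rep-inj i j eq with i Finₚ.≟ j
      ... | yes i≡j = i≡j
      ... | no i≢j = ⊥-elim (face-vertices d k size i j (λ p → i≢j (Finₚ.toℕ-injective p)) (Σ′.rep-reflects eq))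

  -- More than `n + 1` vectors of length `n + 1` are dependent, so with such a face the incidence
  -- theorem holds vacuously.
  big-face⇒no-realization : HasBigFace P D n → ¬ Realization P D n
  big-face⇒no-realization (d , k , size , big) R
    with underdetermined (suc n) (λ (i : Fin k) → Realization.vx R (bd d (toℕ i))) big
  ... | c , rel , i , ci≉0 = ci≉0 (Realization.face-indep R d k size c (λ j → ≈-trans (reflexive (sumFin≡∑ n _)) (rel j)) i)

  sufficient : HasBigFace P D n ⊎ IsCommutative D ⊎ IsSphere → IncidenceTheorem P D n
  sufficient (inj₁ big) R = ⊥-elim (big-face⇒no-realization big R)
  sufficient (inj₂ hyp) R d menelaus = Flat⇒Dependent d
    (G.last-face-flat face≥2 (units-hyp hyp) a a-antisym d (λ e ¬so → Dependent⇒Flat e (menelaus e ¬so)))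
    where
    open FromRealization R
    units-hyp : IsCommutative D ⊎ IsSphere →
                (∀ (x y : Σ Carrier (_≉ 0#)) → proj₁ x * proj₁ y ≈ proj₁ y * proj₁ x) ⊎ IsSphere
    units-hyp (inj₁ comm) = inj₁ (λ x y → comm (proj₁ x) (proj₁ y))
    units-hyp (inj₂ sph) = inj₂ sph

  -- Two elements that do not commute are nonzero, so their commutator is a possible holonomy of the
  -- exceptional face; the incidence theorem for the realization of this connection forces it to be
  -- 1.
  necessary : IncidenceTheorem P D n → ¬ HasBigFace P D n → ¬ IsSphere → IsCommutative D
  necessary incidence small ¬sphere x y = ¬≉⇒≈ λ xy≉yx → commute xy≉yx
    where
    commute : x * y ≉ y * x → ⊥
    commute xy≉yx with G.last-face-commutator face≥2 ¬sphere X Y (fromℕ< nonempty)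
      where
      X Y : Σ Carrier (_≉ 0#)
      X = x , λ x≈0 → xy≉yx (≈-trans (≈-trans (*-congʳ x≈0) (zeroˡ y)) (≈-sym (≈-trans (*-congˡ x≈0) (zeroʳ y))))
      Y = y , λ y≈0 → xy≉yx (≈-trans (≈-trans (*-congˡ y≈0) (zeroʳ x)) (≈-sym (≈-trans (*-congʳ y≈0) (zeroˡ x))))
    ... | a , anti , flat , hol = xy≉yx (G.commutator≈ε⇒commute _ _ (≈-trans (≈-sym hol)
            (Dependent⇒Flat (fromℕ< nonempty) (incidence realization (fromℕ< nonempty) (λ e ¬so → Flat⇒Dependent e (flat e ¬so))))))
      where
      open ToRealization (small-faces⇒frame
        (Infinite.noncommutative⇒infinite lem D (λ comm → xy≉yx (comm x y))) small) a anti

theorem2p9 : (lem : ∀ {ℓ′} → ExcludedMiddle ℓ′) →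
    (P : PolygonalSubdivision) {c ℓ : Level} (D : DivisionRing c ℓ) (n : ℕ) → 1 ≤ n →
    IncidenceTheorem P D n ⇔
    (HasBigFace P D n ⊎ IsCommutative D ⊎ PolygonalSubdivision.IsSphere P)
theorem2p9 lem P D n _ = mk⇔ (λ incidence → cases incidence lem lem) sufficient
  where
  open Realizations lem P D n
  cases : IncidenceTheorem P D n → Dec (HasBigFace P D n) → Dec (PolygonalSubdivision.IsSphere P) →
          HasBigFace P D n ⊎ IsCommutative D ⊎ PolygonalSubdivision.IsSphere P
  cases incidence (yes big) _ = inj₁ big
  cases incidence (no _) (yes sph) = inj₂ (inj₂ sph)
  cases incidence (no small) (no ¬sph) = inj₂ (inj₁ (necessary incidence small ¬sph))
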